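{- Let $q$ be a prime power and $m\ge 1$ a natural number. Let $(T_q^m)^*$ be the group of invertible elements of the monoid $T_q^m$. Then there is an isomorphism of groups $$(T_q^m)^*\;\cong\;\prod_{k\mid m}\left(\mathcal{S}_{\pi(k)}\ltimes_\Gamma C_k^{\pi(k)}\right),$$ where the (direct) product runs over all positive divisors $k$ of $m$ and $\mathcal{S}_{\pi(k)}$ is the group of permutations of $\pi(k)$ elements.
   Context: A map $f:\mathbb{F}_{q^m}\to\mathbb{F}_{q^m}$ is called subfield preserving if $f(\mathbb{F}_q)\subseteq\mathbb{F}_q$ and, for all positive divisors $d,s$ of $m$, $f(\mathbb{F}_{q^d}\setminus\mathbb{F}_{q^s})\subseteq\mathbb{F}_{q^d}\setminus\mathbb{F}_{q^s}$. $T_q^m$ denotes the set of subfield preserving maps $f:\mathbb{F}_{q^m}\to\mathbb{F}_{q^m}$ whose polynomial representation (the unique polynomial of degree less than $q^m$ inducing $f$) has coefficients in $\mathbb{F}_q$; it is a monoid under composition. $\pi(k)$ is the number of monic irreducible polynomials of degree $k$ over $\mathbb{F}_q$, i.e. $\pi(k)=\frac1k\sum_{j\mid k}\mu(k/j)q^j$ with $\mu$ the Möbius function. $C_k$ is the cyclic group of order $k$, and $\mathcal{S}_n$ is the group (under composition) of permutations of $\{1,\dots,n\}$. Semidirect product: given monoids $M,N$ and an antihomomorphism of monoids $\Gamma:M\to\operatorname{End}(N)$, $m\mapsto\Gamma_m$ (so $\Gamma_{m_1m_2}=\Gamma_{m_2}\circ\Gamma_{m_1}$), $M\ltimes_\Gamma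 N$ is the monoid with underlying set $M\times N$ and operation $(m_1,n_1)*(m_2,n_2)=(m_1m_2,\Gamma_{m_2}(n_1)\,n_2)$. Here $\Gamma:\mathcal{S}_n\to\operatorname{End}(C_k^n)$ is given by $\Gamma_\sigma(\gamma_1,\dots,\gamma_n)=(\gamma_{\sigma(1)},\dots,\gamma_{\sigma(n)})$, with $n=\pi(k)$. -}

module Defs where

open import Algebra.Bundles using (Monoid; Group; CommutativeRing; RawSemiring)
open import Algebra.Definitions using (Invertible)
import Algebra.Definitions.RawSemiring as RawSemiringDefinitions
open import Algebra.Morphism.Structures
  using (IsGroupHomomorphism; IsGroupIsomorphism; IsRingHomomorphism)
import Algebra.Construct.Pointwise as Pointwise
import Algebra.Properties.CommutativeMonoid.Sum as Sum
import Algebra.Properties.Semiring.Exp as Exp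
open import Data.Fin.Base using (Fin; zero; suc; toℕ; fromℕ<; finToFun; funToFin; punchIn)
import Data.Fin.Properties as Fin
open import Data.Fin.Permutation as Perm using (Permutation′; _⟨$⟩ʳ_)
open import Data.Fin.Subset using (Subset; ∣_∣) renaming (_∈_ to _∈ₛ_)
open import Data.Integer.Base as ℤ using (ℤ; +_)
open import Data.Integer.Divisibility.Signed as ℤ using () renaming (_∣_ to _∣ℤ_)
import Data.Integer.Properties as ℤ
open import Data.Integer.Solver using (module +-*-Solver)
open import Data.List.Base
  using (List; []; _∷_; _++_; _∷ʳ_; length; filter; allFin; tabulate; initLast; _∷ʳ′_)
import Data.List.Properties as List
open import Data.List.Relation.Unary.All as All using (All; []; _∷_)
import Data.List.Relation.Unary.All.Properties as All
open import Data.Nat.Base as ℕ using (ℕ; zero; suc; z≤n; s≤s; _≤_; _<_)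
open import Data.Nat.Divisibility using (_∣_)
open import Data.Nat.Primality using (Prime)
import Data.Nat.Properties as ℕ
open import Data.Product.Base using (Σ; ∃; ∃-syntax; _×_; _,_; proj₁; proj₂)
open import Data.Sum.Base using (_⊎_; inj₁; inj₂)
open import Data.Vec.Functional using (Vector; removeAt)
open import Function.Base using (_∘_; id)
open import Function.Bundles using (Func; Inverse)
import Function.Construct.Composition as Compose
import Function.Construct.Identity as Identity
open import Level using (Level; _⊔_; 0ℓ) renaming (suc to lsuc)
open import Relation.Binary.Definitions using (Decidable)
open import Relation.Binary.PropositionalEquality.Core as ≡ using (_≡_; _≢_)
import Relation.Binary.PropositionalEquality.Properties as ≡
import Relation.Binary.Reasoning.Setoid as SetoidReasoning
open import Relation.Nullary.Decidable using (Dec; yes; no; map′; _×-dec_; _⊎-dec_; _→-dec_; ¬?)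
open import Relation.Nullary.Negation using (¬_; contradiction)

private
  variable
    c ℓ c′ ℓ′ i : Level
    n : ℕ

-- Polynomials in one variable, as coefficient lists a₀ ∷ a₁ ∷ ⋯ up to
-- trailing zeros.

module Polynomial (R : CommutativeRing c ℓ) where
  open CommutativeRing R hiding (zero)
  open Exp semiring using (_^_)
  open SetoidReasoning setoid

  Poly : Set c
  Poly = List Carrier

  coeff : Poly → ℕ → Carrier
  coeff []      _       = 0#
  coeff (a ∷ p) zero    = a
  coeff (a ∷ p) (suc k) = coeff p k

  infix  4 _≈ₚ_
  infixl 6 _+ₚ_
  infixl 7 _·ₚ_ _*ₚ_

  _≈ₚ_ : Poly → Poly → Set ℓ
  p ≈ₚ q = ∀ k → coeff p k ≈ coeff q k

  _+ₚ_ : Poly → Poly → Poly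
  []      +ₚ q       = q
  (a ∷ p) +ₚ []      = a ∷ p
  (a ∷ p) +ₚ (b ∷ q) = (a + b) ∷ (p +ₚ q)

  _·ₚ_ : Carrier → Poly → Poly
  a ·ₚ []      = []
  a ·ₚ (b ∷ q) = (a * b) ∷ (a ·ₚ q)

  -- (a + X p) q = a q + X (p q)
  _*ₚ_ : Poly → Poly → Poly
  []      *ₚ q = []
  (a ∷ p) *ₚ q = a ·ₚ q +ₚ (0# ∷ p *ₚ q)

  rawSemiring : RawSemiring c ℓ
  rawSemiring = record
    { Carrier = Poly ; _≈_ = _≈ₚ_ ; _+_ = _+ₚ_ ; _*_ = _*ₚ_ ; 0# = [] ; 1# = 1# ∷ [] }

  open RawSemiringDefinitions rawSemiring public
    using (Irreducible; mkIrred) renaming (_∣_ to _∣ₚ_)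

  DegreeBelow : ℕ → Poly → Set ℓ
  DegreeBelow n p = ∀ k → n ≤ k → coeff p k ≈ 0#

  eval : Poly → Carrier → Carrier
  eval []      x = 0#
  eval (a ∷ p) x = a + x * eval p x

  -- c₀ + c₁ X + ⋯ + cₖ₋₁ Xᵏ⁻¹ + Xᵏ
  monic : ∀ {k} → Vector Carrier k → Poly
  monic c = tabulate c ++ 1# ∷ []

  coeff-+ : ∀ p q k → coeff (p +ₚ q) k ≈ coeff p k + coeff q k
  coeff-+ []      q       k       = sym (+-identityˡ _)
  coeff-+ (a ∷ p) []      k       = sym (+-identityʳ _)
  coeff-+ (a ∷ p) (b ∷ q) zero    = refl
  coeff-+ (a ∷ p) (b ∷ q) (suc k) = coeff-+ p q k

  coeff-· : ∀ a p k → coeff (a ·ₚ p) k ≈ a * coeff p k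
  coeff-· a []      k       = sym (zeroʳ a)
  coeff-· a (b ∷ p) zero    = refl
  coeff-· a (b ∷ p) (suc k) = coeff-· a p k

  coeff-*-suc : ∀ a p q k → coeff ((a ∷ p) *ₚ q) (suc k) ≈ a * coeff q (suc k) + coeff (p *ₚ q) k
  coeff-*-suc a p q k = trans (coeff-+ (a ·ₚ q) _ (suc k)) (+-congʳ (coeff-· a q (suc k)))

  coeff-*-zero : ∀ a p q → coeff ((a ∷ p) *ₚ q) 0 ≈ a * coeff q 0
  coeff-*-zero a p q =
    trans (coeff-+ (a ·ₚ q) (0# ∷ p *ₚ q) 0) (trans (+-identityʳ _) (coeff-· a q 0))

  *ₚ-zeroˡ : ∀ p q → p ≈ₚ [] → p *ₚ q ≈ₚ []
  *ₚ-zeroˡ []      q p≈0 k       = refl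
  *ₚ-zeroˡ (a ∷ p) q p≈0 zero    =
    trans (coeff-*-zero a p q) (trans (*-congʳ (p≈0 0)) (zeroˡ _))
  *ₚ-zeroˡ (a ∷ p) q p≈0 (suc k) = begin
    coeff ((a ∷ p) *ₚ q) (suc k)              ≈⟨ coeff-*-suc a p q k ⟩
    a * coeff q (suc k) + coeff (p *ₚ q) k    ≈⟨ +-cong (trans (*-congʳ (p≈0 0)) (zeroˡ _)) (*ₚ-zeroˡ p q (p≈0 ∘ suc) k) ⟩
    0# + 0#                                   ≈⟨ +-identityˡ _ ⟩
    0#                                        ∎

  *ₚ-congʳ : ∀ p {q r} → q ≈ₚ r → p *ₚ q ≈ₚ p *ₚ r
  *ₚ-congʳ []              q≈r k       = refl
  *ₚ-congʳ (a ∷ p) {q} {r} q≈r zero    =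
    trans (coeff-*-zero a p q) (trans (*-congˡ (q≈r 0)) (sym (coeff-*-zero a p r)))
  *ₚ-congʳ (a ∷ p) {q} {r} q≈r (suc k) =
    trans (coeff-*-suc a p q k)
      (trans (+-cong (*-congˡ (q≈r (suc k))) (*ₚ-congʳ p q≈r k)) (sym (coeff-*-suc a p r k)))

  *ₚ-congˡ : ∀ p q r → p ≈ₚ q → p *ₚ r ≈ₚ q *ₚ r
  *ₚ-congˡ []      q       r p≈q k       = sym (*ₚ-zeroˡ q r (λ j → sym (p≈q j)) k)
  *ₚ-congˡ (a ∷ p) []      r p≈q k       = *ₚ-zeroˡ (a ∷ p) r p≈q k
  *ₚ-congˡ (a ∷ p) (b ∷ q) r p≈q zero    =
    trans (coeff-*-zero a p r) (trans (*-congʳ (p≈q 0)) (sym (coeff-*-zero b q r)))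
  *ₚ-congˡ (a ∷ p) (b ∷ q) r p≈q (suc k) =
    trans (coeff-*-suc a p r k)
      (trans (+-cong (*-congʳ (p≈q 0)) (*ₚ-congˡ p q r (p≈q ∘ suc) k)) (sym (coeff-*-suc b q r k)))

  *ₚ-cong : ∀ {p p′ q q′} → p ≈ₚ p′ → q ≈ₚ q′ → p *ₚ q ≈ₚ p′ *ₚ q′
  *ₚ-cong {p} {p′} {q} p≈p′ q≈q′ k = trans (*ₚ-congˡ p p′ q p≈p′ k) (*ₚ-congʳ p′ q≈q′ k)

  coeff-*-top : ∀ p q a b → DegreeBelow (suc a) p → DegreeBelow (suc b) q →
                coeff (p *ₚ q) (a ℕ.+ b) ≈ coeff p a * coeff q b
  coeff-*-top []       q a       b       p< q< = sym (zeroˡ _)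
  coeff-*-top (p₀ ∷ p) q zero    zero    p< q< = coeff-*-zero p₀ p q
  coeff-*-top (p₀ ∷ p) q zero    (suc b) p< q< = begin
    coeff ((p₀ ∷ p) *ₚ q) (suc b)             ≈⟨ coeff-*-suc p₀ p q b ⟩
    p₀ * coeff q (suc b) + coeff (p *ₚ q) b   ≈⟨ +-congˡ (*ₚ-zeroˡ p q (λ k → p< (suc k) (s≤s z≤n)) b) ⟩
    p₀ * coeff q (suc b) + 0#                 ≈⟨ +-identityʳ _ ⟩
    p₀ * coeff q (suc b)                      ∎
  coeff-*-top (p₀ ∷ p) q (suc a) b       p< q< = begin
    coeff ((p₀ ∷ p) *ₚ q) (suc (a ℕ.+ b))                      ≈⟨ coeff-*-suc p₀ p q (a ℕ.+ b) ⟩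
    p₀ * coeff q (suc (a ℕ.+ b)) + coeff (p *ₚ q) (a ℕ.+ b)    ≈⟨ +-cong (*-congˡ (q< _ (s≤s (ℕ.m≤n+m b a)))) (coeff-*-top p q a b (λ k a<k → p< (suc k) (s≤s a<k)) q<) ⟩
    p₀ * 0# + coeff p a * coeff q b                            ≈⟨ +-congʳ (zeroʳ p₀) ⟩
    0# + coeff p a * coeff q b                                 ≈⟨ +-identityˡ _ ⟩
    coeff p a * coeff q b                                      ∎

  length⇒DegreeBelow : ∀ p → length p ≤ n → DegreeBelow n p
  length⇒DegreeBelow []      _       k       _         = refl
  length⇒DegreeBelow (a ∷ p) (s≤s l) (suc k) (s≤s n≤k) = length⇒DegreeBelow p l k n≤k

  tabulate-≈ₚ : ∀ n p → DegreeBelow n p → (f : Vector Carrier n) →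
                (∀ j → f j ≈ coeff p (toℕ j)) → tabulate f ≈ₚ p
  tabulate-≈ₚ zero    p       p< f f≈ k       = sym (p< k z≤n)
  tabulate-≈ₚ (suc n) p       p< f f≈ zero    = f≈ zero
  tabulate-≈ₚ (suc n) []      p< f f≈ (suc k) =
    tabulate-≈ₚ n [] (λ _ _ → refl) (f ∘ suc) (f≈ ∘ suc) k
  tabulate-≈ₚ (suc n) (a ∷ p) p< f f≈ (suc k) =
    tabulate-≈ₚ n p (λ j n≤j → p< (suc j) (s≤s n≤j)) (f ∘ suc) (f≈ ∘ suc) k

  monic-below : ∀ {k} (c : Vector Carrier k) → DegreeBelow (suc k) (monic c)
  monic-below {k} c = length⇒DegreeBelow (monic c) (ℕ.≤-reflexive
    (≡.trans (List.length-++ (tabulate c))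
      (≡.trans (ℕ.+-comm _ 1) (≡.cong suc (List.length-tabulate c)))))

  monic-top : ∀ {k} (c : Vector Carrier k) → coeff (monic c) k ≡ 1#
  monic-top {zero}  c = ≡.refl
  monic-top {suc k} c = monic-top (c ∘ suc)

  eval-cong : ∀ p {x y} → x ≈ y → eval p x ≈ eval p y
  eval-cong []      x≈y = refl
  eval-cong (a ∷ p) x≈y = +-congˡ (*-cong x≈y (eval-cong p x≈y))

  eval-+ : ∀ p q x → eval (p +ₚ q) x ≈ eval p x + eval q x
  eval-+ []      q       x = sym (+-identityˡ _)
  eval-+ (a ∷ p) []      x = sym (+-identityʳ _)
  eval-+ (a ∷ p) (b ∷ q) x = begin
    (a + b) + x * eval (p +ₚ q) x               ≈⟨ +-congˡ (trans (*-congˡ (eval-+ p q x)) (distribˡ x _ _)) ⟩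
    (a + b) + (x * eval p x + x * eval q x)     ≈⟨ +-assoc a b _ ⟩
    a + (b + (x * eval p x + x * eval q x))     ≈⟨ +-congˡ (sym (+-assoc b _ _)) ⟩
    a + ((b + x * eval p x) + x * eval q x)     ≈⟨ +-congˡ (+-congʳ (+-comm b _)) ⟩
    a + ((x * eval p x + b) + x * eval q x)     ≈⟨ +-congˡ (+-assoc _ b _) ⟩
    a + (x * eval p x + (b + x * eval q x))     ≈⟨ sym (+-assoc a _ _) ⟩
    (a + x * eval p x) + (b + x * eval q x)     ∎

  eval-· : ∀ a p x → eval (a ·ₚ p) x ≈ a * eval p x
  eval-· a []      x = sym (zeroʳ a)
  eval-· a (b ∷ p) x = begin
    a * b + x * eval (a ·ₚ p) x    ≈⟨ +-congˡ (*-congˡ (eval-· a p x)) ⟩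
    a * b + x * (a * eval p x)     ≈⟨ +-congˡ (trans (sym (*-assoc x a _)) (trans (*-congʳ (*-comm x a)) (*-assoc a x _))) ⟩
    a * b + a * (x * eval p x)     ≈⟨ sym (distribˡ a _ _) ⟩
    a * (b + x * eval p x)         ∎

  eval-* : ∀ p q x → eval (p *ₚ q) x ≈ eval p x * eval q x
  eval-* []      q x = sym (zeroˡ _)
  eval-* (a ∷ p) q x = begin
    eval (a ·ₚ q +ₚ (0# ∷ p *ₚ q)) x              ≈⟨ eval-+ (a ·ₚ q) _ x ⟩
    eval (a ·ₚ q) x + (0# + x * eval (p *ₚ q) x)  ≈⟨ +-cong (eval-· a q x) (+-identityˡ _) ⟩
    a * eval q x + x * eval (p *ₚ q) x            ≈⟨ +-congˡ (trans (*-congˡ (eval-* p q x)) (sym (*-assoc x _ _))) ⟩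
    a * eval q x + (x * eval p x) * eval q x      ≈⟨ sym (distribʳ (eval q x) a _) ⟩
    (a + x * eval p x) * eval q x                 ∎

  comp : Poly → Poly → Poly
  comp []      q = []
  comp (a ∷ p) q = (a ∷ []) +ₚ q *ₚ comp p q

  eval-comp : ∀ p q x → eval (comp p q) x ≈ eval p (eval q x)
  eval-comp []      q x = refl
  eval-comp (a ∷ p) q x = begin
    eval ((a ∷ []) +ₚ q *ₚ comp p q) x           ≈⟨ eval-+ (a ∷ []) (q *ₚ comp p q) x ⟩
    (a + x * 0#) + eval (q *ₚ comp p q) x        ≈⟨ +-cong (trans (+-congˡ (zeroʳ x)) (+-identityʳ a)) (eval-* q (comp p q) x) ⟩
    a + eval q x * eval (comp p q) x             ≈⟨ +-congˡ (*-congˡ (eval-comp p q x)) ⟩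
    a + eval q x * eval p (eval q x)             ∎

  eval-∷ʳ : ∀ p t x → eval (p ∷ʳ t) x ≈ eval p x + (x ^ length p) * t
  eval-∷ʳ []      t x = begin
    t + x * 0#      ≈⟨ trans (+-congˡ (zeroʳ x)) (+-identityʳ t) ⟩
    t               ≈⟨ sym (*-identityˡ t) ⟩
    1# * t          ≈⟨ sym (+-identityˡ _) ⟩
    0# + 1# * t     ∎
  eval-∷ʳ (a ∷ p) t x = begin
    a + x * eval (p ∷ʳ t) x                          ≈⟨ +-congˡ (trans (*-congˡ (eval-∷ʳ p t x)) (distribˡ x _ _)) ⟩
    a + (x * eval p x + x * ((x ^ length p) * t))    ≈⟨ sym (+-assoc a _ _) ⟩
    (a + x * eval p x) + x * ((x ^ length p) * t)    ≈⟨ +-congˡ (sym (*-assoc x _ t)) ⟩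
    (a + x * eval p x) + (x * x ^ length p) * t      ∎

  length-∷ʳ : ∀ (p : Poly) t → length (p ∷ʳ t) ≡ suc (length p)
  length-∷ʳ p t = ≡.trans (List.length-++ p) (ℕ.+-comm _ 1)

  length-+-≤ : ∀ p q → length p ≤ n → length q ≤ n → length (p +ₚ q) ≤ n
  length-+-≤ []      q       _         q≤      = q≤
  length-+-≤ (a ∷ p) []      p≤        _       = p≤
  length-+-≤ (a ∷ p) (b ∷ q) (s≤s p≤) (s≤s q≤) = s≤s (length-+-≤ p q p≤ q≤)

record FiniteField c ℓ (n : ℕ) : Set (lsuc (c ⊔ ℓ)) where
  field
    commutativeRing : CommutativeRing c ℓ
  open CommutativeRing commutativeRing public hiding (zero)
  field
    0≉1         : ¬ 0# ≈ 1#
    inverse     : ∀ x → ¬ x ≈ 0# → ∃[ y ] x * y ≈ 1#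
    enumeration : Inverse setoid (≡.setoid (Fin n))

  index : Carrier → Fin n
  index = Inverse.to enumeration

  element : Fin n → Carrier
  element = Inverse.from enumeration

module FieldProperties {n} (F : FiniteField c ℓ n) where
  open FiniteField F
  open Polynomial commutativeRing
  open SetoidReasoning setoid
  open Exp semiring using (_^_; ^-congˡ; ^-congʳ)

  element-index : ∀ x → element (index x) ≈ x
  element-index x = Inverse.inverseʳ enumeration ≡.refl

  index-element : ∀ j → index (element j) ≡ j
  index-element j = Inverse.inverseˡ enumeration refl

  index-injective : ∀ {x y} → index x ≡ index y → x ≈ y
  index-injective {x} {y} eq = begin
    x                  ≈⟨ element-index x ⟨
    element (index x)  ≡⟨ ≡.cong element eq ⟩
    element (index y)  ≈⟨ element-index y ⟩
    y                  ∎

  infix 4 _≈?_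
  _≈?_ : Decidable _≈_
  x ≈? y = map′ index-injective (Inverse.to-cong enumeration) (index x Fin.≟ index y)

  *-nonzero : ∀ {x y} → ¬ x ≈ 0# → ¬ y ≈ 0# → ¬ x * y ≈ 0#
  *-nonzero {x} {y} x≉0 y≉0 xy≈0 = let x⁻¹ , xx⁻¹≈1 = inverse x x≉0 in y≉0 (begin
    y                ≈⟨ *-identityˡ y ⟨
    1# * y           ≈⟨ *-congʳ (trans (*-comm x⁻¹ x) xx⁻¹≈1) ⟨
    (x⁻¹ * x) * y    ≈⟨ *-assoc x⁻¹ x y ⟩
    x⁻¹ * (x * y)    ≈⟨ *-congˡ xy≈0 ⟩
    x⁻¹ * 0#         ≈⟨ zeroʳ x⁻¹ ⟩
    0#               ∎)

  *-cancelˡ : ∀ x {y z} → ¬ x ≈ 0# → x * y ≈ x * z → y ≈ z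
  *-cancelˡ x {y} {z} x≉0 eq = let x⁻¹ , xx⁻¹≈1 = inverse x x≉0
                                   x⁻¹x≈1 = trans (*-comm x⁻¹ x) xx⁻¹≈1 in begin
    y                ≈⟨ *-identityˡ y ⟨
    1# * y           ≈⟨ *-congʳ x⁻¹x≈1 ⟨
    (x⁻¹ * x) * y    ≈⟨ *-assoc x⁻¹ x y ⟩
    x⁻¹ * (x * y)    ≈⟨ *-congˡ eq ⟩
    x⁻¹ * (x * z)    ≈⟨ *-assoc x⁻¹ x z ⟨
    (x⁻¹ * x) * z    ≈⟨ *-congʳ x⁻¹x≈1 ⟩
    1# * z           ≈⟨ *-identityˡ z ⟩
    z                ∎

  2≤n : 2 ≤ n
  2≤n = distinct⇒2≤ (index 0#) (index 1#) (0≉1 ∘ index-injective)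
    where
    distinct⇒2≤ : ∀ {m} (j k : Fin m) → j ≢ k → 2 ≤ m
    distinct⇒2≤ {suc zero}    zero zero j≢k = contradiction ≡.refl j≢k
    distinct⇒2≤ {suc (suc m)} _    _    _   = s≤s (s≤s z≤n)

  private
    module Π = Sum *-commutativeMonoid

  -- `unit 0 = 1`, so that the product of all `unit x` is nonzero.
  unit : Carrier → Carrier
  unit x with x ≈? 0#
  ... | yes _ = 1#
  ... | no  _ = x

  unit-zero : ∀ {x} → x ≈ 0# → unit x ≈ 1#
  unit-zero {x} x≈0 with x ≈? 0#
  ... | yes _   = refl
  ... | no  x≉0 = contradiction x≈0 x≉0

  unit-nonzero : ∀ {x} → ¬ x ≈ 0# → unit x ≈ x
  unit-nonzero {x} x≉0 with x ≈? 0#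
  ... | yes x≈0 = contradiction x≈0 x≉0
  ... | no  _   = refl

  unit-cong : ∀ {x y} → x ≈ y → unit x ≈ unit y
  unit-cong {x} {y} x≈y with y ≈? 0#
  ... | yes y≈0 = unit-zero (trans x≈y y≈0)
  ... | no  y≉0 = trans (unit-nonzero (λ x≈0 → y≉0 (trans (sym x≈y) x≈0))) x≈y

  unit≉0 : ∀ x → ¬ unit x ≈ 0#
  unit≉0 x with x ≈? 0#
  ... | yes _   = λ 1≈0 → 0≉1 (sym 1≈0)
  ... | no  x≉0 = x≉0

  Π-nonzero : ∀ {m} (f : Vector Carrier m) → (∀ j → ¬ f j ≈ 0#) → ¬ Π.sum f ≈ 0#
  Π-nonzero {zero}  f f≉0 = λ 1≈0 → 0≉1 (sym 1≈0)
  Π-nonzero {suc m} f f≉0 = *-nonzero (f≉0 zero) (Π-nonzero (f ∘ suc) (f≉0 ∘ suc))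

  scaling : ∀ a → ¬ a ≈ 0# → Permutation′ n
  scaling a a≉0 = Perm.permutation
    (λ j → index (a * element j)) (λ j → index (a⁻¹ * element j))
    (cancels a a⁻¹ aa⁻¹≈1) (cancels a⁻¹ a (trans (*-comm a⁻¹ a) aa⁻¹≈1))
    where
    a⁻¹ = proj₁ (inverse a a≉0)
    aa⁻¹≈1 = proj₂ (inverse a a≉0)
    cancels : ∀ u v → u * v ≈ 1# → ∀ j → index (u * element (index (v * element j))) ≡ j
    cancels u v uv≈1 j = ≡.trans (Inverse.to-cong enumeration (begin
      u * element (index (v * element j))  ≈⟨ *-congˡ (element-index _) ⟩
      u * (v * element j)                  ≈⟨ *-assoc u v _ ⟨
      (u * v) * element j                  ≈⟨ *-congʳ uv≈1 ⟩
      1# * element j                       ≈⟨ *-identityˡ _ ⟩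
      element j                            ∎)) (index-element j)

  Π-scaling : ∀ a {m} → n ≡ suc m → ¬ a ≈ 0# →
              Π.sum (λ j → unit (a * element j)) ≈ (a ^ m) * Π.sum (λ j → unit (element j))
  Π-scaling a {m} ≡.refl a≉0 = begin
    Π.sum (λ j → unit (a * element j))        ≈⟨ Π.sum-cong-≋ pointwise ⟩
    Π.sum (λ j → w j * unit (element j))      ≈⟨ Π.∑-distrib-+ w (unit ∘ element) ⟩
    Π.sum w * Π.sum (unit ∘ element)          ≈⟨ *-congʳ Πw ⟩
    (a ^ m) * Π.sum (unit ∘ element)          ∎
    where
    o = index 0#
    w : Vector Carrier (suc m)
    w j with element j ≈? 0#
    ... | yes _ = 1#
    ... | no  _ = a
    pointwise : ∀ j → unit (a * element j) ≈ w j * unit (element j)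
    pointwise j with element j ≈? 0#
    ... | yes e≈0 = trans (unit-zero (trans (*-congˡ e≈0) (zeroʳ a))) (sym (*-identityˡ 1#))
    ... | no  e≉0 = unit-nonzero (*-nonzero a≉0 e≉0)
    wo : w o ≈ 1#
    wo with element o ≈? 0#
    ... | yes _   = refl
    ... | no  e≉0 = contradiction (element-index 0#) e≉0
    w-rest : ∀ j → w (punchIn o j) ≈ a
    w-rest j with element (punchIn o j) ≈? 0#
    ... | yes e≈0 = contradiction
            (≡.trans (≡.sym (index-element _)) (Inverse.to-cong enumeration e≈0))
            (Fin.punchInᵢ≢i o j)
    ... | no  _   = refl
    Πw : Π.sum w ≈ a ^ m
    Πw = begin
      Π.sum w                          ≈⟨ Π.sum-remove {i = o} w ⟩
      w o * Π.sum (removeAt w o)       ≈⟨ *-cong wo (Π.sum-cong-≋ w-rest) ⟩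
      1# * Π.sum {m} (λ _ → a)         ≈⟨ *-identityˡ _ ⟩
      Π.sum {m} (λ _ → a)              ≈⟨ Π.sum-replicate m ⟩
      a ^ m                            ∎

  fermat : ∀ x → x ^ n ≈ x
  fermat x = trans (^-congʳ x n≡1+m) (x*xᵐ≈x (x ≈? 0#))
    where
    m = ℕ.pred n
    n≡1+m : n ≡ suc m
    n≡1+m = ≡.sym (ℕ.suc-pred n ⦃ ℕ.>-nonZero (ℕ.≤-trans (s≤s z≤n) 2≤n) ⦄)
    P = Π.sum (unit ∘ element)
    xᵐ≈1 : ¬ x ≈ 0# → x ^ m ≈ 1#
    xᵐ≈1 x≉0 = *-cancelˡ P (Π-nonzero _ (λ j → unit≉0 (element j))) (begin
      P * x ^ m                                          ≈⟨ *-comm P _ ⟩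
      (x ^ m) * P                                        ≈⟨ Π-scaling x n≡1+m x≉0 ⟨
      Π.sum (λ j → unit (x * element j))                 ≈⟨ Π.sum-cong-≋ (λ j → unit-cong (element-index (x * element j))) ⟨
      Π.sum (λ j → unit (element (index (x * element j)))) ≈⟨ Π.sum-permute (unit ∘ element) (scaling x x≉0) ⟨
      P                                                  ≈⟨ *-identityʳ P ⟨
      P * 1#                                             ∎)
    x*xᵐ≈x : Dec (x ≈ 0#) → x * x ^ m ≈ x
    x*xᵐ≈x (yes x≈0) = trans (*-congʳ x≈0) (trans (zeroˡ _) (sym x≈0))
    x*xᵐ≈x (no  x≉0) = trans (*-congˡ (xᵐ≈1 x≉0)) (*-identityʳ x)

  polyOf : ∀ k → Fin (n ℕ.^ k) → Poly
  polyOf k j = tabulate {n = k} (element ∘ finToFun j)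

  polyOf-surjective : ∀ k p → DegreeBelow k p → ∃[ j ] polyOf k j ≈ₚ p
  polyOf-surjective k p p< = funToFin {k} f , tabulate-≈ₚ k p p< _ λ j → begin
    element (finToFun (funToFin f) j)  ≡⟨ ≡.cong element (Fin.finToFun-funToFin f j) ⟩
    element (f j)                      ≈⟨ element-index _ ⟩
    coeff p (toℕ j)                    ∎
    where
    f : Fin k → Fin n
    f j = index (coeff p (toℕ j))

  zeroₚ? : ∀ p → Dec (p ≈ₚ [])
  zeroₚ? []      = yes λ _ → refl
  zeroₚ? (a ∷ p) = map′
    (λ { (a≈0 , p≈0) zero → a≈0 ; (a≈0 , p≈0) (suc k) → p≈0 k })
    (λ eq → eq 0 , eq ∘ suc)
    ((a ≈? 0#) ×-dec zeroₚ? p)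

  infix 4 _≈ₚ?_
  _≈ₚ?_ : Decidable _≈ₚ_
  []      ≈ₚ? q       = map′ (λ eq k → sym (eq k)) (λ eq k → sym (eq k)) (zeroₚ? q)
  (a ∷ p) ≈ₚ? []      = zeroₚ? (a ∷ p)
  (a ∷ p) ≈ₚ? (b ∷ q) = map′
    (λ { (a≈b , p≈q) zero → a≈b ; (a≈b , p≈q) (suc k) → p≈q k })
    (λ eq → eq 0 , eq ∘ suc)
    ((a ≈? b) ×-dec (p ≈ₚ? q))

  degree : ∀ p → ¬ p ≈ₚ [] → ∃[ d ] ¬ coeff p d ≈ 0# × DegreeBelow (suc d) p
  degree []      p≉0 = contradiction (λ _ → refl) p≉0
  degree (a ∷ p) p≉0 with zeroₚ? p
  ... | no  p≉0′ = let d , top , p< = degree p p≉0′ in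
                   suc d , top , λ { (suc k) (s≤s d<k) → p< k d<k }
  ... | yes p≈0  = 0 , (λ a≈0 → p≉0 λ { zero → a≈0 ; (suc k) → p≈0 k }) ,
                   λ { (suc k) _ → p≈0 k }

  *ₚ-zeroʳ : ∀ p q → q ≈ₚ [] → p *ₚ q ≈ₚ []
  *ₚ-zeroʳ []      q q≈0 k       = refl
  *ₚ-zeroʳ (a ∷ p) q q≈0 zero    =
    trans (coeff-*-zero a p q) (trans (*-congˡ (q≈0 0)) (zeroʳ a))
  *ₚ-zeroʳ (a ∷ p) q q≈0 (suc k) = trans (coeff-*-suc a p q k)
    (trans (+-cong (trans (*-congˡ (q≈0 (suc k))) (zeroʳ a)) (*ₚ-zeroʳ p q q≈0 k)) (+-identityˡ 0#))

  factors-below : ∀ {k} p q r → ¬ r ≈ₚ [] → DegreeBelow k r → p *ₚ q ≈ₚ r →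
                  DegreeBelow k p × DegreeBelow k q
  factors-below {k} p q r r≉0 r< pq≈r =
    (λ j k≤j → p< j (ℕ.≤-trans (ℕ.≤-<-trans (ℕ.m≤m+n a b) a+b<k) k≤j)) ,
    (λ j k≤j → q< j (ℕ.≤-trans (ℕ.≤-<-trans (ℕ.m≤n+m b a) a+b<k) k≤j))
    where
    p≉0 : ¬ p ≈ₚ []
    p≉0 p≈0 = r≉0 λ j → trans (sym (pq≈r j)) (*ₚ-zeroˡ p q p≈0 j)
    q≉0 : ¬ q ≈ₚ []
    q≉0 q≈0 = r≉0 λ j → trans (sym (pq≈r j)) (*ₚ-zeroʳ p q q≈0 j)
    a = proj₁ (degree p p≉0)
    b = proj₁ (degree q q≉0)
    p< = proj₂ (proj₂ (degree p p≉0))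
    q< = proj₂ (proj₂ (degree q q≉0))
    a+b<k : a ℕ.+ b < k
    a+b<k = ℕ.≰⇒> λ k≤a+b →
      *-nonzero (proj₁ (proj₂ (degree p p≉0))) (proj₁ (proj₂ (degree q q≉0)))
        (trans (sym (coeff-*-top p q a b p< q<)) (trans (pq≈r _) (r< _ k≤a+b)))

  1ₚ≉0 : ¬ (1# ∷ []) ≈ₚ []
  1ₚ≉0 eq = 0≉1 (sym (eq 0))

  unitₚ? : ∀ p → Dec (p ∣ₚ (1# ∷ []))
  unitₚ? p = map′
    (λ { (j , eq) → record { quotient = polyOf 1 j ; equality = eq } })
    (λ { record { quotient = q ; equality = qp≈1 } →
      let q< , _ = factors-below q p (1# ∷ []) 1ₚ≉0 (length⇒DegreeBelow _ ℕ.≤-refl) qp≈1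
          j , eq = polyOf-surjective 1 q q<
      in j , λ k → trans (*ₚ-congˡ (polyOf 1 j) q p eq k) (qp≈1 k) })
    (Fin.any? λ j → (polyOf 1 j *ₚ p) ≈ₚ? (1# ∷ []))

  ∣1-resp : ∀ p q → p ≈ₚ q → p ∣ₚ (1# ∷ []) → q ∣ₚ (1# ∷ [])
  ∣1-resp p q p≈q record { quotient = r ; equality = rp≈1 } =
    record { quotient = r ; equality = λ k → trans (sym (*ₚ-congʳ r p≈q k)) (rp≈1 k) }

  irreducible? : ∀ {k} (c : Vector Carrier k) → Dec (Irreducible (monic c))
  irreducible? {k} c = map′ to from
    (¬? (unitₚ? p) ×-dec
      Fin.all? λ i → Fin.all? λ j →
        (p ≈ₚ? poly i *ₚ poly j) →-dec (unitₚ? (poly i) ⊎-dec unitₚ? (poly j)))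
    where
    p = monic c
    poly = polyOf (suc k)
    p≉0 : ¬ p ≈ₚ []
    p≉0 p≈0 = 0≉1 (sym (trans (reflexive (≡.sym (monic-top c))) (p≈0 k)))
    to : (¬ p ∣ₚ (1# ∷ [])) ×
         (∀ i j → p ≈ₚ poly i *ₚ poly j → poly i ∣ₚ (1# ∷ []) ⊎ poly j ∣ₚ (1# ∷ [])) →
         Irreducible p
    to (p∤1 , split) = mkIrred p∤1 λ {x} {y} p≈xy →
      let x< , y< = factors-below x y p p≉0 (monic-below c) (λ m → sym (p≈xy m))
          i , xᵢ≈x = polyOf-surjective (suc k) x x<
          j , yⱼ≈y = polyOf-surjective (suc k) y y<
      in resp x y i j xᵢ≈x yⱼ≈y
           (split i j λ m → trans (p≈xy m) (sym (*ₚ-cong {poly i} {x} {poly j} {y} xᵢ≈x yⱼ≈y m)))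
      where
      resp : ∀ x y i j → poly i ≈ₚ x → poly j ≈ₚ y →
             poly i ∣ₚ (1# ∷ []) ⊎ poly j ∣ₚ (1# ∷ []) → x ∣ₚ (1# ∷ []) ⊎ y ∣ₚ (1# ∷ [])
      resp x y i j xᵢ≈x yⱼ≈y (inj₁ u) = inj₁ (∣1-resp (poly i) x xᵢ≈x u)
      resp x y i j xᵢ≈x yⱼ≈y (inj₂ u) = inj₂ (∣1-resp (poly j) y yⱼ≈y u)
    from : Irreducible p →
           (¬ p ∣ₚ (1# ∷ [])) ×
           (∀ i j → p ≈ₚ poly i *ₚ poly j → poly i ∣ₚ (1# ∷ []) ⊎ poly j ∣ₚ (1# ∷ []))
    from (mkIrred p∤1 split) = p∤1 , λ i j → split {poly i} {poly j}

-- The number π(k) of monic irreducible polynomials of degree k over F; the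
-- indices j < nᵏ enumerate the tuples (c₀, …, cₖ₋₁) of lower coefficients.
π : FiniteField c ℓ n → ℕ → ℕ
π {n = n} F k =
  length (filter (λ j → irreducible? (element ∘ finToFun {n} {k} j)) (allFin (n ℕ.^ k)))
  where
  open FiniteField F
  open FieldProperties F

IsPrimePower : ℕ → Set
IsPrimePower q = ∃[ p ] ∃[ e ] Prime p × 1 ≤ e × q ≡ p ℕ.^ e

module Subfields {n} (F : FiniteField c ℓ n) where
  open FiniteField F

  _∈ᶠ_ : Carrier → Subset n → Set
  x ∈ᶠ S = index x ∈ₛ S

  record IsSubfield (S : Subset n) : Set (c ⊔ ℓ) where
    field
      0#∈       : 0# ∈ᶠ S
      1#∈       : 1# ∈ᶠ S
      +-closed  : ∀ {x y} → x ∈ᶠ S → y ∈ᶠ S → (x + y) ∈ᶠ S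
      -‿closed  : ∀ {x} → x ∈ᶠ S → (- x) ∈ᶠ S
      *-closed  : ∀ {x y} → x ∈ᶠ S → y ∈ᶠ S → (x * y) ∈ᶠ S
      ⁻¹-closed : ∀ {x y} → x ∈ᶠ S → x * y ≈ 1# → y ∈ᶠ S

  -- x ∈ 𝔽ᵣ.  A finite field has at most one subfield with r elements, so
  -- "some subfield of order r" means "the subfield of order r".
  _∈𝔽_ : Carrier → ℕ → Set (c ⊔ ℓ)
  x ∈𝔽 r = ∃[ S ] IsSubfield S × ∣ S ∣ ≡ r × x ∈ᶠ S

-- T is the monoid T_q^m of an extension ι : K → L of the field K = 𝔽_q by the
-- field L = 𝔽_{q^m}

module SubfieldPreservingMaps
  (q m : ℕ) (K : FiniteField c ℓ q) (L : FiniteField c′ ℓ′ (q ℕ.^ m))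
  (ι : FiniteField.Carrier K → FiniteField.Carrier L)
  (ι-isRingHomomorphism :
    IsRingHomomorphism (FiniteField.rawRing K) (FiniteField.rawRing L) ι) where

  private
    module K = FiniteField K
    module ι = IsRingHomomorphism ι-isRingHomomorphism
  open FiniteField L
  open FieldProperties L using (2≤n; fermat)
  open Polynomial commutativeRing
  open Subfields L
  open Exp semiring using (_^_)
  open SetoidReasoning setoid

  InBase : Carrier → Set (c ⊔ ℓ′)
  InBase x = ∃[ a ] ι a ≈ x

  record SubfieldPreserving (f : Carrier → Carrier) : Set (c ⊔ c′ ⊔ ℓ′) where
    field
      base  : ∀ {x} → InBase x → InBase (f x)
      tower : ∀ d s → d ∣ m → s ∣ m → ∀ {x} →
              x ∈𝔽 (q ℕ.^ d) × ¬ x ∈𝔽 (q ℕ.^ s) →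
              f x ∈𝔽 (q ℕ.^ d) × ¬ f x ∈𝔽 (q ℕ.^ s)

  -- The inducing polynomial of degree < q^m is unique, so it does not matter
  -- that the condition on coefficients is stated existentially.
  HasBaseCoefficients : (Carrier → Carrier) → Set (c ⊔ c′ ⊔ ℓ′)
  HasBaseCoefficients f =
    ∃[ p ] DegreeBelow (q ℕ.^ m) p × (∀ x → f x ≈ eval p x) × (∀ k → InBase (coeff p k))

  InBase-0 : InBase 0#
  InBase-0 = K.0# , ι.0#-homo

  InBase-1 : InBase 1#
  InBase-1 = K.1# , ι.1#-homo

  InBase-+ : ∀ {x y} → InBase x → InBase y → InBase (x + y)
  InBase-+ (a , a≈) (b , b≈) = a K.+ b , trans (ι.+-homo a b) (+-cong a≈ b≈)

  InBase-* : ∀ {x y} → InBase x → InBase y → InBase (x * y)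
  InBase-* (a , a≈) (b , b≈) = a K.* b , trans (ι.*-homo a b) (*-cong a≈ b≈)

  All-+ₚ : ∀ {p r} → All InBase p → All InBase r → All InBase (p +ₚ r)
  All-+ₚ []       bs       = bs
  All-+ₚ (a ∷ as) []       = a ∷ as
  All-+ₚ (a ∷ as) (b ∷ bs) = InBase-+ a b ∷ All-+ₚ as bs

  All-·ₚ : ∀ {x p} → InBase x → All InBase p → All InBase (x ·ₚ p)
  All-·ₚ x []       = []
  All-·ₚ x (a ∷ as) = InBase-* x a ∷ All-·ₚ x as

  All-*ₚ : ∀ {p r} → All InBase p → All InBase r → All InBase (p *ₚ r)
  All-*ₚ []       bs = []
  All-*ₚ (a ∷ as) bs = All-+ₚ (All-·ₚ a bs) (InBase-0 ∷ All-*ₚ as bs)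

  All-comp : ∀ {p r} → All InBase p → All InBase r → All InBase (comp p r)
  All-comp []       bs = []
  All-comp (a ∷ as) bs = All-+ₚ (a ∷ []) (All-*ₚ bs (All-comp as bs))

  All-coeff : ∀ {p} → All InBase p → ∀ k → InBase (coeff p k)
  All-coeff []       k       = InBase-0
  All-coeff (a ∷ as) zero    = a
  All-coeff (a ∷ as) (suc k) = All-coeff as k

  coeff-All : ∀ p → (∀ k → InBase (coeff p k)) → All InBase p
  coeff-All []      h = []
  coeff-All (a ∷ p) h = h 0 ∷ coeff-All p (h ∘ suc)

  -- Reduction modulo X^(q^m) − X.
  reduce : ∀ {p} → All InBase p →
           ∃[ r ] length r ≤ q ℕ.^ m × All InBase r × (∀ x → eval r x ≈ eval p x)
  reduce             []       = [] , z≤n , [] , λ _ → refl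
  reduce {p = a ∷ p} (b ∷ bs) with reduce bs
  ... | r , r≤ , rs , r≈p with length (a ∷ r) ℕ.≤? q ℕ.^ m
  ...   | yes ar≤ = a ∷ r , ar≤ , b ∷ rs , λ x → +-congˡ (*-congˡ (r≈p x))
  ...   | no  ar≰ with initLast r
  ...     | [] = contradiction (ℕ.≤-trans (s≤s z≤n) 2≤n) ar≰
  ...     | s ∷ʳ′ t = as +ₚ (0# ∷ t ∷ []) , length-+-≤ as (0# ∷ t ∷ []) as≤ 2≤n ,
                      All-+ₚ (b ∷ ss) (InBase-0 ∷ t∈ ∷ []) , reduced
    where
    as = a ∷ s
    ss = All.++⁻ˡ s rs
    t∈ : InBase t
    t∈ = All.head (All.++⁻ʳ s rs)
    as≤ : length as ≤ q ℕ.^ m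
    as≤ = ≡.subst (_≤ q ℕ.^ m) (length-∷ʳ s t) r≤
    as≡ : length as ≡ q ℕ.^ m
    as≡ = ℕ.≤-antisym as≤ (ℕ.s≤s⁻¹
      (≡.subst (λ l → suc (q ℕ.^ m) ≤ suc l) (length-∷ʳ s t) (ℕ.≰⇒> ar≰)))
    reduced : ∀ x → eval (as +ₚ (0# ∷ t ∷ [])) x ≈ a + x * eval p x
    reduced x = begin
      eval (as +ₚ (0# ∷ t ∷ [])) x              ≈⟨ eval-+ as (0# ∷ t ∷ []) x ⟩
      eval as x + (0# + x * (t + x * 0#))       ≈⟨ +-congˡ (trans (+-identityˡ _) (*-congˡ (trans (+-congˡ (zeroʳ x)) (+-identityʳ t)))) ⟩
      eval as x + x * t                         ≈⟨ +-congˡ (*-congʳ (fermat x)) ⟨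
      eval as x + (x ^ (q ℕ.^ m)) * t           ≡⟨ ≡.cong (λ l → eval as x + (x ^ l) * t) as≡ ⟨
      eval as x + (x ^ length as) * t           ≈⟨ eval-∷ʳ as t x ⟨
      a + x * eval (s ∷ʳ t) x                   ≈⟨ +-congˡ (*-congˡ (r≈p x)) ⟩
      a + x * eval p x                          ∎

  HasBaseCoefficients-∘ : ∀ {f g} → HasBaseCoefficients f → HasBaseCoefficients g →
                          HasBaseCoefficients (f ∘ g)
  HasBaseCoefficients-∘ {f} {g} (p , _ , f≈ , p∈) (r , _ , g≈ , r∈) =
    let s , s≤ , s∈ , s≈ = reduce (All-comp (coeff-All p p∈) (coeff-All r r∈)) in
    s , length⇒DegreeBelow s s≤ ,
    (λ x → begin
      f (g x)            ≈⟨ f≈ (g x) ⟩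
      eval p (g x)       ≈⟨ eval-cong p (g≈ x) ⟩
      eval p (eval r x)  ≈⟨ eval-comp p r x ⟨
      eval (comp p r) x  ≈⟨ s≈ x ⟨
      eval s x           ∎) ,
    All-coeff s∈

  HasBaseCoefficients-id : HasBaseCoefficients id
  HasBaseCoefficients-id = X , length⇒DegreeBelow X 2≤n ,
    (λ x → sym (begin
      0# + x * (1# + x * 0#)  ≈⟨ +-identityˡ _ ⟩
      x * (1# + x * 0#)       ≈⟨ *-congˡ (trans (+-congˡ (zeroʳ x)) (+-identityʳ 1#)) ⟩
      x * 1#                  ≈⟨ *-identityʳ x ⟩
      x                       ∎)) ,
    All-coeff (InBase-0 ∷ InBase-1 ∷ [])
    where
    X : Poly
    X = 0# ∷ 1# ∷ []

  record Map : Set (c ⊔ c′ ⊔ ℓ′) where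
    field
      func                : Func setoid setoid
      subfieldPreserving  : SubfieldPreserving (Func.to func)
      hasBaseCoefficients : HasBaseCoefficients (Func.to func)

    infix 5 _⟨$⟩_
    _⟨$⟩_ : Carrier → Carrier
    _⟨$⟩_ = Func.to func

  open Map using (_⟨$⟩_)

  infixr 9 _∘ₜ_
  _∘ₜ_ : Map → Map → Map
  f ∘ₜ g = record
    { func                = Compose.function (Map.func g) (Map.func f)
    ; subfieldPreserving  = record
      { base  = F.base ∘ G.base
      ; tower = λ d s d∣m s∣m → F.tower d s d∣m s∣m ∘ G.tower d s d∣m s∣m
      }
    ; hasBaseCoefficients =
        HasBaseCoefficients-∘ {f ⟨$⟩_} {g ⟨$⟩_} (Map.hasBaseCoefficients f) (Map.hasBaseCoefficients g)
    }
    where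
    module F = SubfieldPreserving (Map.subfieldPreserving f)
    module G = SubfieldPreserving (Map.subfieldPreserving g)

  idₜ : Map
  idₜ = record
    { func                = Identity.function setoid
    ; subfieldPreserving  = record { base = id ; tower = λ _ _ _ _ → id }
    ; hasBaseCoefficients = HasBaseCoefficients-id
    }

  T : Monoid (c ⊔ c′ ⊔ ℓ′) (c′ ⊔ ℓ′)
  T = record
    { Carrier  = Map
    ; _≈_      = λ f g → ∀ x → (f ⟨$⟩ x) ≈ (g ⟨$⟩ x)
    ; _∙_      = _∘ₜ_
    ; ε        = idₜ
    ; isMonoid = record
      { isSemigroup = record
        { isMagma = record
          { isEquivalence = record
            { refl  = λ _ → refl
            ; sym   = λ f≈g x → sym (f≈g x)
            ; trans = λ f≈g g≈h x → trans (f≈g x) (g≈h x)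
            }
          ; ∙-cong = λ {f} {f′} {g} {g′} f≈f′ g≈g′ x →
              trans (f≈f′ (g ⟨$⟩ x)) (Func.cong (Map.func f′) (g≈g′ x))
          }
        ; assoc = λ _ _ _ _ → refl
        }
      ; identity = (λ _ _ → refl) , (λ _ _ → refl)
      }
    }

infix 4 _≅_
_≅_ : Group c ℓ → Group c′ ℓ′ → Set (c ⊔ ℓ ⊔ c′ ⊔ ℓ′)
G ≅ H = ∃[ φ ] IsGroupIsomorphism (Group.rawGroup G) (Group.rawGroup H) φ

_ˣ : Monoid c ℓ → Group (c ⊔ ℓ) ℓ
M ˣ = record
  { Carrier = Σ Carrier (Invertible _≈_ ε _∙_)
  ; _≈_     = λ u v → proj₁ u ≈ proj₁ v
  ; _∙_     = λ { (x , x⁻¹ , x⁻¹x , xx⁻¹) (y , y⁻¹ , y⁻¹y , yy⁻¹) →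
                x ∙ y , y⁻¹ ∙ x⁻¹ , cancel x⁻¹x y⁻¹y , cancel yy⁻¹ xx⁻¹ }
  ; ε       = ε , ε , identityˡ ε , identityˡ ε
  ; _⁻¹     = λ { (x , x⁻¹ , x⁻¹x , xx⁻¹) → x⁻¹ , x , xx⁻¹ , x⁻¹x }
  ; isGroup = record
    { isMonoid = record
      { isSemigroup = record
        { isMagma = record
          { isEquivalence = record { refl = refl ; sym = sym ; trans = trans }
          ; ∙-cong        = ∙-cong
          }
        ; assoc = λ u v w → assoc (proj₁ u) (proj₁ v) (proj₁ w)
        }
      ; identity = (λ u → identityˡ (proj₁ u)) , (λ u → identityʳ (proj₁ u))
      }
    ; inverse = (λ { (_ , _ , x⁻¹x , _) → x⁻¹x }) , (λ { (_ , _ , _ , xx⁻¹) → xx⁻¹ })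
    ; ⁻¹-cong = λ { {x , x⁻¹ , x⁻¹x , xx⁻¹} {y , y⁻¹ , y⁻¹y , yy⁻¹} x≈y → begin
        x⁻¹                ≈⟨ identityʳ x⁻¹ ⟨
        x⁻¹ ∙ ε            ≈⟨ ∙-congˡ yy⁻¹ ⟨
        x⁻¹ ∙ (y ∙ y⁻¹)    ≈⟨ ∙-congˡ (∙-congʳ x≈y) ⟨
        x⁻¹ ∙ (x ∙ y⁻¹)    ≈⟨ assoc x⁻¹ x y⁻¹ ⟨
        (x⁻¹ ∙ x) ∙ y⁻¹    ≈⟨ ∙-congʳ x⁻¹x ⟩
        ε ∙ y⁻¹            ≈⟨ identityˡ y⁻¹ ⟩
        y⁻¹                ∎ }
    }
  }
  where
  open Monoid M
  open SetoidReasoning setoid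
  cancel : ∀ {a b x y} → a ∙ x ≈ ε → b ∙ y ≈ ε → (b ∙ a) ∙ (x ∙ y) ≈ ε
  cancel {a} {b} {x} {y} ax by = begin
    (b ∙ a) ∙ (x ∙ y)    ≈⟨ assoc b a _ ⟩
    b ∙ (a ∙ (x ∙ y))    ≈⟨ ∙-congˡ (assoc a x y) ⟨
    b ∙ ((a ∙ x) ∙ y)    ≈⟨ ∙-congˡ (∙-congʳ ax) ⟩
    b ∙ (ε ∙ y)          ≈⟨ ∙-congˡ (identityˡ y) ⟩
    b ∙ y                ≈⟨ by ⟩
    ε                    ∎

∏ : (I : Set i) → (I → Group c ℓ) → Group (i ⊔ c) (i ⊔ ℓ)
∏ I G = record
  { Carrier = ∀ j → Carrier (G j)
  ; _≈_     = λ x y → ∀ j → _≈_ (G j) (x j) (y j)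
  ; _∙_     = λ x y j → _∙_ (G j) (x j) (y j)
  ; ε       = λ j → ε (G j)
  ; _⁻¹     = λ x j → _⁻¹ (G j) (x j)
  ; isGroup = record
    { isMonoid = record
      { isSemigroup = record
        { isMagma = record
          { isEquivalence = record
            { refl  = λ j → refl (G j)
            ; sym   = λ x≈y j → sym (G j) (x≈y j)
            ; trans = λ x≈y y≈z j → trans (G j) (x≈y j) (y≈z j)
            }
          ; ∙-cong = λ x≈y u≈v j → ∙-cong (G j) (x≈y j) (u≈v j)
          }
        ; assoc = λ x y z j → assoc (G j) (x j) (y j) (z j)
        }
      ; identity = (λ x j → identityˡ (G j) (x j)) , (λ x j → identityʳ (G j) (x j))
      }
    ; inverse = (λ x j → inverseˡ (G j) (x j)) , (λ x j → inverseʳ (G j) (x j))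
    ; ⁻¹-cong = λ x≈y j → ⁻¹-cong (G j) (x≈y j)
    }
  }
  where open Group

-- Γ is an antihomomorphism of monoids from M to End(N).
record IsAntiAction (M : Group c ℓ) (N : Group c′ ℓ′)
  (Γ : Group.Carrier M → Group.Carrier N → Group.Carrier N) : Set (c ⊔ ℓ ⊔ c′ ⊔ ℓ′) where
  private
    module M = Group M
    module N = Group N
  field
    isEndomorphism : ∀ σ → IsGroupHomomorphism N.rawGroup N.rawGroup (Γ σ)
    Γ-cong         : ∀ {σ τ} → σ M.≈ τ → ∀ x → Γ σ x N.≈ Γ τ x
    Γ-ε            : ∀ x → Γ M.ε x N.≈ x
    Γ-∙            : ∀ σ τ x → Γ (σ M.∙ τ) x N.≈ Γ τ (Γ σ x)

semidirect : (M : Group c ℓ) (N : Group c′ ℓ′)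
             (Γ : Group.Carrier M → Group.Carrier N → Group.Carrier N) →
             IsAntiAction M N Γ → Group (c ⊔ c′) (ℓ ⊔ ℓ′)
semidirect M N Γ isAntiAction = record
  { Carrier = M.Carrier × N.Carrier
  ; _≈_     = λ { (σ , x) (τ , y) → (σ M.≈ τ) × (x N.≈ y) }
  ; _∙_     = λ { (σ , x) (τ , y) → σ M.∙ τ , Γ τ x N.∙ y }
  ; ε       = M.ε , N.ε
  ; _⁻¹     = λ { (σ , x) → σ M.⁻¹ , Γ (σ M.⁻¹) (x N.⁻¹) }
  ; isGroup = record
    { isMonoid = record
      { isSemigroup = record
        { isMagma = record
          { isEquivalence = record
            { refl  = M.refl , N.refl
            ; sym   = λ { (p , q) → M.sym p , N.sym q }
            ; trans = λ { (p , q) (r , s) → M.trans p r , N.trans q s }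
            }
          ; ∙-cong = λ { {σ , x} {σ′ , x′} {τ , y} {τ′ , y′} (p , q) (r , s) →
              M.∙-cong p r , N.∙-cong (N.trans (Γ-cong r x) (⟦⟧-cong τ′ q)) s }
          }
        ; assoc = λ { (σ , x) (τ , y) (υ , z) → M.assoc σ τ υ , (begin
            Γ υ (Γ τ x N.∙ y) N.∙ z             ≈⟨ N.∙-congʳ (homo υ (Γ τ x) y) ⟩
            (Γ υ (Γ τ x) N.∙ Γ υ y) N.∙ z       ≈⟨ N.assoc _ _ _ ⟩
            Γ υ (Γ τ x) N.∙ (Γ υ y N.∙ z)       ≈⟨ N.∙-congʳ (Γ-∙ τ υ x) ⟨
            Γ (τ M.∙ υ) x N.∙ (Γ υ y N.∙ z)     ∎) }
        }
      ; identity =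
          (λ { (σ , x) → M.identityˡ σ , N.trans (N.∙-congʳ (ε-homo σ)) (N.identityˡ x) }) ,
          (λ { (σ , x) → M.identityʳ σ , N.trans (N.identityʳ _) (Γ-ε x) })
      }
    ; inverse =
        (λ { (σ , x) → M.inverseˡ σ , (begin
          Γ σ (Γ (σ M.⁻¹) (x N.⁻¹)) N.∙ x    ≈⟨ N.∙-congʳ (Γ-∙ (σ M.⁻¹) σ _) ⟨
          Γ (σ M.⁻¹ M.∙ σ) (x N.⁻¹) N.∙ x    ≈⟨ N.∙-congʳ (N.trans (Γ-cong (M.inverseˡ σ) _) (Γ-ε _)) ⟩
          x N.⁻¹ N.∙ x                       ≈⟨ N.inverseˡ x ⟩
          N.ε                                ∎) }) ,
        (λ { (σ , x) → M.inverseʳ σ , (begin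
          Γ (σ M.⁻¹) x N.∙ Γ (σ M.⁻¹) (x N.⁻¹)  ≈⟨ homo (σ M.⁻¹) x (x N.⁻¹) ⟨
          Γ (σ M.⁻¹) (x N.∙ x N.⁻¹)             ≈⟨ ⟦⟧-cong (σ M.⁻¹) (N.inverseʳ x) ⟩
          Γ (σ M.⁻¹) N.ε                        ≈⟨ ε-homo (σ M.⁻¹) ⟩
          N.ε                                   ∎) })
    ; ⁻¹-cong = λ { {σ , x} {τ , y} (p , q) →
        M.⁻¹-cong p , N.trans (Γ-cong (M.⁻¹-cong p) _) (⟦⟧-cong (τ M.⁻¹) (N.⁻¹-cong q)) }
    }
  }
  where
  module M = Group M
  module N = Group N
  open IsAntiAction isAntiAction
  open module End σ = IsGroupHomomorphism (isEndomorphism σ) using (⟦⟧-cong; homo; ε-homo)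
  open SetoidReasoning N.setoid

-- Permutations of Fin n, with (σ ∙ τ) j = σ (τ j).
𝒮 : ℕ → Group 0ℓ 0ℓ
𝒮 n = record
  { Carrier = Permutation′ n
  ; _≈_     = Perm._≈_
  ; _∙_     = λ σ τ → τ Perm.∘ₚ σ
  ; ε       = Perm.id
  ; _⁻¹     = Perm.flip
  ; isGroup = record
    { isMonoid = record
      { isSemigroup = record
        { isMagma = record
          { isEquivalence = record
            { refl  = λ _ → ≡.refl
            ; sym   = λ σ≈τ j → ≡.sym (σ≈τ j)
            ; trans = λ σ≈τ τ≈υ j → ≡.trans (σ≈τ j) (τ≈υ j)
            }
          ; ∙-cong = λ {σ} {σ′} {τ} {τ′} σ≈σ′ τ≈τ′ j →
              ≡.trans (σ≈σ′ (τ ⟨$⟩ʳ j)) (≡.cong (σ′ ⟨$⟩ʳ_) (τ≈τ′ j))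
          }
        ; assoc = λ _ _ _ _ → ≡.refl
        }
      ; identity = (λ _ _ → ≡.refl) , (λ _ _ → ≡.refl)
      }
    ; inverse = (λ σ _ → Perm.inverseˡ σ) , (λ σ _ → Perm.inverseʳ σ)
    ; ⁻¹-cong = λ {σ} {τ} σ≈τ j → ≡.trans
        (≡.cong (Perm._⟨$⟩ˡ_ σ)
          (≡.sym (≡.trans (σ≈τ (Perm._⟨$⟩ˡ_ τ j)) (Perm.inverseʳ τ))))
        (Perm.inverseˡ σ)
    }
  }

-- The cyclic group of order k, as ℤ modulo k.
C : ℕ → Group 0ℓ 0ℓ
C k = record
  { Carrier = ℤ
  ; _≈_     = λ x y → + k ∣ℤ (x ℤ.- y)
  ; _∙_     = ℤ._+_
  ; ε       = + 0
  ; _⁻¹     = ℤ.-_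
  ; isGroup = record
    { isMonoid = record
      { isSemigroup = record
        { isMagma = record
          { isEquivalence = record
            { refl  = λ {x} → ≈-reflexive {x} ≡.refl
            ; sym   = λ {x} {y} p → via (ℤ.∣m⇒∣-m p)
                (solve 2 (λ x y → :- (x :- y) := y :- x) ≡.refl x y)
            ; trans = λ {x} {y} {z} p r → via (ℤ.∣m∣n⇒∣m+n p r)
                (solve 3 (λ x y z → (x :- y) :+ (y :- z) := x :- z) ≡.refl x y z)
            }
          ; ∙-cong = λ {x} {y} {u} {v} p r → via (ℤ.∣m∣n⇒∣m+n p r)
              (solve 4 (λ x y u v → (x :- y) :+ (u :- v) := (x :+ u) :- (y :+ v)) ≡.refl x y u v)
          }
        ; assoc = λ x y z → ≈-reflexive (ℤ.+-assoc x y z)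
        }
      ; identity = (λ x → ≈-reflexive (ℤ.+-identityˡ x)) , (λ x → ≈-reflexive (ℤ.+-identityʳ x))
      }
    ; inverse = (λ x → ≈-reflexive (ℤ.+-inverseˡ x)) , (λ x → ≈-reflexive (ℤ.+-inverseʳ x))
    ; ⁻¹-cong = λ {x} {y} p → via (ℤ.∣m⇒∣-m p)
        (solve 2 (λ x y → :- (x :- y) := (:- x) :- (:- y)) ≡.refl x y)
    }
  }
  where
  open +-*-Solver
  via : ∀ {x y} → + k ∣ℤ x → x ≡ y → + k ∣ℤ y
  via p eq = ≡.subst (+ k ∣ℤ_) eq p
  ≈-reflexive : ∀ {x y} → x ≡ y → + k ∣ℤ (x ℤ.- y)
  ≈-reflexive {x} ≡.refl = record { quotient = + 0 ; equality = ℤ.+-inverseʳ x }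

C^ : ℕ → ℕ → Group 0ℓ 0ℓ
C^ k n = Pointwise.group (Fin n) (C k)

Γ : ∀ {k n} → Permutation′ n → Group.Carrier (C^ k n) → Group.Carrier (C^ k n)
Γ σ γ = γ ∘ (σ ⟨$⟩ʳ_)

Γ-isAntiAction : ∀ k n → IsAntiAction (𝒮 n) (C^ k n) (Γ {k})
Γ-isAntiAction k n = record
  { isEndomorphism = λ σ → record
    { isMonoidHomomorphism = record
      { isMagmaHomomorphism = record
        { isRelHomomorphism = record { cong = λ γ≈δ j → γ≈δ (σ ⟨$⟩ʳ j) }
        ; homo              = λ γ δ j → refl {γ (σ ⟨$⟩ʳ j) ℤ.+ δ (σ ⟨$⟩ʳ j)}
        }
      ; ε-homo = λ _ → refl {+ 0}
      }
    ; ⁻¹-homo = λ γ j → refl {ℤ.- γ (σ ⟨$⟩ʳ j)}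
    }
  ; Γ-cong = λ σ≈τ γ j → reflexive (≡.cong γ (σ≈τ j))
  ; Γ-ε    = λ γ j → refl {γ j}
  ; Γ-∙    = λ σ τ γ j → refl {γ (σ ⟨$⟩ʳ (τ ⟨$⟩ʳ j))}
  }
  where open Group (C k)

𝒮⋉C^ : ℕ → ℕ → Group 0ℓ 0ℓ
𝒮⋉C^ n k = semidirect (𝒮 n) (C^ k n) (Γ {k}) (Γ-isAntiAction k n)

-- For m ≥ 1 the type k ∣ m has at most one element, so each divisor occurs
-- exactly once.
Divisor : ℕ → Set
Divisor m = ∃[ k ] k ∣ m

{-# OPTIONS --safe #-}

-- Let φ be the map x ↦ x^q on L.  A map has a polynomial representation over
-- K exactly when it commutes with φ, and the elements of 𝔽_{q^d} are those
-- fixed by φ^d, so the invertible elements of T are the permutations of L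
-- commuting with φ.  The orbits of φ of length k are the root sets of the
-- monic irreducible polynomials of degree k over K.  Choosing a root b_j of
-- each such polynomial P_j, a permutation f commuting with φ is given by
-- f(b_j) = φ^(γ_j) b_(σ j) with σ a permutation and γ_j determined modulo k,
-- and (f ∘ f′)(b_j) = φ^(γ_(σ′ j) + γ′_j) b_(σ σ′ j) is the product in the
-- semidirect product.

module Submission where

open import Defs
open import Algebra.Bundles using (CommutativeRing; CommutativeMonoid; RawRing; Group)
import Algebra.Morphism.RingMonomorphism as RingMonomorphism
open import Algebra.Morphism.Structures using (IsRingHomomorphism; IsRingMonomorphism)
import Algebra.Properties.AbelianGroup as AbelianGroupProperties
import Algebra.Properties.CommutativeSemigroup as CommutativeSemigroupProperties
import Algebra.Properties.CommutativeSemiring.Exp as Exp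
import Algebra.Properties.Group as GroupProperties
import Algebra.Properties.Ring as RingProperties
open import Data.Fin.Base using (Fin; zero; suc; toℕ; fromℕ<; finToFun; funToFin; combine; punchOut)
open import Data.Fin.Permutation as Perm using (_⟨$⟩ʳ_)
import Data.Fin.Properties as Fin
open import Data.Fin.Subset using (Subset; ∣_∣; inside; outside; ∁) renaming (_∈_ to _∈ₛ_)
import Data.Fin.Subset.Properties as Subset
open import Data.Integer.Base as ℤ using (ℤ; +_)
open import Data.Integer.DivMod using (_%ℕ_; _/ℕ_; a≡a%ℕn+[a/ℕn]*n)
open import Data.Integer.Divisibility.Signed as ℤ using () renaming (_∣_ to _∣ℤ_)
import Data.Integer.Properties as ℤ
open import Data.List.Base using (List; []; _∷_; map; lookup; tabulate; filter; allFin)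
import Data.List.Membership.Propositional as Membership
open import Data.List.Membership.Propositional.Properties
  using (∈-lookup; ∈-filter⁺; ∈-filter⁻; ∈-allFin)
import Data.List.Properties as List
open import Data.List.Relation.Unary.All as All using (All; []; _∷_)
open import Data.List.Relation.Unary.AllPairs using ([]; _∷_)
import Data.List.Relation.Unary.Any as Any
open import Data.List.Relation.Unary.Any.Properties using (lookup-index)
open import Data.List.Relation.Unary.Unique.Propositional using (Unique)
open import Data.List.Relation.Unary.Unique.Propositional.Properties using (filter⁺; allFin⁺)
open import Data.Nat.Base as ℕ using (ℕ; zero; suc; z≤n; s≤s; _≤_; _<_)
open import Data.Nat.DivMod using (_%_; _/_; m≡m%n+[m/n]*n; m%n<n)
open import Data.Nat.Divisibility using (_∣_; divides; ∣⇒≤; ∣-antisym; m%n≡0⇒n∣m; >⇒∤; 0∣⇒≡0)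
import Data.Nat.Properties as ℕ
open import Data.Product.Base using (Σ; ∃-syntax; _×_; _,_; proj₁; proj₂)
open import Data.Sum.Base using (_⊎_; inj₁; inj₂)
import Data.Vec.Base as Vec
open import Data.Vec.Functional using (Vector)
import Data.Vec.Properties as Vec
open import Function.Base using (_∘_; id)
open import Function.Bundles using (Inverse; Func)
open import Function.Definitions using (Injective)
open import Level using (Level; _⊔_)
open import Relation.Binary.Bundles using (Setoid)
open import Relation.Binary.Definitions using (tri<; tri≈; tri>)
open import Relation.Binary.PropositionalEquality as ≡ using (_≡_; _≢_)
import Relation.Binary.Reasoning.Setoid as SetoidReasoning
open import Relation.Nullary.Decidable using (Dec; yes; no; does)
open import Relation.Nullary.Negation using (¬_; contradiction)

-- The field `L` is given only by its order q^m and a homomorphism from `K`, so the orbits have to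
-- be found by counting roots. A monic irreducible P of degree k dividing m has a root: K[X]/(P) is
-- a field with q^k elements, Fermat's theorem there gives X^(q^k) ≡ X modulo P, hence P divides
-- X^(q^m) - X, and the cofactor has too few roots to account for all of `L`. The root has period k
-- and no less: its q^k polynomial expressions of degree below k are distinct, and a power φ^e
-- fixing the root fixes them all, while φ^e with e ≥ 1 has at most q^e fixed points.
--
-- The relation `f ⊩ g` links maps and elements of the product: f takes on each b_j the value
-- prescribed by g. It respects composition, f determines g, and g determines f among the maps
-- commuting with φ. The laws of the isomorphism are read off from this relation instead of from the
-- coordinates, whose exponents are chosen arbitrarily modulo the period.

private
  variable
    α c ℓ c′ ℓ′ : Level

-- The ring of polynomials

module PolynomialRing (R : CommutativeRing c ℓ) where
  open CommutativeRing R hiding (zero)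
  open Polynomial R hiding (rawSemiring)
  open RingProperties ring using (-0#≈0#; +-inverseʳ-unique)

  infix 4 _≋_
  -- A record, so that p and q can be inferred from a proof of p ≋ q.
  record _≋_ (p q : Poly) : Set ℓ where
    constructor coefficientwise
    field coeff-≈ : p ≈ₚ q
  open _≋_ public

  ≋-setoid : Setoid c ℓ
  ≋-setoid = record
    { Carrier       = Poly
    ; _≈_           = _≋_
    ; isEquivalence = record
      { refl  = coefficientwise λ _ → refl
      ; sym   = λ p≋q → coefficientwise λ k → sym (coeff-≈ p≋q k)
      ; trans = λ p≋q q≋r → coefficientwise λ k → trans (coeff-≈ p≋q k) (coeff-≈ q≋r k)
      }
    }
  private
    module ≋ = Setoid ≋-setoid

  -ₚ_ : Poly → Poly
  -ₚ_ = map (-_)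

  coeff-neg : ∀ p k → coeff (-ₚ p) k ≈ - coeff p k
  coeff-neg []      k       = sym -0#≈0#
  coeff-neg (a ∷ p) zero    = refl
  coeff-neg (a ∷ p) (suc k) = coeff-neg p k

  ∷-cong : ∀ {a b p q} → a ≈ b → p ≋ q → (a ∷ p) ≋ (b ∷ q)
  ∷-cong a≈b p≋q = coefficientwise λ { zero → a≈b ; (suc k) → coeff-≈ p≋q k }

  0∷[]≋[] : (0# ∷ []) ≋ []
  0∷[]≋[] = coefficientwise λ { zero → refl ; (suc k) → refl }

  module _ where
    open SetoidReasoning setoid

    +ₚ-cong : ∀ {p p′ q q′} → p ≋ p′ → q ≋ q′ → p +ₚ q ≋ p′ +ₚ q′
    +ₚ-cong {p} {p′} {q} {q′} p≋ q≋ = coefficientwise λ k → begin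
      coeff (p +ₚ q) k           ≈⟨ coeff-+ p q k ⟩
      coeff p k + coeff q k      ≈⟨ +-cong (coeff-≈ p≋ k) (coeff-≈ q≋ k) ⟩
      coeff p′ k + coeff q′ k    ≈⟨ coeff-+ p′ q′ k ⟨
      coeff (p′ +ₚ q′) k         ∎

    +ₚ-assoc : ∀ p q r → (p +ₚ q) +ₚ r ≋ p +ₚ (q +ₚ r)
    +ₚ-assoc p q r = coefficientwise λ k → begin
      coeff ((p +ₚ q) +ₚ r) k                ≈⟨ coeff-+ (p +ₚ q) r k ⟩
      coeff (p +ₚ q) k + coeff r k           ≈⟨ +-congʳ (coeff-+ p q k) ⟩
      (coeff p k + coeff q k) + coeff r k    ≈⟨ +-assoc _ _ _ ⟩
      coeff p k + (coeff q k + coeff r k)    ≈⟨ +-congˡ (coeff-+ q r k) ⟨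
      coeff p k + coeff (q +ₚ r) k           ≈⟨ coeff-+ p (q +ₚ r) k ⟨
      coeff (p +ₚ (q +ₚ r)) k                ∎

    +ₚ-comm : ∀ p q → p +ₚ q ≋ q +ₚ p
    +ₚ-comm p q = coefficientwise λ k → begin
      coeff (p +ₚ q) k         ≈⟨ coeff-+ p q k ⟩
      coeff p k + coeff q k    ≈⟨ +-comm _ _ ⟩
      coeff q k + coeff p k    ≈⟨ coeff-+ q p k ⟨
      coeff (q +ₚ p) k         ∎

    +ₚ-identityʳ : ∀ p → p +ₚ [] ≋ p
    +ₚ-identityʳ []      = ≋.refl
    +ₚ-identityʳ (a ∷ p) = ≋.refl

    -ₚ-inverseʳ : ∀ p → p +ₚ -ₚ p ≋ []
    -ₚ-inverseʳ p = coefficientwise λ k → begin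
      coeff (p +ₚ -ₚ p) k            ≈⟨ coeff-+ p (-ₚ p) k ⟩
      coeff p k + coeff (-ₚ p) k     ≈⟨ +-congˡ (coeff-neg p k) ⟩
      coeff p k + - coeff p k        ≈⟨ -‿inverseʳ _ ⟩
      0#                             ∎

    +ₚ-commutativeMonoid : CommutativeMonoid c ℓ
    +ₚ-commutativeMonoid = record
      { Carrier = Poly ; _≈_ = _≋_ ; _∙_ = _+ₚ_ ; ε = []
      ; isCommutativeMonoid = record
        { isMonoid = record
          { isSemigroup = record
            { isMagma = record { isEquivalence = ≋.isEquivalence ; ∙-cong = +ₚ-cong }
            ; assoc   = +ₚ-assoc
            }
          ; identity = (λ _ → ≋.refl) , +ₚ-identityʳ
          }
        ; comm = +ₚ-comm
        }
      }
    module +ₚ = CommutativeMonoid +ₚ-commutativeMonoid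
    module +ₚ-Properties = CommutativeSemigroupProperties +ₚ.commutativeSemigroup

    ·ₚ-distribˡ : ∀ a p q → a ·ₚ (p +ₚ q) ≋ a ·ₚ p +ₚ a ·ₚ q
    ·ₚ-distribˡ a p q = coefficientwise λ k → begin
      coeff (a ·ₚ (p +ₚ q)) k                 ≈⟨ coeff-· a (p +ₚ q) k ⟩
      a * coeff (p +ₚ q) k                    ≈⟨ *-congˡ (coeff-+ p q k) ⟩
      a * (coeff p k + coeff q k)             ≈⟨ distribˡ a _ _ ⟩
      a * coeff p k + a * coeff q k           ≈⟨ +-cong (coeff-· a p k) (coeff-· a q k) ⟨
      coeff (a ·ₚ p) k + coeff (a ·ₚ q) k     ≈⟨ coeff-+ (a ·ₚ p) (a ·ₚ q) k ⟨
      coeff (a ·ₚ p +ₚ a ·ₚ q) k              ∎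

    ·ₚ-distribʳ : ∀ a b p → (a + b) ·ₚ p ≋ a ·ₚ p +ₚ b ·ₚ p
    ·ₚ-distribʳ a b p = coefficientwise λ k → begin
      coeff ((a + b) ·ₚ p) k                  ≈⟨ coeff-· (a + b) p k ⟩
      (a + b) * coeff p k                     ≈⟨ distribʳ _ a b ⟩
      a * coeff p k + b * coeff p k           ≈⟨ +-cong (coeff-· a p k) (coeff-· b p k) ⟨
      coeff (a ·ₚ p) k + coeff (b ·ₚ p) k     ≈⟨ coeff-+ (a ·ₚ p) (b ·ₚ p) k ⟨
      coeff (a ·ₚ p +ₚ b ·ₚ p) k              ∎

    ·ₚ-assoc : ∀ a b p → (a * b) ·ₚ p ≋ a ·ₚ (b ·ₚ p)
    ·ₚ-assoc a b p = coefficientwise λ k → begin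
      coeff ((a * b) ·ₚ p) k      ≈⟨ coeff-· (a * b) p k ⟩
      (a * b) * coeff p k         ≈⟨ *-assoc a b _ ⟩
      a * (b * coeff p k)         ≈⟨ *-congˡ (coeff-· b p k) ⟨
      a * coeff (b ·ₚ p) k        ≈⟨ coeff-· a (b ·ₚ p) k ⟨
      coeff (a ·ₚ (b ·ₚ p)) k     ∎

    1·ₚ : ∀ p → 1# ·ₚ p ≋ p
    1·ₚ p = coefficientwise λ k → trans (coeff-· 1# p k) (*-identityˡ _)

    0·ₚ : ∀ p → 0# ·ₚ p ≋ []
    0·ₚ p = coefficientwise λ k → trans (coeff-· 0# p k) (zeroˡ _)

  module _ where
    open SetoidReasoning ≋-setoid

    shift : Poly → Poly
    shift p = 0# ∷ p

    shift-+ : ∀ p q → shift (p +ₚ q) ≋ shift p +ₚ shift q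
    shift-+ p q = ∷-cong (sym (+-identityˡ 0#)) ≋.refl

    ·-shift : ∀ a p → a ·ₚ shift p ≋ shift (a ·ₚ p)
    ·-shift a p = ∷-cong (zeroʳ a) ≋.refl

    *ₚ-distribʳ : ∀ r p q → (p +ₚ q) *ₚ r ≋ p *ₚ r +ₚ q *ₚ r
    *ₚ-distribʳ r []      q       = ≋.refl
    *ₚ-distribʳ r (a ∷ p) []      = ≋.sym (+ₚ-identityʳ _)
    *ₚ-distribʳ r (a ∷ p) (b ∷ q) = begin
      (a + b) ·ₚ r +ₚ shift ((p +ₚ q) *ₚ r)                         ≈⟨ +ₚ-cong (·ₚ-distribʳ a b r) (∷-cong refl (*ₚ-distribʳ r p q)) ⟩
      (a ·ₚ r +ₚ b ·ₚ r) +ₚ shift (p *ₚ r +ₚ q *ₚ r)                ≈⟨ +ₚ.∙-congˡ (shift-+ (p *ₚ r) (q *ₚ r)) ⟩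
      (a ·ₚ r +ₚ b ·ₚ r) +ₚ (shift (p *ₚ r) +ₚ shift (q *ₚ r))      ≈⟨ +ₚ-Properties.interchange (a ·ₚ r) (b ·ₚ r) (shift (p *ₚ r)) (shift (q *ₚ r)) ⟩
      (a ·ₚ r +ₚ shift (p *ₚ r)) +ₚ (b ·ₚ r +ₚ shift (q *ₚ r))      ∎

    ·-*ₚ : ∀ a p q → (a ·ₚ p) *ₚ q ≋ a ·ₚ (p *ₚ q)
    ·-*ₚ a []      q = ≋.refl
    ·-*ₚ a (b ∷ p) q = begin
      (a * b) ·ₚ q +ₚ shift ((a ·ₚ p) *ₚ q)       ≈⟨ +ₚ-cong (·ₚ-assoc a b q) (∷-cong refl (·-*ₚ a p q)) ⟩
      a ·ₚ (b ·ₚ q) +ₚ shift (a ·ₚ (p *ₚ q))      ≈⟨ +ₚ.∙-congˡ (·-shift a (p *ₚ q)) ⟨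
      a ·ₚ (b ·ₚ q) +ₚ a ·ₚ shift (p *ₚ q)        ≈⟨ ·ₚ-distribˡ a (b ·ₚ q) (shift (p *ₚ q)) ⟨
      a ·ₚ (b ·ₚ q +ₚ shift (p *ₚ q))             ∎

    shift-*ₚ : ∀ p q → shift p *ₚ q ≋ shift (p *ₚ q)
    shift-*ₚ p q = +ₚ.trans (+ₚ.∙-congʳ (0·ₚ q)) (+ₚ.identityˡ _)

    *ₚ-assoc : ∀ p q r → (p *ₚ q) *ₚ r ≋ p *ₚ (q *ₚ r)
    *ₚ-assoc []      q r = ≋.refl
    *ₚ-assoc (a ∷ p) q r = begin
      (a ·ₚ q +ₚ shift (p *ₚ q)) *ₚ r             ≈⟨ *ₚ-distribʳ r (a ·ₚ q) (shift (p *ₚ q)) ⟩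
      (a ·ₚ q) *ₚ r +ₚ shift (p *ₚ q) *ₚ r        ≈⟨ +ₚ-cong (·-*ₚ a q r) (shift-*ₚ (p *ₚ q) r) ⟩
      a ·ₚ (q *ₚ r) +ₚ shift ((p *ₚ q) *ₚ r)      ≈⟨ +ₚ.∙-congˡ (∷-cong refl (*ₚ-assoc p q r)) ⟩
      a ·ₚ (q *ₚ r) +ₚ shift (p *ₚ (q *ₚ r))      ∎

    -- The defining recursion of `*ₚ` runs along the left factor; this is its mirror image along the
    -- right one, from which commutativity follows by induction.
    *ₚ-∷ : ∀ p b q → p *ₚ (b ∷ q) ≋ b ·ₚ p +ₚ shift (p *ₚ q)
    *ₚ-∷ []      b q = ≋.sym 0∷[]≋[]
    *ₚ-∷ (a ∷ p) b q = ∷-cong (+-congʳ (*-comm a b)) (begin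
      a ·ₚ q +ₚ p *ₚ (b ∷ q)                      ≈⟨ +ₚ.∙-congˡ (*ₚ-∷ p b q) ⟩
      a ·ₚ q +ₚ (b ·ₚ p +ₚ shift (p *ₚ q))        ≈⟨ +ₚ-Properties.x∙yz≈y∙xz (a ·ₚ q) (b ·ₚ p) _ ⟩
      b ·ₚ p +ₚ (a ·ₚ q +ₚ shift (p *ₚ q))        ∎)

    *ₚ-[] : ∀ p → p *ₚ [] ≋ []
    *ₚ-[] []      = ≋.refl
    *ₚ-[] (a ∷ p) = ≋.trans (∷-cong refl (*ₚ-[] p)) 0∷[]≋[]

    *ₚ-comm : ∀ p q → p *ₚ q ≋ q *ₚ p
    *ₚ-comm []      q = ≋.sym (*ₚ-[] q)
    *ₚ-comm (a ∷ p) q = ≋.trans (+ₚ.∙-congˡ (∷-cong refl (*ₚ-comm p q))) (≋.sym (*ₚ-∷ q a p))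

    *ₚ-identityˡ : ∀ p → (1# ∷ []) *ₚ p ≋ p
    *ₚ-identityˡ p = ≋.trans (+ₚ-cong (1·ₚ p) 0∷[]≋[]) (+ₚ-identityʳ p)

  polynomialRing : CommutativeRing c ℓ
  polynomialRing = record
    { Carrier = Poly ; _≈_ = _≋_ ; _+_ = _+ₚ_ ; _*_ = _*ₚ_ ; -_ = -ₚ_ ; 0# = [] ; 1# = 1# ∷ []
    ; isCommutativeRing = record
      { isRing = record
        { +-isAbelianGroup = record
          { isGroup = record
            { isMonoid = +ₚ.isMonoid
            ; inverse  = (λ p → ≋.trans (+ₚ-comm (-ₚ p) p) (-ₚ-inverseʳ p)) , -ₚ-inverseʳ
            ; ⁻¹-cong  = λ {p} {q} p≋q → coefficientwise λ k →
                trans (coeff-neg p k) (trans (-‿cong (coeff-≈ p≋q k)) (sym (coeff-neg q k)))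
            }
          ; comm = +ₚ-comm
          }
        ; *-cong     = λ {p} {p′} {q} {q′} p≋ q≋ →
            coefficientwise (*ₚ-cong {p} {p′} {q} {q′} (coeff-≈ p≋) (coeff-≈ q≋))
        ; *-assoc    = *ₚ-assoc
        ; *-identity = *ₚ-identityˡ , λ p → ≋.trans (*ₚ-comm p (1# ∷ [])) (*ₚ-identityˡ p)
        ; distrib    = (λ r p q → ≋.trans (*ₚ-comm r (p +ₚ q))
                           (≋.trans (*ₚ-distribʳ r p q) (+ₚ-cong (*ₚ-comm p r) (*ₚ-comm q r)))) ,
                       *ₚ-distribʳ
        }
      ; *-comm = *ₚ-comm
      }
    }

  module 𝒫 = CommutativeRing polynomialRing
  open Exp 𝒫.commutativeSemiring public using () renaming (_^_ to _^ₚ_)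
  open Exp commutativeSemiring using (_^_)

  X : Poly
  X = 0# ∷ 1# ∷ []

  coeff-*ₚ-const : ∀ a p → (a ∷ []) *ₚ p ≋ a ·ₚ p
  coeff-*ₚ-const a p = ≋.trans (+ₚ.∙-congˡ 0∷[]≋[]) (+ₚ-identityʳ _)

  module _ where
    open SetoidReasoning ≋-setoid

    -- Long division recurses on the tail p; written with ring operations, the list constructor is
    -- seen to respect congruence modulo D.
    ∷-as-sum : ∀ a p → (a ∷ p) ≋ (a ∷ []) +ₚ p *ₚ X
    ∷-as-sum a p = begin
      a ∷ p                              ≈⟨ ∷-cong (sym (+-identityʳ a)) (≋.sym (*ₚ-identityˡ p)) ⟩
      (a ∷ []) +ₚ shift ((1# ∷ []) *ₚ p)  ≈⟨ +ₚ.∙-congˡ {a ∷ []} (≋.sym (shift-*ₚ (1# ∷ []) p)) ⟩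
      (a ∷ []) +ₚ X *ₚ p                 ≈⟨ +ₚ.∙-congˡ {a ∷ []} (*ₚ-comm X p) ⟩
      (a ∷ []) +ₚ p *ₚ X                 ∎

  open SetoidReasoning setoid

  -- Degrees and monic polynomials

  DegreeBelow-resp : ∀ {n p q} → p ≋ q → DegreeBelow n p → DegreeBelow n q
  DegreeBelow-resp p≋q p< k n≤k = trans (sym (coeff-≈ p≋q k)) (p< k n≤k)

  DegreeBelow-+ : ∀ {n} p q → DegreeBelow n p → DegreeBelow n q → DegreeBelow n (p +ₚ q)
  DegreeBelow-+ p q p< q< k n≤k =
    trans (coeff-+ p q k) (trans (+-cong (p< k n≤k) (q< k n≤k)) (+-identityˡ 0#))

  DegreeBelow-neg : ∀ {n} p → DegreeBelow n p → DegreeBelow n (-ₚ p)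
  DegreeBelow-neg p p< k n≤k = trans (coeff-neg p k) (trans (-‿cong (p< k n≤k)) -0#≈0#)

  DegreeBelow-≤ : ∀ {m n} p → m ≤ n → DegreeBelow m p → DegreeBelow n p
  DegreeBelow-≤ p m≤n p< k n≤k = p< k (ℕ.≤-trans m≤n n≤k)

  DegreeBelow-* : ∀ {a b} p q → DegreeBelow (suc a) p → DegreeBelow (suc b) q →
                  DegreeBelow (suc (a ℕ.+ b)) (p *ₚ q)
  DegreeBelow-* []      q p< q< k       _         = refl
  DegreeBelow-* {zero}  {b} (a ∷ p) q p< q< (suc k) (s≤s b≤k) = begin
    coeff ((a ∷ p) *ₚ q) (suc k)              ≈⟨ coeff-*-suc a p q k ⟩
    a * coeff q (suc k) + coeff (p *ₚ q) k    ≈⟨ +-cong (*-congˡ (q< (suc k) (s≤s b≤k))) (*ₚ-zeroˡ p q (λ j → p< (suc j) (s≤s z≤n)) k) ⟩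
    a * 0# + 0#                               ≈⟨ trans (+-identityʳ _) (zeroʳ a) ⟩
    0#                                        ∎
  DegreeBelow-* {suc d} {b} (a ∷ p) q p< q< (suc k) (s≤s d+b<k) = begin
    coeff ((a ∷ p) *ₚ q) (suc k)              ≈⟨ coeff-*-suc a p q k ⟩
    a * coeff q (suc k) + coeff (p *ₚ q) k    ≈⟨ +-cong (*-congˡ (q< (suc k) (s≤s (ℕ.≤-trans (ℕ.m≤n+m b (suc d)) d+b<k)))) (DegreeBelow-* p q (λ j d<j → p< (suc j) (s≤s d<j)) q< k d+b<k) ⟩
    a * 0# + 0#                               ≈⟨ trans (+-identityʳ _) (zeroʳ a) ⟩
    0#                                        ∎

  -- A predicate on arbitrary coefficient lists, since products and powers need not have the shape
  -- `monic c` and may carry trailing zeros.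
  record IsMonic (k : ℕ) (p : Poly) : Set ℓ where
    constructor isMonic
    field
      below   : DegreeBelow (suc k) p
      leading : coeff p k ≈ 1#

  IsMonic-* : ∀ {a b p q} → IsMonic a p → IsMonic b q → IsMonic (a ℕ.+ b) (p *ₚ q)
  IsMonic-* {a} {b} {p} {q} (isMonic p< p≈1) (isMonic q< q≈1) = isMonic (DegreeBelow-* p q p< q<)
    (trans (coeff-*-top p q a b p< q<) (trans (*-cong p≈1 q≈1) (*-identityˡ 1#)))

  IsMonic-1 : IsMonic 0 (1# ∷ [])
  IsMonic-1 = isMonic (λ { (suc k) _ → refl }) refl

  IsMonic-linear : ∀ a → IsMonic 1 (a ∷ 1# ∷ [])
  IsMonic-linear a = isMonic (λ { (suc (suc k)) _ → refl ; (suc zero) (s≤s ()) }) refl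

  IsMonic-^ : ∀ {p} → IsMonic 1 p → ∀ n → IsMonic n (p ^ₚ n)
  IsMonic-^ p-monic zero    = IsMonic-1
  IsMonic-^ p-monic (suc n) = IsMonic-* p-monic (IsMonic-^ p-monic n)

  IsMonic-+ : ∀ {k p} q → IsMonic k p → DegreeBelow k q → IsMonic k (p +ₚ q)
  IsMonic-+ {k} {p} q (isMonic p< p≈1) q< = isMonic
    (DegreeBelow-+ p q p< (DegreeBelow-≤ q (ℕ.n≤1+n k) q<))
    (trans (coeff-+ p q k) (trans (+-cong p≈1 (q< k ℕ.≤-refl)) (+-identityʳ 1#)))

  -- The leading terms cancel. Hence two monic polynomials of degree k are already equal when they
  -- agree at k points, one fewer than in general.
  IsMonic-cancel : ∀ {k p q} → IsMonic k p → IsMonic k q → DegreeBelow k (p +ₚ -ₚ q)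
  IsMonic-cancel {k} {p} {q} (isMonic p< p≈1) (isMonic q< q≈1) j k≤j with ℕ.m≤n⇒m<n∨m≡n k≤j
  ... | inj₁ k<j    = DegreeBelow-+ p (-ₚ q) p< (DegreeBelow-neg q q<) j k<j
  ... | inj₂ ≡.refl = begin
    coeff (p +ₚ -ₚ q) k           ≈⟨ coeff-+ p (-ₚ q) k ⟩
    coeff p k + coeff (-ₚ q) k    ≈⟨ +-cong p≈1 (trans (coeff-neg q k) (-‿cong q≈1)) ⟩
    1# + - 1#                     ≈⟨ -‿inverseʳ 1# ⟩
    0#                            ∎

  monic-IsMonic : ∀ {k} (v : Vector Carrier k) → IsMonic k (monic v)
  monic-IsMonic v = isMonic (monic-below v) (reflexive (monic-top v))

  coeff-monic : ∀ {k} (v : Vector Carrier k) (j : Fin k) → coeff (monic v) (toℕ j) ≡ v j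
  coeff-monic v zero    = ≡.refl
  coeff-monic v (suc j) = coeff-monic (v ∘ suc) j

  monic-≋ : ∀ {k} (v : Vector Carrier k) p → IsMonic k p → (∀ j → v j ≈ coeff p (toℕ j)) →
            monic v ≋ p
  monic-≋ {k} v p (isMonic p< p≈1) v≈ = coefficientwise λ j → helper j
    where
    helper : ∀ j → coeff (monic v) j ≈ coeff p j
    helper j with ℕ.<-cmp j k
    ... | tri< j<k _ _    = ≡.subst (λ i → coeff (monic v) i ≈ coeff p i) (Fin.toℕ-fromℕ< j<k)
                              (trans (reflexive (coeff-monic v (fromℕ< j<k))) (v≈ (fromℕ< j<k)))
    ... | tri≈ _ ≡.refl _ = trans (reflexive (monic-top v)) (sym p≈1)
    ... | tri> _ _ k<j    = trans (monic-below v j k<j) (sym (p< j k<j))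

  -- Values of polynomials

  eval-≋[] : ∀ p x → p ≋ [] → eval p x ≈ 0#
  eval-≋[] []      x p≋[] = refl
  eval-≋[] (a ∷ p) x p≋[] = begin
    a + x * eval p x    ≈⟨ +-cong (coeff-≈ p≋[] 0) (*-congˡ (eval-≋[] p x (coefficientwise (coeff-≈ p≋[] ∘ suc)))) ⟩
    0# + x * 0#         ≈⟨ trans (+-identityˡ _) (zeroʳ x) ⟩
    0#                  ∎

  eval-resp : ∀ {p q} x → p ≋ q → eval p x ≈ eval q x
  eval-resp {[]}    {q}     x p≋q = sym (eval-≋[] q x (≋.sym p≋q))
  eval-resp {a ∷ p} {[]}    x p≋q = eval-≋[] (a ∷ p) x p≋q
  eval-resp {a ∷ p} {b ∷ q} x p≋q = +-cong (coeff-≈ p≋q 0)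
    (*-congˡ (eval-resp {p} {q} x (coefficientwise (coeff-≈ p≋q ∘ suc))))

  eval-1 : ∀ x → eval (1# ∷ []) x ≈ 1#
  eval-1 x = trans (+-congˡ (zeroʳ x)) (+-identityʳ 1#)

  eval-linear : ∀ a x → eval (a ∷ 1# ∷ []) x ≈ a + x
  eval-linear a x = +-congˡ (trans (*-congˡ (eval-1 x)) (*-identityʳ x))

  eval-X : ∀ x → eval X x ≈ x
  eval-X x = trans (eval-linear 0# x) (+-identityˡ x)

  eval-^ : ∀ p n x → eval (p ^ₚ n) x ≈ eval p x ^ n
  eval-^ p zero    x = eval-1 x
  eval-^ p (suc n) x = trans (eval-* p (p ^ₚ n) x) (*-congˡ (eval-^ p n x))

  eval-neg : ∀ p x → eval (-ₚ p) x ≈ - eval p x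
  eval-neg p x = +-inverseʳ-unique _ _
    (trans (sym (eval-+ p (-ₚ p) x)) (eval-≋[] (p +ₚ -ₚ p) x (-ₚ-inverseʳ p)))

  -- For N = q^d its roots in `L` are the fixed points of the d-th power of the Frobenius
  -- automorphism.
  Φ : ℕ → Poly
  Φ N = X ^ₚ N +ₚ -ₚ X

  -- The bound on N keeps the second term below the first; for N = 1 the two would cancel.
  IsMonic-Φ : ∀ {N} → 2 ≤ N → IsMonic N (Φ N)
  IsMonic-Φ {N} 2≤N = IsMonic-+ (-ₚ X) (IsMonic-^ (IsMonic-linear 0#) N)
    (DegreeBelow-neg X (DegreeBelow-≤ X 2≤N (IsMonic.below (IsMonic-linear 0#))))

-- The quotient R[X]/(D)

module Quotient (R : CommutativeRing c ℓ) (D : Polynomial.Poly R) where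
  open CommutativeRing R
    using (0#; 1#; refl; sym; trans; +-congˡ; -‿cong; -‿inverseʳ; *-congˡ; *-identityʳ; zeroʳ)
  open Polynomial R hiding (rawSemiring)
  open PolynomialRing R
  open SetoidReasoning ≋-setoid
  open CommutativeSemigroupProperties 𝒫.+-commutativeSemigroup using (interchange)
  open RingProperties 𝒫.ring using (-‿distribˡ-*; -‿+-comm)

  infix 4 _≡ᴰ_
  -- The multiplier is kept as data: it serves as the quotient in `invert-step`, and `enough-roots`
  -- counts its roots.
  record _≡ᴰ_ (p p′ : Poly) : Set (c ⊔ ℓ) where
    constructor _,_
    field
      multiplier : Poly
      difference : p ≋ p′ +ₚ multiplier *ₚ D

  ≋⇒≡ᴰ : ∀ {p p′} → p ≋ p′ → p ≡ᴰ p′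
  ≋⇒≡ᴰ {p} {p′} p≋p′ = [] , 𝒫.trans p≋p′ (𝒫.sym (𝒫.+-identityʳ p′))

  private
    ≡ᴰ-sym : ∀ {p p′} → p ≡ᴰ p′ → p′ ≡ᴰ p
    ≡ᴰ-sym {p} {p′} (s , p≋) = (-ₚ s) , 𝒫.sym (begin
      p +ₚ (-ₚ s) *ₚ D                       ≈⟨ 𝒫.+-cong p≋ (𝒫.sym (-‿distribˡ-* s D)) ⟩
      (p′ +ₚ s *ₚ D) +ₚ (-ₚ (s *ₚ D))        ≈⟨ 𝒫.+-assoc p′ _ _ ⟩
      p′ +ₚ (s *ₚ D +ₚ (-ₚ (s *ₚ D)))        ≈⟨ 𝒫.+-congˡ (𝒫.-‿inverseʳ (s *ₚ D)) ⟩
      p′ +ₚ []                               ≈⟨ 𝒫.+-identityʳ p′ ⟩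
      p′                                     ∎)

    ≡ᴰ-trans : ∀ {p q r} → p ≡ᴰ q → q ≡ᴰ r → p ≡ᴰ r
    ≡ᴰ-trans {p} {q} {r} (s , p≋) (t , q≋) = t +ₚ s , (begin
      p                               ≈⟨ p≋ ⟩
      q +ₚ s *ₚ D                     ≈⟨ 𝒫.+-congʳ q≋ ⟩
      (r +ₚ t *ₚ D) +ₚ s *ₚ D         ≈⟨ 𝒫.+-assoc r _ _ ⟩
      r +ₚ (t *ₚ D +ₚ s *ₚ D)         ≈⟨ 𝒫.+-congˡ (𝒫.distribʳ D t s) ⟨
      r +ₚ (t +ₚ s) *ₚ D              ∎)

    +-≡ᴰ : ∀ {p p′ q q′} → p ≡ᴰ p′ → q ≡ᴰ q′ → p +ₚ q ≡ᴰ p′ +ₚ q′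
    +-≡ᴰ {p} {p′} {q} {q′} (s , p≋) (t , q≋) = s +ₚ t , (begin
      p +ₚ q                                  ≈⟨ 𝒫.+-cong p≋ q≋ ⟩
      (p′ +ₚ s *ₚ D) +ₚ (q′ +ₚ t *ₚ D)        ≈⟨ interchange p′ (s *ₚ D) q′ (t *ₚ D) ⟩
      (p′ +ₚ q′) +ₚ (s *ₚ D +ₚ t *ₚ D)        ≈⟨ 𝒫.+-congˡ (𝒫.distribʳ D s t) ⟨
      (p′ +ₚ q′) +ₚ (s +ₚ t) *ₚ D             ∎)

    *-≡ᴰ-congʳ : ∀ {p p′} q → p ≡ᴰ p′ → p *ₚ q ≡ᴰ p′ *ₚ q
    *-≡ᴰ-congʳ {p} {p′} q (s , p≋) = q *ₚ s , (begin
      p *ₚ q                        ≈⟨ 𝒫.*-congʳ p≋ ⟩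
      (p′ +ₚ s *ₚ D) *ₚ q           ≈⟨ 𝒫.distribʳ q p′ (s *ₚ D) ⟩
      p′ *ₚ q +ₚ (s *ₚ D) *ₚ q      ≈⟨ 𝒫.+-congˡ (𝒫.trans (𝒫.*-comm (s *ₚ D) q) (𝒫.sym (𝒫.*-assoc q s D))) ⟩
      p′ *ₚ q +ₚ (q *ₚ s) *ₚ D      ∎)

    *-≡ᴰ : ∀ {p p′ q q′} → p ≡ᴰ p′ → q ≡ᴰ q′ → p *ₚ q ≡ᴰ p′ *ₚ q′
    *-≡ᴰ {p} {p′} {q} {q′} p≡ q≡ = ≡ᴰ-trans (*-≡ᴰ-congʳ q p≡)
      (≡ᴰ-trans (≋⇒≡ᴰ (𝒫.*-comm p′ q)) (≡ᴰ-trans (*-≡ᴰ-congʳ p′ q≡) (≋⇒≡ᴰ (𝒫.*-comm q′ p′))))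

    neg-≡ᴰ : ∀ {p p′} → p ≡ᴰ p′ → -ₚ p ≡ᴰ -ₚ p′
    neg-≡ᴰ {p} {p′} (s , p≋) = (-ₚ s) , (begin
      -ₚ p                               ≈⟨ 𝒫.-‿cong p≋ ⟩
      -ₚ (p′ +ₚ s *ₚ D)                  ≈⟨ -‿+-comm p′ (s *ₚ D) ⟨
      (-ₚ p′) +ₚ (-ₚ (s *ₚ D))           ≈⟨ 𝒫.+-congˡ (-‿distribˡ-* s D) ⟩
      (-ₚ p′) +ₚ (-ₚ s) *ₚ D             ∎)

  quotientRing : CommutativeRing c (c ⊔ ℓ)
  quotientRing = record
    { Carrier = Poly ; _≈_ = _≡ᴰ_ ; _+_ = _+ₚ_ ; _*_ = _*ₚ_ ; -_ = -ₚ_ ; 0# = [] ; 1# = 1# ∷ []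
    ; isCommutativeRing = record
      { isRing = record
        { +-isAbelianGroup = record
          { isGroup = record
            { isMonoid = record
              { isSemigroup = record
                { isMagma = record
                  { isEquivalence = record
                    { refl = ≋⇒≡ᴰ 𝒫.refl ; sym = ≡ᴰ-sym ; trans = ≡ᴰ-trans }
                  ; ∙-cong = +-≡ᴰ
                  }
                ; assoc = λ p q r → ≋⇒≡ᴰ (𝒫.+-assoc p q r)
                }
              ; identity = (λ p → ≋⇒≡ᴰ (𝒫.+-identityˡ p)) , (λ p → ≋⇒≡ᴰ (𝒫.+-identityʳ p))
              }
            ; inverse = (λ p → ≋⇒≡ᴰ (𝒫.-‿inverseˡ p)) , (λ p → ≋⇒≡ᴰ (𝒫.-‿inverseʳ p))
            ; ⁻¹-cong = neg-≡ᴰ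
            }
          ; comm = λ p q → ≋⇒≡ᴰ (𝒫.+-comm p q)
          }
        ; *-cong     = *-≡ᴰ
        ; *-assoc    = λ p q r → ≋⇒≡ᴰ (𝒫.*-assoc p q r)
        ; *-identity = (λ p → ≋⇒≡ᴰ (𝒫.*-identityˡ p)) , (λ p → ≋⇒≡ᴰ (𝒫.*-identityʳ p))
        ; distrib    = (λ p q r → ≋⇒≡ᴰ (𝒫.distribˡ p q r)) , (λ p q r → ≋⇒≡ᴰ (𝒫.distribʳ p q r))
        }
      ; *-comm = λ p q → ≋⇒≡ᴰ (𝒫.*-comm p q)
      }
    }

  module 𝒬 = CommutativeRing quotientRing
  module 𝒬-Exp = Exp 𝒬.commutativeSemiring

  ^-agree : ∀ p n → p 𝒬-Exp.^ n ≡ p ^ₚ n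
  ^-agree p zero    = ≡.refl
  ^-agree p (suc n) = ≡.cong (p *ₚ_) (^-agree p n)

  ^-≡ᴰ : ∀ {p p′} n → p ≡ᴰ p′ → p ^ₚ n ≡ᴰ p′ ^ₚ n
  ^-≡ᴰ {p} {p′} n p≡p′ = ≡.subst₂ _≡ᴰ_ (^-agree p n) (^-agree p′ n) (𝒬-Exp.^-congˡ n p≡p′)

  -- One step of the division replaces a + X p by its remainder c X^k + ⋯
  -- and subtracts c D.
  divide : ∀ {k} → IsMonic k D → ∀ p → ∃[ r ] DegreeBelow k r × p ≡ᴰ r
  divide D-monic []      = [] , (λ _ _ → refl) , 𝒬.refl
  divide {k} D-monic@(isMonic D< D≈1) (a ∷ p) = let r , r< , p≡r = divide D-monic p in
    reduce-step (a ∷ r) (λ { (suc j) (s≤s k≤j) → r< j k≤j })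
      (𝒬.trans (≋⇒≡ᴰ (∷-as-sum a p))
        (𝒬.trans (𝒬.+-congˡ (𝒬.*-congʳ p≡r)) (≋⇒≡ᴰ (𝒫.sym (∷-as-sum a r)))))
    where
    reduce-step : ∀ t → DegreeBelow (suc k) t → (a ∷ p) ≡ᴰ t →
                  ∃[ r ] DegreeBelow k r × (a ∷ p) ≡ᴰ r
    reduce-step t t< p≡t = t +ₚ -ₚ (c₀ ·ₚ D) , lower , 𝒬.trans p≡t t≡
      where
      c₀ = coeff t k
      t≡ : t ≡ᴰ t +ₚ -ₚ (c₀ ·ₚ D)
      t≡ = (c₀ ∷ []) , 𝒫.sym (begin
        (t +ₚ -ₚ (c₀ ·ₚ D)) +ₚ (c₀ ∷ []) *ₚ D    ≈⟨ 𝒫.+-congˡ (coeff-*ₚ-const c₀ D) ⟩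
        (t +ₚ -ₚ (c₀ ·ₚ D)) +ₚ c₀ ·ₚ D           ≈⟨ 𝒫.+-assoc t _ _ ⟩
        t +ₚ (-ₚ (c₀ ·ₚ D) +ₚ c₀ ·ₚ D)           ≈⟨ 𝒫.+-congˡ (𝒫.-‿inverseˡ (c₀ ·ₚ D)) ⟩
        t +ₚ []                                  ≈⟨ 𝒫.+-identityʳ t ⟩
        t                                        ∎)
      c₀D< : DegreeBelow (suc k) (c₀ ·ₚ D)
      c₀D< j k<j = trans (coeff-· c₀ D j) (trans (*-congˡ (D< j k<j)) (zeroʳ c₀))
      lower : DegreeBelow k (t +ₚ -ₚ (c₀ ·ₚ D))
      lower j k≤j with ℕ.m≤n⇒m<n∨m≡n k≤j
      ... | inj₁ k<j    = DegreeBelow-+ t (-ₚ (c₀ ·ₚ D)) t< (DegreeBelow-neg (c₀ ·ₚ D) c₀D<) j k<j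
      ... | inj₂ ≡.refl = trans (coeff-+ t _ k) (trans (+-congˡ (trans (coeff-neg (c₀ ·ₚ D) k)
                            (-‿cong (trans (coeff-· c₀ D k) (trans (*-congˡ D≈1) (*-identityʳ c₀))))))
                            (-‿inverseʳ c₀))

  -- X^(M^(t+1)) is X^M raised to the power M^t, and powers respect congruence. With M = q^k this
  -- passes from the exponent q^k to q^m for every multiple m of k.
  X^-iterate : ∀ {M} → X ^ₚ M ≡ᴰ X → ∀ t → X ^ₚ (M ℕ.^ t) ≡ᴰ X
  X^-iterate     X^M≡X zero    = ≋⇒≡ᴰ (𝒫.*-identityʳ X)
  X^-iterate {M} X^M≡X (suc t) = 𝒬.trans
    (≋⇒≡ᴰ (𝒫.sym (𝒫-Exp.^-assocʳ X M (M ℕ.^ t))))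
    (𝒬.trans (^-≡ᴰ (M ℕ.^ t) X^M≡X) (X^-iterate X^M≡X t))
    where module 𝒫-Exp = Exp 𝒫.commutativeSemiring

  D≡0 : D ≡ᴰ []
  D≡0 = (1# ∷ []) , 𝒫.sym (𝒫.*-identityˡ D)

-- Finite sets

-- A missed value y could be punched out of the codomain, leaving an injection of n + 1 elements
-- into n.
injective⇒surjective : ∀ {n} {f : Fin n → Fin n} → Injective _≡_ _≡_ f → ∀ y → ∃[ x ] f x ≡ y
injective⇒surjective {suc n} {f} f-injective y with Fin.any? (λ x → f x Fin.≟ y)
... | yes found = found
... | no  none  = contradiction (Fin.injective⇒≤ {f = λ x → punchOut (y≢f x)}
        (λ eq → f-injective (Fin.punchOut-injective (y≢f _) (y≢f _) eq))) ℕ.1+n≰n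
  where
  y≢f : ∀ x → y ≢ f x
  y≢f x y≡fx = none (x , ≡.sym y≡fx)

funToFin-cong : ∀ {m n} {f g : Fin m → Fin n} → (∀ j → f j ≡ g j) → funToFin f ≡ funToFin g
funToFin-cong {zero}  f≗g = ≡.refl
funToFin-cong {suc m} f≗g = ≡.cong₂ combine (f≗g zero) (funToFin-cong (f≗g ∘ suc))

finToFun-injective : ∀ {m n} {i j : Fin (n ℕ.^ m)} →
                     (∀ x → finToFun {n} {m} i x ≡ finToFun j x) → i ≡ j
finToFun-injective {m} {n} {i} {j} eq = ≡.trans (≡.sym (Fin.funToFin-finToFin {m} {n} i))
  (≡.trans (funToFin-cong eq) (Fin.funToFin-finToFin {m} {n} j))

lookup-injective : ∀ {A : Set α} {xs : List A} → Unique xs →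
                   ∀ {i j} → lookup xs i ≡ lookup xs j → i ≡ j
lookup-injective (x∉ ∷ u) {zero}  {zero}  eq = ≡.refl
lookup-injective (x∉ ∷ u) {zero}  {suc j} eq = contradiction eq (All.lookup x∉ (∈-lookup j))
lookup-injective (x∉ ∷ u) {suc i} {zero}  eq = contradiction (≡.sym eq) (All.lookup x∉ (∈-lookup i))
lookup-injective (x∉ ∷ u) {suc i} {suc j} eq = ≡.cong suc (lookup-injective u eq)

-- Lists S in increasing order. Together with `position` it is a bijection from `Fin ∣ S ∣`, which
-- turns cardinalities of subsets into families of distinct roots.
member : ∀ {n} (S : Subset n) → Fin ∣ S ∣ → Fin n
member (outside Vec.∷ S) j       = suc (member S j)
member (inside  Vec.∷ S) zero    = zero
member (inside  Vec.∷ S) (suc j) = suc (member S j)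

member-∈ : ∀ {n} (S : Subset n) j → member S j ∈ₛ S
member-∈ (outside Vec.∷ S) j       = Vec.there (member-∈ S j)
member-∈ (inside  Vec.∷ S) zero    = Vec.here
member-∈ (inside  Vec.∷ S) (suc j) = Vec.there (member-∈ S j)

member-injective : ∀ {n} (S : Subset n) {i j} → member S i ≡ member S j → i ≡ j
member-injective (outside Vec.∷ S)                 eq = member-injective S (Fin.suc-injective eq)
member-injective (inside  Vec.∷ S) {zero}  {zero}  eq = ≡.refl
member-injective (inside  Vec.∷ S) {suc i} {suc j} eq =
  ≡.cong suc (member-injective S (Fin.suc-injective eq))

position : ∀ {n} (S : Subset n) {x} → x ∈ₛ S → ∃[ j ] member S j ≡ x
position (inside  Vec.∷ S) Vec.here       = zero , ≡.refl
position (inside  Vec.∷ S) (Vec.there x∈) = let j , eq = position S x∈ in suc j , ≡.cong suc eq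
position (outside Vec.∷ S) (Vec.there x∈) = let j , eq = position S x∈ in j , ≡.cong suc eq

module _ {n} {P : Fin n → Set α} (P? : ∀ j → Dec (P j)) where

  comprehension : Subset n
  comprehension = Vec.tabulate (does ∘ P?)

  ∈-comprehension⁺ : ∀ {j} → P j → j ∈ₛ comprehension
  ∈-comprehension⁺ {j} p = Vec.lookup⇒[]= j _ (≡.trans (Vec.lookup∘tabulate (does ∘ P?) j) does≡)
    where
    does≡ : does (P? j) ≡ inside
    does≡ with P? j
    ... | yes _  = ≡.refl
    ... | no  ¬p = contradiction p ¬p

  ∈-comprehension⁻ : ∀ {j} → j ∈ₛ comprehension → P j
  ∈-comprehension⁻ {j} j∈ with P? j | ≡.trans (≡.sym (Vec.lookup∘tabulate (does ∘ P?) j)) (Vec.[]=⇒lookup j∈)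
  ... | yes p | _ = p

least : ∀ {P : ℕ → Set α} → (∀ n → Dec (P n)) → ∀ N → P N →
        ∃[ n ] P n × (∀ k → k < n → ¬ P k)
least {P = P} P? zero    p = 0 , p , λ _ ()
least {P = P} P? (suc N) p with P? 0
... | yes p₀ = 0 , p₀ , λ _ ()
... | no ¬p₀ = let n , pₙ , below = least (P? ∘ suc) N p in
  suc n , pₙ , λ { zero _ → ¬p₀ ; (suc k) (s≤s k<n) → below k k<n }

-- Polynomials over a finite field

module PolynomialsOverField {n} (F : FiniteField c ℓ n) where
  open FiniteField F
  open FieldProperties F
  open Polynomial commutativeRing hiding (rawSemiring)
  open PolynomialRing commutativeRing
  open RingProperties ring using (x≈y⇒x∙y⁻¹≈ε)

  -- The quotient of p − p(a) by X − a.
  synthetic : Carrier → Poly → Poly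
  synthetic a []      = []
  synthetic a (b ∷ p) = eval p a ∷ synthetic a p

  -- p(x) − p(a) = (x − a) q(x) without subtraction.
  eval-synthetic : ∀ a p x →
    eval p x + a * eval (synthetic a p) x ≈ eval p a + x * eval (synthetic a p) x
  eval-synthetic a []      x = +-congˡ (trans (zeroʳ a) (sym (zeroʳ x)))
  eval-synthetic a (b ∷ p) x = begin
    (b + x * px) + a * (pa + x * qx)          ≈⟨ +-congˡ (distribˡ a pa (x * qx)) ⟩
    (b + x * px) + (a * pa + a * (x * qx))    ≈⟨ interchange b (x * px) (a * pa) (a * (x * qx)) ⟩
    (b + a * pa) + (x * px + a * (x * qx))    ≈⟨ +-congˡ (+-congˡ (x∙yz≈y∙xz a x qx)) ⟩
    (b + a * pa) + (x * px + x * (a * qx))    ≈⟨ +-congˡ (distribˡ x px (a * qx)) ⟨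
    (b + a * pa) + x * (px + a * qx)          ≈⟨ +-congˡ (*-congˡ (eval-synthetic a p x)) ⟩
    (b + a * pa) + x * (pa + x * qx)          ∎
    where
    open SetoidReasoning setoid
    open CommutativeSemigroupProperties +-commutativeSemigroup using (interchange)
    open CommutativeSemigroupProperties *-commutativeSemigroup using (x∙yz≈y∙xz)
    px = eval p x
    pa = eval p a
    qx = eval (synthetic a p) x

  DegreeBelow-synthetic : ∀ {k} a p → DegreeBelow (suc k) p → DegreeBelow k (synthetic a p)
  DegreeBelow-synthetic a []      p< j       _         = refl
  DegreeBelow-synthetic a (b ∷ p) p< zero    z≤n       =
    eval-≋[] p a (coefficientwise λ j → p< (suc j) (s≤s z≤n))
  DegreeBelow-synthetic a (b ∷ p) p< (suc j) z≤n       =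
    DegreeBelow-synthetic a p (λ i _ → p< (suc i) (s≤s z≤n)) j z≤n
  DegreeBelow-synthetic a (b ∷ p) p< (suc j) (s≤s k≤j) =
    DegreeBelow-synthetic a p (λ i k<i → p< (suc i) (s≤s k<i)) j k≤j

  -- The head of the quotient is the value of the tail at a. Its vanishing passes the hypothesis on
  -- to the tail and reduces the value of the whole polynomial at a to its constant term.
  synthetic-zero : ∀ a p → eval p a ≈ 0# → synthetic a p ≋ [] → p ≋ []
  synthetic-zero a []      pa≈0 q≋[] = 𝒫.refl
  synthetic-zero a (b ∷ p) bpa≈0 q≋[] = 𝒫.trans (∷-cong b≈0 p≋[]) 0∷[]≋[]
    where
    p≋[] : p ≋ []
    p≋[] = synthetic-zero a p (coeff-≈ q≋[] 0) (coefficientwise (coeff-≈ q≋[] ∘ suc))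
    b≈0 : b ≈ 0#
    b≈0 = trans (sym (trans (+-congˡ (trans (*-congˡ (coeff-≈ q≋[] 0)) (zeroʳ a))) (+-identityʳ b))) bpa≈0

  -- Division by X - a for the first root a lowers the degree by one. Every other root x is a root
  -- of the quotient q, since otherwise q(x) could be cancelled from q(x) a = q(x) x, giving x = a.
  root-bound : ∀ k p → DegreeBelow k p → (r : Fin k → Carrier) → (∀ {i j} → r i ≈ r j → i ≡ j) →
               (∀ j → eval p (r j) ≈ 0#) → p ≋ []
  root-bound zero    p p< r r-injective roots = coefficientwise λ k → p< k z≤n
  root-bound (suc k) p p< r r-injective roots = synthetic-zero a p (roots zero)
    (root-bound k q (DegreeBelow-synthetic a p p<) (r ∘ suc)
      (λ eq → Fin.suc-injective (r-injective eq)) q-roots)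
    where
    a = r zero
    q = synthetic a p
    open SetoidReasoning setoid
    q-roots : ∀ j → eval q (r (suc j)) ≈ 0#
    q-roots j with eval q (r (suc j)) ≈? 0#
    ... | yes q≈0 = q≈0
    ... | no  q≉0 = contradiction (r-injective (*-cancelˡ qx q≉0 (begin
      qx * a                 ≈⟨ *-comm qx a ⟩
      a * qx                 ≈⟨ +-identityˡ _ ⟨
      0# + a * qx            ≈⟨ +-congʳ (roots (suc j)) ⟨
      eval p x + a * qx      ≈⟨ eval-synthetic a p x ⟩
      eval p a + x * qx      ≈⟨ +-congʳ (roots zero) ⟩
      0# + x * qx            ≈⟨ +-identityˡ _ ⟩
      x * qx                 ≈⟨ *-comm x qx ⟩
      qx * x                 ∎))) λ ()
      where
      x = r (suc j)
      qx = eval q x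

  -- The degree bound is put on the difference, so that the lemma also covers two monic polynomials
  -- of degree k compared at only k points.
  agree : ∀ k p p′ → DegreeBelow k (p +ₚ -ₚ p′) → (r : Fin k → Carrier) →
          (∀ {i j} → r i ≈ r j → i ≡ j) → (∀ j → eval p (r j) ≈ eval p′ (r j)) → p ≋ p′
  agree k p p′ p-p′< r r-injective p≈p′ = 𝒫-Properties.x∙y⁻¹≈ε⇒x≈y p p′
    (root-bound k (p +ₚ -ₚ p′) p-p′< r r-injective λ j →
      trans (eval-+ p (-ₚ p′) (r j))
        (trans (+-congˡ (eval-neg p′ (r j))) (x≈y⇒x∙y⁻¹≈ε (p≈p′ j))))
    where module 𝒫-Properties = RingProperties 𝒫.ring

  IsMonic⇒≉[] : ∀ {k p} → IsMonic k p → ¬ p ≋ []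
  IsMonic⇒≉[] (isMonic _ p≈1) p≋[] = 0≉1 (trans (sym (coeff-≈ p≋[] _)) p≈1)

  roots-≤-degree : ∀ {k p m} → IsMonic k p → (r : Fin m → Carrier) → (∀ {i j} → r i ≈ r j → i ≡ j) →
                   (∀ j → eval p (r j) ≈ 0#) → m ≤ k
  roots-≤-degree {k} {p} {m} p-monic r r-injective roots = ℕ.≮⇒≥ λ k<m →
    IsMonic⇒≉[] p-monic
      (root-bound m p (DegreeBelow-≤ p k<m (IsMonic.below p-monic)) r r-injective roots)

  normalize : ∀ p → ¬ p ≋ [] → ∃[ d ] ∃[ u ] IsMonic d ((u ∷ []) *ₚ p) × ¬ coeff p d ≈ 0# × DegreeBelow (suc d) p
  normalize p p≉[] with degree p (p≉[] ∘ coefficientwise)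
  ... | d , top , p< with inverse (coeff p d) top
  ... | u , pu≈1 = d , u , isMonic
    (DegreeBelow-* {0} (u ∷ []) p (λ { (suc _) _ → refl }) p<)
    (trans (coeff-*-top (u ∷ []) p 0 d (λ { (suc _) _ → refl }) p<) (trans (*-comm u _) pu≈1)) ,
    top , p<

  -- As D is monic, the leading coefficient of a nonzero s of degree d reappears in s D at degree d
  -- + k, which is at least k.
  multiple-below : ∀ {k D} → IsMonic k D → ∀ s → DegreeBelow k (s *ₚ D) → s ≋ []
  multiple-below {k} {D} (isMonic D< D≈1) s sD< with zeroₚ? s
  ... | yes s≈0 = coefficientwise s≈0
  ... | no  s≉0 = let d , top , s< = degree s s≉0 in contradiction
    (trans (sym (trans (coeff-*-top s D d k s< D<) (trans (*-congˡ D≈1) (*-identityʳ _))))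
      (sD< (d ℕ.+ k) (ℕ.m≤n+m k d)))
    top

  -- Degrees add because D is monic: with b + k > N the top coefficient of h would vanish, with b +
  -- k < N the leading 1 of S would.
  cofactor-degree : ∀ {k N D S} h → IsMonic k D → IsMonic N S → S ≋ h *ₚ D →
                    ∃[ b ] b ℕ.+ k ≡ N × DegreeBelow (suc b) h × ¬ h ≋ []
  cofactor-degree {k} {N} {D} {S} h (isMonic D< D≈1) S-monic@(isMonic S< S≈1) S≋ =
    b , ℕ.≤-antisym b+k≤N (ℕ.≮⇒≥ λ b+k<N → 0≉1 (trans (sym (DegreeBelow-* h D h< D< N b+k<N))
          (trans (sym (coeff-≈ S≋ N)) S≈1))) , h< , h≉[]
    where
    h≉[] : ¬ h ≋ []
    h≉[] h≋[] = IsMonic⇒≉[] S-monic (𝒫.trans S≋ (𝒫.*-congʳ {D} h≋[]))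
    deg = degree h (h≉[] ∘ coefficientwise)
    b = proj₁ deg
    top = proj₁ (proj₂ deg)
    h< = proj₂ (proj₂ deg)
    b+k≤N : b ℕ.+ k ≤ N
    b+k≤N = ℕ.≮⇒≥ λ N<b+k → top
      (trans (sym (trans (coeff-*-top h D b k h< D<) (trans (*-congˡ D≈1) (*-identityʳ _))))
        (trans (sym (coeff-≈ S≋ (b ℕ.+ k))) (S< _ N<b+k)))

  coeff-tabulate : ∀ {k} (f : Fin k → Carrier) j → coeff (tabulate f) (toℕ j) ≡ f j
  coeff-tabulate f zero    = ≡.refl
  coeff-tabulate f (suc j) = coeff-tabulate (f ∘ suc) j

  polyOf-below : ∀ k j → DegreeBelow k (polyOf k j)
  polyOf-below k j = length⇒DegreeBelow (polyOf k j) (ℕ.≤-reflexive (List.length-tabulate _))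

  element-injective : ∀ {i j} → element i ≈ element j → i ≡ j
  element-injective {i} {j} eq = ≡.trans (≡.sym (index-element i))
    (≡.trans (Inverse.to-cong enumeration eq) (index-element j))

  polyOf-injective : ∀ k {i j} → polyOf k i ≋ polyOf k j → i ≡ j
  polyOf-injective k {i} {j} eq = finToFun-injective {k} {n} λ x → element-injective
    (trans (reflexive (≡.sym (coeff-tabulate {k} (element ∘ finToFun i) x)))
      (trans (coeff-≈ eq (toℕ x)) (reflexive (coeff-tabulate {k} (element ∘ finToFun j) x))))

  -- The field F[X]/(P)

  module IrreducibleQuotient {k P} (P-monic : IsMonic k P) (P-irreducible : Irreducible P) where
    open Quotient commutativeRing P
    open SetoidReasoning 𝒬.setoid

    -- Dividing P by p leaves a remainder of smaller degree, and an inverse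
    -- of the remainder gives an inverse of p.
    invert-step : ∀ b p → b < k → DegreeBelow (suc b) p → ¬ p ≋ [] →
                  (∀ r → DegreeBelow b r → ¬ r ≋ [] → ∃[ u ] u *ₚ r ≡ᴰ 1# ∷ []) →
                  ∃[ u ] u *ₚ p ≡ᴰ 1# ∷ []
    invert-step b p b<k p< p≉[] invert-remainder
      with normalize p p≉[]
    ... | d , u , A-monic , top , p<′ with Quotient.divide commutativeRing ((u ∷ []) *ₚ p) A-monic P
    ...   | r , r< , Quotient._,_ s P≋ with zeroₚ? r
    ...     | yes r≈0 = unit-factor (Irreducible.split-∣1 P-irreducible (coeff-≈ P≋sA))
      where
      A = (u ∷ []) *ₚ p
      d<k : d < k
      d<k = ℕ.≤-trans (s≤s (ℕ.≮⇒≥ λ b<d → top (p< d b<d))) b<k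
      P≋sA : P ≋ s *ₚ A
      P≋sA = 𝒫.trans P≋ (𝒫.+-congʳ {s *ₚ A} (coefficientwise r≈0))
      unit-factor : s ∣ₚ (1# ∷ []) ⊎ A ∣ₚ (1# ∷ []) → ∃[ v ] v *ₚ p ≡ᴰ 1# ∷ []
      -- If s were a unit, A would be a multiple of P of degree below k, hence zero, although it is
      -- monic.
      unit-factor (inj₁ record { quotient = t ; equality = ts≈1 }) =
        contradiction (𝒫.trans (𝒫.sym tP≋A) (𝒫.*-congʳ {P}
          (multiple-below P-monic t
            (DegreeBelow-resp (𝒫.sym tP≋A) (DegreeBelow-≤ A d<k (IsMonic.below A-monic))))))
          (IsMonic⇒≉[] A-monic)
        where
        tP≋A : t *ₚ P ≋ A
        tP≋A = 𝒫.trans (𝒫.*-congˡ {t} P≋sA) (𝒫.trans (𝒫.sym (𝒫.*-assoc t s A))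
          (𝒫.trans (𝒫.*-congʳ {A} {t *ₚ s} {1# ∷ []} (coefficientwise ts≈1)) (𝒫.*-identityˡ A)))
      unit-factor (inj₂ record { quotient = t ; equality = tA≈1 }) =
        t *ₚ (u ∷ []) , ≋⇒≡ᴰ (𝒫.trans (𝒫.*-assoc t (u ∷ []) p) (coefficientwise tA≈1))
    ...     | no  r≉0 = let v , vr≡1 = invert-remainder r r<′ (r≉0 ∘ coeff-≈) in
      (v *ₚ (-ₚ s)) *ₚ (u ∷ []) , (begin
        ((v *ₚ (-ₚ s)) *ₚ (u ∷ [])) *ₚ p    ≈⟨ 𝒬.*-assoc (v *ₚ (-ₚ s)) (u ∷ []) p ⟩
        (v *ₚ (-ₚ s)) *ₚ A                  ≈⟨ 𝒬.*-assoc v (-ₚ s) A ⟩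
        v *ₚ ((-ₚ s) *ₚ A)                  ≈⟨ 𝒬.*-congˡ {v} r≡-sA ⟨
        v *ₚ r                              ≈⟨ vr≡1 ⟩
        1# ∷ []                             ∎)
      where
      A = (u ∷ []) *ₚ p
      d≤b : d ≤ b
      d≤b = ℕ.≮⇒≥ λ b<d → top (p< d b<d)
      r<′ : DegreeBelow b r
      r<′ = DegreeBelow-≤ r d≤b r<
      open RingProperties 𝒬.ring using (+-inverseˡ-unique; -‿distribˡ-*)
      r≡-sA : r ≡ᴰ (-ₚ s) *ₚ A
      r≡-sA = 𝒬.trans (+-inverseˡ-unique r (s *ₚ A) (𝒬.trans (≋⇒≡ᴰ (𝒫.sym P≋))
        ((1# ∷ []) , 𝒫.sym (𝒫.*-identityˡ P)))) (-‿distribˡ-* s A)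

    -- Euclid's algorithm by recursion on the degree bound. The condition `b ≤ k` keeps p of smaller
    -- degree than P, without which P = s A would not exclude that s is a unit.
    invert-below : ∀ b p → b ≤ k → DegreeBelow b p → ¬ p ≋ [] → ∃[ u ] u *ₚ p ≡ᴰ 1# ∷ []
    invert-below zero    p b≤k p< p≉[] = contradiction (coefficientwise λ j → p< j z≤n) p≉[]
    invert-below (suc b) p b<k p< p≉[] = invert-step b p b<k p< p≉[]
      λ r → invert-below b r (ℕ.≤-trans (ℕ.n≤1+n b) b<k)

    -- Remainders are unique: the difference is a multiple of P of degree below k, so the multiplier
    -- is zero.
    ≡ᴰ-below : ∀ {p q} → DegreeBelow k p → DegreeBelow k q → p ≡ᴰ q → p ≋ q
    ≡ᴰ-below {p} {q} p< q< (s , p≋) = 𝒫.trans p≋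
      (𝒫.trans (𝒫.+-congˡ {q} (𝒫.*-congʳ {P} (multiple-below P-monic s sP<))) (𝒫.+-identityʳ q))
      where
      open CommutativeSemigroupProperties 𝒫.+-commutativeSemigroup using (xy∙z≈xz∙y)
      sP< : DegreeBelow k (s *ₚ P)
      sP< = DegreeBelow-resp {p = p +ₚ -ₚ q}
        (𝒫.trans (𝒫.+-congʳ {(-ₚ q)} p≋)
          (𝒫.trans (xy∙z≈xz∙y q (s *ₚ P) (-ₚ q)) (𝒫.+-congʳ {s *ₚ P} (𝒫.-‿inverseʳ q))))
        (DegreeBelow-+ p (-ₚ q) p< (DegreeBelow-neg q q<))

    remainder : Poly → Poly
    remainder p = proj₁ (divide P-monic p)

    remainder-below : ∀ p → DegreeBelow k (remainder p)
    remainder-below p = proj₁ (proj₂ (divide P-monic p))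

    remainder-≡ᴰ : ∀ p → p ≡ᴰ remainder p
    remainder-≡ᴰ p = proj₂ (proj₂ (divide P-monic p))

    invert : ∀ p → ¬ p ≡ᴰ [] → ∃[ u ] p *ₚ u ≡ᴰ 1# ∷ []
    invert p p≢0 = let u , ur≡1 = invert-below k (remainder p) ℕ.≤-refl (remainder-below p)
                                    (λ r≋[] → p≢0 (𝒬.trans (remainder-≡ᴰ p) (≋⇒≡ᴰ r≋[]))) in
      u , 𝒬.trans (𝒬.*-comm p u) (𝒬.trans (𝒬.*-congˡ {u} (remainder-≡ᴰ p)) ur≡1)

    code : Poly → Fin (n ℕ.^ k)
    code p = proj₁ (polyOf-surjective k (remainder p) (remainder-below p))

    code-≡ᴰ : ∀ p → polyOf k (code p) ≡ᴰ p
    code-≡ᴰ p = 𝒬.trans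
      (≋⇒≡ᴰ (coefficientwise (proj₂ (polyOf-surjective k (remainder p) (remainder-below p)))))
      (𝒬.sym (remainder-≡ᴰ p))

    polyOf-≡ᴰ-injective : ∀ {i j} → polyOf k i ≡ᴰ polyOf k j → i ≡ j
    polyOf-≡ᴰ-injective {i} {j} eq =
      polyOf-injective k (≡ᴰ-below (polyOf-below k i) (polyOf-below k j) eq)

    -- A residue class is numbered by the k coefficients of its remainder, which gives the order
    -- n^k. Fermat's theorem in this field is the source of the congruence X^(n^k) ≡ X modulo P.
    quotientField : FiniteField c (c ⊔ ℓ) (n ℕ.^ k)
    quotientField = record
      { commutativeRing = quotientRing
      ; 0≉1         = λ 0≡1 → let (s , 1≋) = 𝒬.sym 0≡1 in
          Irreducible.p∤1 P-irreducible (record { quotient = s ; equality = λ j → sym (coeff-≈ 1≋ j) })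
      ; inverse     = invert
      ; enumeration = record
        { to        = code
        ; from      = polyOf k
        ; to-cong   = λ {p} {q} p≡q → polyOf-≡ᴰ-injective
            (𝒬.trans (code-≡ᴰ p) (𝒬.trans p≡q (𝒬.sym (code-≡ᴰ q))))
        ; from-cong = λ { ≡.refl → 𝒬.refl }
        ; inverse   = (λ {j} {p} p≡ → polyOf-≡ᴰ-injective (𝒬.trans (code-≡ᴰ p) p≡)) ,
                      (λ { {p} ≡.refl → code-≡ᴰ p })
        }
      }

    fermat-quotient : ∀ p → p ^ₚ (n ℕ.^ k) ≡ᴰ p
    fermat-quotient p = ≡.subst (_≡ᴰ p) (^-agree p (n ℕ.^ k)) (FieldProperties.fermat quotientField p)

-- Subfields

module SubfieldFermat {n} (F : FiniteField c ℓ n) {S : Subset n}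
  (S-subfield : Subfields.IsSubfield F S) where
  open FiniteField F
  open FieldProperties F
  open Subfields F
  open IsSubfield S-subfield
  open Exp commutativeSemiring using (_^_)

  private
    rawSubring : RawRing c ℓ
    rawSubring = record
      { Carrier = Σ Carrier (_∈ᶠ S)
      ; _≈_     = λ x y → proj₁ x ≈ proj₁ y
      ; _+_     = λ { (x , x∈) (y , y∈) → x + y , +-closed x∈ y∈ }
      ; _*_     = λ { (x , x∈) (y , y∈) → x * y , *-closed x∈ y∈ }
      ; -_      = λ { (x , x∈) → - x , -‿closed x∈ }
      ; 0#      = 0# , 0#∈
      ; 1#      = 1# , 1#∈
      }

    inclusion : IsRingMonomorphism rawSubring rawRing proj₁
    inclusion = record
      { isRingHomomorphism = record
        { isSemiringHomomorphism = record
          { isNearSemiringHomomorphism = record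
            { +-isMonoidHomomorphism = record
              { isMagmaHomomorphism = record
                { isRelHomomorphism = record { cong = id }
                ; homo              = λ _ _ → refl
                }
              ; ε-homo = refl
              }
            ; *-homo = λ _ _ → refl
            }
          ; 1#-homo = refl
          }
        ; -‿homo = λ _ → refl
        }
      ; injective = id
      }

    element-∈ : ∀ {j} → j ∈ₛ S → element j ∈ᶠ S
    element-∈ {j} = ≡.subst (_∈ₛ S) (≡.sym (index-element j))

    rank : ∀ {x} → x ∈ᶠ S → Fin ∣ S ∣
    rank x∈ = proj₁ (position S x∈)

    element-rank : ∀ {x} (x∈ : x ∈ᶠ S) → element (member S (rank x∈)) ≈ x
    element-rank {x} x∈ = trans (reflexive (≡.cong element (proj₂ (position S x∈)))) (element-index x)

    element-member-injective : ∀ {i j} → element (member S i) ≈ element (member S j) → i ≡ j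
    element-member-injective eq = member-injective S
      (≡.trans (≡.sym (index-element _)) (≡.trans (Inverse.to-cong enumeration eq) (index-element _)))

    subfield : FiniteField c ℓ ∣ S ∣
    subfield = record
      { commutativeRing = record
        { isCommutativeRing = RingMonomorphism.isCommutativeRing inclusion isCommutativeRing }
      ; 0≉1         = 0≉1
      ; inverse     = λ { (x , x∈) x≉0 → let y , xy≈1 = inverse x x≉0 in
                          (y , ⁻¹-closed x∈ xy≈1) , xy≈1 }
      ; enumeration = record
        { to        = λ { (x , x∈) → rank x∈ }
        ; from      = λ j → element (member S j) , element-∈ (member-∈ S j)
        ; to-cong   = λ { {x , x∈} {y , y∈} x≈y → element-member-injective
                          (trans (element-rank x∈) (trans x≈y (sym (element-rank y∈)))) }
        ; from-cong = λ { ≡.refl → refl }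
        ; inverse   = (λ { {j} {x , x∈} x≈ → element-member-injective (trans (element-rank x∈) x≈) }) ,
                      (λ { {x , x∈} ≡.refl → element-rank x∈ })
        }
      }

    module Sub = FiniteField subfield
    open Exp Sub.commutativeSemiring using () renaming (_^_ to _^ˢ_)

    proj₁-^ : ∀ x k → proj₁ (x ^ˢ k) ≡ proj₁ x ^ k
    proj₁-^ x zero    = ≡.refl
    proj₁-^ x (suc k) = ≡.cong (proj₁ x *_) (proj₁-^ x k)

  -- With the operations restricted to it, S is itself a finite field of order `∣ S ∣`, so Fermat's
  -- theorem applies inside S.
  fermat-∈ : ∀ {x} → x ∈ᶠ S → x ^ ∣ S ∣ ≈ x
  fermat-∈ {x} x∈ = trans (reflexive (≡.sym (proj₁-^ (x , x∈) ∣ S ∣)))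
    (FieldProperties.fermat subfield (x , x∈))

-- The extension K → L

module Extension (q m : ℕ) (1≤m : 1 ≤ m) (K : FiniteField c ℓ q) (L : FiniteField c′ ℓ′ (q ℕ.^ m))
  (ι : FiniteField.Carrier K → FiniteField.Carrier L)
  (ι-isRingHomomorphism :
    IsRingHomomorphism (FiniteField.rawRing K) (FiniteField.rawRing L) ι) where

  module K where
    open FiniteField K public
    open FieldProperties K public
    open Polynomial commutativeRing hiding (rawSemiring) public
    open PolynomialRing commutativeRing public
    open PolynomialsOverField K public
  open FiniteField L
  open FieldProperties L
  open Polynomial commutativeRing hiding (rawSemiring)
  open PolynomialRing commutativeRing
  open PolynomialsOverField L hiding (module IrreducibleQuotient)
  module ι = IsRingHomomorphism ι-isRingHomomorphism
  open Exp commutativeSemiring using (_^_; ^-distrib-*; ^-congˡ; ^-congʳ; ^-assocʳ)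
  open RingProperties ring using (x≈y⇒x∙y⁻¹≈ε; x∙y⁻¹≈ε⇒x≈y; +-inverseʳ-unique)
  open SubfieldPreservingMaps q m K L ι ι-isRingHomomorphism
    using (InBase)
  open Subfields L
  open SetoidReasoning setoid

  ι-injective : ∀ {a b} → ι a ≈ ι b → a K.≈ b
  ι-injective {a} {b} ιa≈ιb with (a K.+ K.- b) K.≈? K.0#
  ... | yes a-b≈0 = RingProperties.x∙y⁻¹≈ε⇒x≈y K.ring a b a-b≈0
  ... | no  a-b≉0 = let u , eq = K.inverse (a K.+ K.- b) a-b≉0 in contradiction (begin
    0#                              ≈⟨ zeroˡ (ι u) ⟨
    0# * ι u                        ≈⟨ *-congʳ (x≈y⇒x∙y⁻¹≈ε ιa≈ιb) ⟨
    (ι a + - ι b) * ι u             ≈⟨ *-congʳ (trans (ι.+-homo a (K.- b)) (+-congˡ (ι.-‿homo b))) ⟨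
    ι (a K.+ K.- b) * ι u           ≈⟨ ι.*-homo _ u ⟨
    ι ((a K.+ K.- b) K.* u)         ≈⟨ ι.⟦⟧-cong eq ⟩
    ι K.1#                          ≈⟨ ι.1#-homo ⟩
    1#                              ∎) 0≉1

  -- Values in `L` of polynomials over `K`

  coeff-map : ∀ p k → coeff (map ι p) k ≈ ι (K.coeff p k)
  coeff-map []      k       = sym ι.0#-homo
  coeff-map (a ∷ p) zero    = refl
  coeff-map (a ∷ p) (suc k) = coeff-map p k

  map-below : ∀ {k} p → K.DegreeBelow k p → DegreeBelow k (map ι p)
  map-below p p< j k≤j = trans (coeff-map p j) (trans (ι.⟦⟧-cong (p< j k≤j)) ι.0#-homo)

  map-injective : ∀ p → map ι p ≋ [] → p K.≋ []
  map-injective p eq = K.coefficientwise λ k →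
    ι-injective (trans (sym (coeff-map p k)) (trans (coeff-≈ eq k) (sym ι.0#-homo)))

  infix 8 ⟦_⟧
  ⟦_⟧ : K.Poly → Carrier → Carrier
  ⟦ p ⟧ x = eval (map ι p) x

  map-resp : ∀ {p p′} → p K.≋ p′ → map ι p ≋ map ι p′
  map-resp {p} {p′} p≋p′ = coefficientwise λ k →
    trans (coeff-map p k) (trans (ι.⟦⟧-cong (K.coeff-≈ p≋p′ k)) (sym (coeff-map p′ k)))

  ⟦⟧-resp : ∀ {p p′} x → p K.≋ p′ → ⟦ p ⟧ x ≈ ⟦ p′ ⟧ x
  ⟦⟧-resp x p≋p′ = eval-resp x (map-resp p≋p′)

  ⟦⟧-cong : ∀ p {x y} → x ≈ y → ⟦ p ⟧ x ≈ ⟦ p ⟧ y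
  ⟦⟧-cong p = eval-cong (map ι p)

  ⟦⟧-+ : ∀ p p′ x → ⟦ p K.+ₚ p′ ⟧ x ≈ ⟦ p ⟧ x + ⟦ p′ ⟧ x
  ⟦⟧-+ p p′ x = trans (eval-resp {map ι (p K.+ₚ p′)} {map ι p +ₚ map ι p′} x (coefficientwise λ k → begin
    coeff (map ι (p K.+ₚ p′)) k                 ≈⟨ coeff-map (p K.+ₚ p′) k ⟩
    ι (K.coeff (p K.+ₚ p′) k)                   ≈⟨ ι.⟦⟧-cong (K.coeff-+ p p′ k) ⟩
    ι (K.coeff p k K.+ K.coeff p′ k)            ≈⟨ ι.+-homo _ _ ⟩
    ι (K.coeff p k) + ι (K.coeff p′ k)          ≈⟨ +-cong (coeff-map p k) (coeff-map p′ k) ⟨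
    coeff (map ι p) k + coeff (map ι p′) k      ≈⟨ coeff-+ (map ι p) (map ι p′) k ⟨
    coeff (map ι p +ₚ map ι p′) k               ∎)) (eval-+ (map ι p) (map ι p′) x)

  ⟦⟧-· : ∀ a p x → ⟦ a K.·ₚ p ⟧ x ≈ ι a * ⟦ p ⟧ x
  ⟦⟧-· a p x = trans (eval-resp {map ι (a K.·ₚ p)} {ι a ·ₚ map ι p} x (coefficientwise λ k → begin
    coeff (map ι (a K.·ₚ p)) k       ≈⟨ coeff-map (a K.·ₚ p) k ⟩
    ι (K.coeff (a K.·ₚ p) k)         ≈⟨ ι.⟦⟧-cong (K.coeff-· a p k) ⟩
    ι (a K.* K.coeff p k)            ≈⟨ ι.*-homo a _ ⟩
    ι a * ι (K.coeff p k)            ≈⟨ *-congˡ (coeff-map p k) ⟨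
    ι a * coeff (map ι p) k          ≈⟨ coeff-· (ι a) (map ι p) k ⟨
    coeff (ι a ·ₚ map ι p) k         ∎)) (eval-· (ι a) (map ι p) x)

  ⟦⟧-* : ∀ p p′ x → ⟦ p K.*ₚ p′ ⟧ x ≈ ⟦ p ⟧ x * ⟦ p′ ⟧ x
  ⟦⟧-* []      p′ x = sym (zeroˡ _)
  ⟦⟧-* (a ∷ p) p′ x = begin
    ⟦ a K.·ₚ p′ K.+ₚ (K.0# ∷ p K.*ₚ p′) ⟧ x             ≈⟨ ⟦⟧-+ (a K.·ₚ p′) (K.0# ∷ p K.*ₚ p′) x ⟩
    ⟦ a K.·ₚ p′ ⟧ x + (ι K.0# + x * ⟦ p K.*ₚ p′ ⟧ x)    ≈⟨ +-cong (⟦⟧-· a p′ x) (trans (+-congʳ ι.0#-homo) (+-identityˡ _)) ⟩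
    ι a * ⟦ p′ ⟧ x + x * ⟦ p K.*ₚ p′ ⟧ x                ≈⟨ +-congˡ (trans (*-congˡ (⟦⟧-* p p′ x)) (sym (*-assoc x _ _))) ⟩
    ι a * ⟦ p′ ⟧ x + (x * ⟦ p ⟧ x) * ⟦ p′ ⟧ x           ≈⟨ distribʳ _ (ι a) _ ⟨
    (ι a + x * ⟦ p ⟧ x) * ⟦ p′ ⟧ x                      ∎

  ⟦⟧-1 : ∀ x → ⟦ K.1# ∷ [] ⟧ x ≈ 1#
  ⟦⟧-1 x = trans (+-cong ι.1#-homo (zeroʳ x)) (+-identityʳ 1#)

  ⟦⟧-linear : ∀ a x → ⟦ a ∷ K.1# ∷ [] ⟧ x ≈ ι a + x
  ⟦⟧-linear a x = +-congˡ (trans (*-congˡ (⟦⟧-1 x)) (*-identityʳ x))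

  ⟦⟧-X : ∀ x → ⟦ K.X ⟧ x ≈ x
  ⟦⟧-X x = trans (⟦⟧-linear K.0# x) (trans (+-congʳ ι.0#-homo) (+-identityˡ x))

  ⟦⟧-^ : ∀ p n x → ⟦ p K.^ₚ n ⟧ x ≈ ⟦ p ⟧ x ^ n
  ⟦⟧-^ p zero    x = ⟦⟧-1 x
  ⟦⟧-^ p (suc n) x = trans (⟦⟧-* p (p K.^ₚ n) x) (*-congˡ (⟦⟧-^ p n x))

  ⟦⟧-neg : ∀ p x → ⟦ K.-ₚ p ⟧ x ≈ - ⟦ p ⟧ x
  ⟦⟧-neg p x = +-inverseʳ-unique _ _
    (trans (sym (⟦⟧-+ p (K.-ₚ p) x)) (⟦⟧-resp x (K.𝒫.-‿inverseʳ p)))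

  ⟦⟧-X^ : ∀ N x → ⟦ K.X K.^ₚ N ⟧ x ≈ x ^ N
  ⟦⟧-X^ N x = trans (⟦⟧-^ K.X N x) (^-congˡ N (⟦⟧-X x))

  ⟦⟧-Φ : ∀ N x → ⟦ K.Φ N ⟧ x ≈ x ^ N + - x
  ⟦⟧-Φ N x = trans (⟦⟧-+ (K.X K.^ₚ N) (K.-ₚ K.X) x)
    (+-cong (⟦⟧-X^ N x) (trans (⟦⟧-neg K.X x) (-‿cong (⟦⟧-X x))))

  eval-Φ : ∀ N x → eval (Φ N) x ≈ x ^ N + - x
  eval-Φ N x = trans (eval-+ (X ^ₚ N) (-ₚ X) x)
    (+-cong (trans (eval-^ X N x) (^-congˡ N (eval-X x))) (trans (eval-neg X x) (-‿cong (eval-X x))))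

  -- The Frobenius automorphism

  φ : Carrier → Carrier
  φ x = x ^ q

  φ-cong : ∀ {x y} → x ≈ y → φ x ≈ φ y
  φ-cong = ^-congˡ q

  -- (1 + X)^q and X^q + 1 are monic of degree q and agree on K.
  freshman : (K.1# ∷ K.1# ∷ []) K.^ₚ q K.≋ K.X K.^ₚ q K.+ₚ (K.1# ∷ [])
  freshman = K.agree q _ _ (K.IsMonic-cancel (K.IsMonic-^ (K.IsMonic-linear K.1#) q)
      (K.IsMonic-+ (K.1# ∷ []) (K.IsMonic-^ (K.IsMonic-linear K.0#) q)
        (K.DegreeBelow-≤ (K.1# ∷ []) (ℕ.<⇒≤ K.2≤n) (K.IsMonic.below K.IsMonic-1))))
    K.element K.element-injective λ j → let a = K.element j in
      K.trans (K.eval-^ (K.1# ∷ K.1# ∷ []) q a) (K.trans (K.fermat _)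
        (K.trans (K.eval-linear K.1# a) (K.trans (K.+-comm _ _) (K.sym
          (K.trans (K.eval-+ (K.X K.^ₚ q) (K.1# ∷ []) a) (K.+-cong
            (K.trans (K.eval-^ K.X q a) (K.trans (K.fermat _) (K.eval-X a)))
            (K.eval-1 a)))))))

  φ-1+ : ∀ x → φ (1# + x) ≈ φ x + 1#
  φ-1+ x = begin
    (1# + x) ^ q                                 ≈⟨ ^-congˡ q (trans (⟦⟧-linear K.1# x) (+-congʳ ι.1#-homo)) ⟨
    (⟦ K.1# ∷ K.1# ∷ [] ⟧ x) ^ q                 ≈⟨ ⟦⟧-^ (K.1# ∷ K.1# ∷ []) q x ⟨
    ⟦ (K.1# ∷ K.1# ∷ []) K.^ₚ q ⟧ x              ≈⟨ ⟦⟧-resp x freshman ⟩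
    ⟦ K.X K.^ₚ q K.+ₚ (K.1# ∷ []) ⟧ x            ≈⟨ ⟦⟧-+ (K.X K.^ₚ q) (K.1# ∷ []) x ⟩
    ⟦ K.X K.^ₚ q ⟧ x + ⟦ K.1# ∷ [] ⟧ x           ≈⟨ +-cong (⟦⟧-X^ q x) (⟦⟧-1 x) ⟩
    x ^ q + 1#                                   ∎

  φ-* : ∀ x y → φ (x * y) ≈ φ x * φ y
  φ-* x y = ^-distrib-* x y q

  -- The power is carried through ι by regarding ι a as the value of a constant polynomial; Fermat's
  -- theorem in `K` then applies.
  φ-ι : ∀ a → φ (ι a) ≈ ι a
  φ-ι a = begin
    φ (ι a)               ≈⟨ φ-cong (trans (+-congˡ (zeroʳ 0#)) (+-identityʳ (ι a))) ⟨
    (⟦ a ∷ [] ⟧ 0#) ^ q      ≈⟨ ⟦⟧-^ (a ∷ []) q 0# ⟨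
    ⟦ (a ∷ []) K.^ₚ q ⟧ 0#   ≈⟨ ⟦⟧-resp 0# (const-^ q) ⟩
    ⟦ (a K^ q) ∷ [] ⟧ 0#     ≈⟨ trans (+-congˡ (zeroʳ 0#)) (+-identityʳ _) ⟩
    ι (a K^ q)               ≈⟨ ι.⟦⟧-cong (K.fermat a) ⟩
    ι a                      ∎
    where
    open Exp K.commutativeSemiring using () renaming (_^_ to _K^_)
    const-^ : ∀ n → (a ∷ []) K.^ₚ n K.≋ (a K^ n) ∷ []
    const-^ zero    = K.𝒫.refl
    const-^ (suc n) = K.𝒫.trans (K.𝒫.*-congˡ {a ∷ []} (const-^ n))
      (K.∷-cong (K.+-identityʳ _) K.𝒫.refl)

  φ-1 : φ 1# ≈ 1#
  φ-1 = trans (φ-cong (sym ι.1#-homo)) (trans (φ-ι K.1#) ι.1#-homo)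

  φ-0 : φ 0# ≈ 0#
  φ-0 = trans (φ-cong (sym ι.0#-homo)) (trans (φ-ι K.0#) ι.0#-homo)

  -- Homogeneity reduces the claim to `φ-1+`: if x is nonzero with inverse u, then x + y = x (1 + u
  -- y).
  φ-+ : ∀ x y → φ (x + y) ≈ φ x + φ y
  φ-+ x y with x ≈? 0#
  ... | yes x≈0 = begin
    φ (x + y)      ≈⟨ φ-cong (trans (+-congʳ x≈0) (+-identityˡ y)) ⟩
    φ y            ≈⟨ +-identityˡ (φ y) ⟨
    0# + φ y       ≈⟨ +-congʳ (trans (φ-cong x≈0) φ-0) ⟨
    φ x + φ y      ∎
  ... | no  x≉0 = let u , xu≈1 = inverse x x≉0
                      xuy≈y = trans (sym (*-assoc x u y)) (trans (*-congʳ xu≈1) (*-identityˡ y)) in begin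
    φ (x + y)                       ≈⟨ φ-cong (+-cong (*-identityʳ x) xuy≈y) ⟨
    φ (x * 1# + x * (u * y))        ≈⟨ φ-cong (distribˡ x 1# (u * y)) ⟨
    φ (x * (1# + u * y))            ≈⟨ φ-* x _ ⟩
    φ x * φ (1# + u * y)            ≈⟨ *-congˡ (trans (φ-1+ (u * y)) (+-comm _ 1#)) ⟩
    φ x * (1# + φ (u * y))          ≈⟨ distribˡ (φ x) 1# _ ⟩
    φ x * 1# + φ x * φ (u * y)      ≈⟨ +-cong (*-identityʳ (φ x)) (trans (sym (φ-* x (u * y))) (φ-cong xuy≈y)) ⟩
    φ x + φ y                       ∎

  φ-⟦⟧ : ∀ p x → φ (⟦ p ⟧ x) ≈ ⟦ p ⟧ (φ x)
  φ-⟦⟧ []      x = φ-0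
  φ-⟦⟧ (a ∷ p) x = trans (φ-+ (ι a) _) (+-cong (φ-ι a) (trans (φ-* x _) (*-congˡ (φ-⟦⟧ p x))))

  φ^ : ℕ → Carrier → Carrier
  φ^ zero    x = x
  φ^ (suc j) x = φ (φ^ j x)

  φ^-cong : ∀ j {x y} → x ≈ y → φ^ j x ≈ φ^ j y
  φ^-cong zero    x≈y = x≈y
  φ^-cong (suc j) x≈y = φ-cong (φ^-cong j x≈y)

  φ^-∘ : ∀ i j x → φ^ i (φ^ j x) ≡ φ^ (i ℕ.+ j) x
  φ^-∘ zero    j x = ≡.refl
  φ^-∘ (suc i) j x = ≡.cong φ (φ^-∘ i j x)

  φ^-comm : ∀ i j x → φ^ i (φ^ j x) ≡ φ^ j (φ^ i x)
  φ^-comm i j x = ≡.trans (φ^-∘ i j x)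
    (≡.trans (≡.cong (λ k → φ^ k x) (ℕ.+-comm i j)) (≡.sym (φ^-∘ j i x)))

  φ^-^ : ∀ j x → φ^ j x ≈ x ^ (q ℕ.^ j)
  φ^-^ zero    x = sym (*-identityʳ x)
  φ^-^ (suc j) x = trans (φ-cong (φ^-^ j x)) (trans (^-assocʳ x (q ℕ.^ j) q)
    (^-congʳ x (ℕ.*-comm (q ℕ.^ j) q)))

  φ^-m : ∀ x → φ^ m x ≈ x
  φ^-m x = trans (φ^-^ m x) (fermat x)

  φ^-* : ∀ k t {x} → φ^ k x ≈ x → φ^ (t ℕ.* k) x ≈ x
  φ^-* k zero    φx≈x = refl
  φ^-* k (suc t) {x} φx≈x = trans (reflexive (≡.sym (φ^-∘ k (t ℕ.* k) x)))
    (trans (φ^-cong k (φ^-* k t φx≈x)) φx≈x)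

  -- As j + j (m - 1) = j m and φ^m is the identity, φ^(j (m - 1)) inverts φ^j.
  φ^-onto : ∀ j x → φ^ j (φ^ (j ℕ.* ℕ.pred m) x) ≈ x
  φ^-onto j x = trans (reflexive (≡.trans (φ^-∘ j (j ℕ.* ℕ.pred m) x)
    (≡.cong (λ k → φ^ k x) (≡.trans (≡.sym (ℕ.*-suc j (ℕ.pred m)))
      (≡.cong (j ℕ.*_) (ℕ.suc-pred m ⦃ ℕ.>-nonZero 1≤m ⦄)))))) (φ^-* m j (φ^-m x))

  φ^-injective : ∀ j {x y} → φ^ j x ≈ φ^ j y → x ≈ y
  φ^-injective j {x} {y} eq = trans (sym (φ^-onto j x)) (trans (reflexive (φ^-comm j (j ℕ.* ℕ.pred m) x))
    (trans (φ^-cong (j ℕ.* ℕ.pred m) eq) (trans (reflexive (φ^-comm (j ℕ.* ℕ.pred m) j y)) (φ^-onto j y))))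

  φ^-⟦⟧ : ∀ j p x → φ^ j (⟦ p ⟧ x) ≈ ⟦ p ⟧ (φ^ j x)
  φ^-⟦⟧ zero    p x = refl
  φ^-⟦⟧ (suc j) p x = trans (φ-cong (φ^-⟦⟧ j p x)) (φ-⟦⟧ p (φ^ j x))

  φ^-0 : ∀ j → φ^ j 0# ≈ 0#
  φ^-0 zero    = refl
  φ^-0 (suc j) = trans (φ-cong (φ^-0 j)) φ-0

  φ^-1 : ∀ j → φ^ j 1# ≈ 1#
  φ^-1 zero    = refl
  φ^-1 (suc j) = trans (φ-cong (φ^-1 j)) φ-1

  φ^-homo-+ : ∀ j x y → φ^ j (x + y) ≈ φ^ j x + φ^ j y
  φ^-homo-+ zero    x y = refl
  φ^-homo-+ (suc j) x y = trans (φ-cong (φ^-homo-+ j x y)) (φ-+ _ _)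

  φ^-homo-* : ∀ j x y → φ^ j (x * y) ≈ φ^ j x * φ^ j y
  φ^-homo-* zero    x y = refl
  φ^-homo-* (suc j) x y = trans (φ-cong (φ^-homo-* j x y)) (φ-* _ _)

  InBase⇒fixed : ∀ {x} → InBase x → φ x ≈ x
  InBase⇒fixed (a , ιa≈x) = trans (φ-cong (sym ιa≈x)) (trans (φ-ι a) ιa≈x)

  -- Otherwise X^q − X would have q + 1 roots.
  fixed⇒InBase : ∀ {x} → φ x ≈ x → InBase x
  fixed⇒InBase {x} φx≈x with Fin.any? (λ j → ι (K.element j) ≈? x)
  ... | yes (j , ιj≈x) = K.element j , ιj≈x
  ... | no  x∉ι = contradiction (roots-≤-degree (IsMonic-Φ K.2≤n) r r-injective r-roots) ℕ.1+n≰n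
    where
    r : Fin (suc q) → Carrier
    r zero    = x
    r (suc j) = ι (K.element j)
    r-injective : ∀ {i j} → r i ≈ r j → i ≡ j
    r-injective {zero}  {zero}  eq = ≡.refl
    r-injective {zero}  {suc j} eq = contradiction (j , sym eq) x∉ι
    r-injective {suc i} {zero}  eq = contradiction (i , eq) x∉ι
    r-injective {suc i} {suc j} eq = ≡.cong suc (K.element-injective (ι-injective eq))
    r-roots : ∀ j → eval (Φ q) (r j) ≈ 0#
    r-roots zero    = trans (eval-Φ q x) (x≈y⇒x∙y⁻¹≈ε φx≈x)
    r-roots (suc j) = trans (eval-Φ q _) (x≈y⇒x∙y⁻¹≈ε (φ-ι (K.element j)))

  2≤q^ : ∀ d → 1 ≤ d → 2 ≤ q ℕ.^ d
  2≤q^ (suc d) _ = ℕ.≤-trans K.2≤n (ℕ.≤-trans (ℕ.≤-reflexive (≡.sym (ℕ.*-identityʳ q)))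
    (ℕ.*-monoʳ-≤ q (ℕ.m^n>0 q ⦃ ℕ.>-nonZero (ℕ.≤-trans (s≤s z≤n) K.2≤n) ⦄ d)))

  -- Writing X^(q^m) − X = h D, every element of L which is not a root of D is
  -- a root of h, and h has at most q^m − k roots.
  enough-roots : ∀ {k D} → K.IsMonic k D → Quotient._≡ᴰ_ K.commutativeRing D (K.X K.^ₚ (q ℕ.^ m)) K.X →
                 ∀ {a} {P : Fin (q ℕ.^ m) → Set a} (P? : ∀ j → Dec (P j)) →
                 (∀ j → ⟦ D ⟧ (element j) ≈ 0# → P j) → k ≤ ∣ comprehension P? ∣
  enough-roots {k} {D} D-monic (Quotient._,_ h X^N≋) P? roots⇒P = k≤∣R∣
    where
    N = q ℕ.^ m
    R = comprehension P?
    Φ≋hD : K.Φ N K.≋ h K.*ₚ D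
    Φ≋hD = K.𝒫.trans (K.𝒫.+-congʳ {K.-ₚ K.X} X^N≋)
      (K.𝒫.trans (xy∙z≈xz∙y K.X (h K.*ₚ D) (K.-ₚ K.X)) (K.𝒫.+-congʳ {h K.*ₚ D} (K.𝒫.-‿inverseʳ K.X)))
      where open CommutativeSemigroupProperties K.𝒫.+-commutativeSemigroup using (xy∙z≈xz∙y)
    cofactor = K.cofactor-degree h D-monic (K.IsMonic-Φ (2≤q^ m 1≤m)) Φ≋hD
    b = proj₁ cofactor
    b+k≡N = proj₁ (proj₂ cofactor)
    h< = proj₁ (proj₂ (proj₂ cofactor))
    h≉[] = proj₂ (proj₂ (proj₂ cofactor))
    r : Fin ∣ ∁ R ∣ → Carrier
    r j = element (member (∁ R) j)
    r-roots : ∀ j → ⟦ h ⟧ (r j) ≈ 0#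
    r-roots j with ⟦ h ⟧ (r j) ≈? 0#
    ... | yes h≈0 = h≈0
    ... | no  h≉0 = contradiction (begin
      ⟦ h ⟧ (r j) * ⟦ D ⟧ (r j)    ≈⟨ ⟦⟧-* h D (r j) ⟨
      ⟦ h K.*ₚ D ⟧ (r j)           ≈⟨ ⟦⟧-resp (r j) Φ≋hD ⟨
      ⟦ K.Φ N ⟧ (r j)              ≈⟨ ⟦⟧-Φ N (r j) ⟩
      r j ^ N + - r j              ≈⟨ x≈y⇒x∙y⁻¹≈ε (fermat (r j)) ⟩
      0#                           ∎)
      (*-nonzero h≉0 λ D≈0 → Subset.x∈∁p⇒x∉p (member-∈ (∁ R) j) (∈-comprehension⁺ P? (roots⇒P _ D≈0)))
    ∣∁R∣≤b : ∣ ∁ R ∣ ≤ b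
    ∣∁R∣≤b = ℕ.≮⇒≥ λ b<∣∁R∣ → h≉[] (map-injective h
      (root-bound ∣ ∁ R ∣ (map ι h) (DegreeBelow-≤ (map ι h) b<∣∁R∣ (map-below h h<)) r
        (λ eq → member-injective (∁ R) (element-injective eq)) r-roots))
    k≤∣R∣ : k ≤ ∣ R ∣
    k≤∣R∣ = ℕ.+-cancelˡ-≤ b _ _ (ℕ.≤-trans (ℕ.≤-reflexive b+k≡N)
      (ℕ.≤-trans (ℕ.m≤n+m∸n N ∣ R ∣)
        (ℕ.≤-trans (ℕ.≤-reflexive (ℕ.+-comm ∣ R ∣ _))
          (ℕ.+-monoˡ-≤ ∣ R ∣ (≡.subst (_≤ b) (Subset.∣∁p∣≡n∸∣p∣ R) ∣∁R∣≤b)))))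

  X^q^k⇒X^q^m : ∀ {k D} → k ∣ m → let open Quotient K.commutativeRing D in
                K.X K.^ₚ (q ℕ.^ k) ≡ᴰ K.X → K.X K.^ₚ (q ℕ.^ m) ≡ᴰ K.X
  X^q^k⇒X^q^m {k} {D} (divides t m≡tk) X^≡X = ≡.subst (λ N → K.X K.^ₚ N ≡ᴰ K.X)
    (≡.trans (ℕ.^-*-assoc q k t) (≡.cong (q ℕ.^_) (≡.trans (ℕ.*-comm k t) (≡.sym m≡tk))))
    (X^-iterate X^≡X t)
    where open Quotient K.commutativeRing D

  -- Subfields as fixed points of powers of φ

  Fixed : ℕ → Subset (q ℕ.^ m)
  Fixed d = comprehension λ j → φ^ d (element j) ≈? element j

  ∈-Fixed⁺ : ∀ d {x} → φ^ d x ≈ x → x ∈ᶠ Fixed d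
  ∈-Fixed⁺ d {x} fixed = ∈-comprehension⁺ (λ j → φ^ d (element j) ≈? element j)
    (trans (φ^-cong d (element-index x)) (trans fixed (sym (element-index x))))

  ∈-Fixed⁻ : ∀ d {x} → x ∈ᶠ Fixed d → φ^ d x ≈ x
  ∈-Fixed⁻ d {x} x∈ = trans (φ^-cong d (sym (element-index x)))
    (trans (∈-comprehension⁻ (λ j → φ^ d (element j) ≈? element j) x∈) (element-index x))

  Fixed-isSubfield : ∀ d → IsSubfield (Fixed d)
  Fixed-isSubfield d = record
    { 0#∈       = ∈-Fixed⁺ d (φ^-0 d)
    ; 1#∈       = ∈-Fixed⁺ d (φ^-1 d)
    ; +-closed  = λ {x} {y} x∈ y∈ → ∈-Fixed⁺ d
        (trans (φ^-homo-+ d x y) (+-cong (∈-Fixed⁻ d x∈) (∈-Fixed⁻ d y∈)))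
    ; -‿closed  = λ {x} x∈ → ∈-Fixed⁺ d (+-inverseʳ-unique x (φ^ d (- x)) (begin
        x + φ^ d (- x)           ≈⟨ +-congʳ (∈-Fixed⁻ d x∈) ⟨
        φ^ d x + φ^ d (- x)      ≈⟨ φ^-homo-+ d x (- x) ⟨
        φ^ d (x + - x)           ≈⟨ φ^-cong d (-‿inverseʳ x) ⟩
        φ^ d 0#                  ≈⟨ φ^-0 d ⟩
        0#                       ∎))
    ; *-closed  = λ {x} {y} x∈ y∈ → ∈-Fixed⁺ d
        (trans (φ^-homo-* d x y) (*-cong (∈-Fixed⁻ d x∈) (∈-Fixed⁻ d y∈)))
    ; ⁻¹-closed = λ {x} {y} x∈ xy≈1 → ∈-Fixed⁺ d
        (*-cancelˡ x (λ x≈0 → 0≉1 (trans (sym (zeroˡ y)) (trans (*-congʳ (sym x≈0)) xy≈1))) (begin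
          x * φ^ d y           ≈⟨ *-congʳ (∈-Fixed⁻ d x∈) ⟨
          φ^ d x * φ^ d y      ≈⟨ φ^-homo-* d x y ⟨
          φ^ d (x * y)         ≈⟨ φ^-cong d xy≈1 ⟩
          φ^ d 1#              ≈⟨ φ^-1 d ⟩
          1#                   ≈⟨ xy≈1 ⟨
          x * y                ∎))
    }

  fixed⇒root : ∀ d {x} → φ^ d x ≈ x → eval (Φ (q ℕ.^ d)) x ≈ 0#
  fixed⇒root d {x} fixed = trans (eval-Φ (q ℕ.^ d) x) (x≈y⇒x∙y⁻¹≈ε (trans (sym (φ^-^ d x)) fixed))

  fixed-≤ : ∀ d {k} → 1 ≤ d → (r : Fin k → Carrier) → (∀ {i j} → r i ≈ r j → i ≡ j) →
            (∀ j → φ^ d (r j) ≈ r j) → k ≤ q ℕ.^ d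
  fixed-≤ d 1≤d r r-injective r-fixed =
    roots-≤-degree (IsMonic-Φ (2≤q^ d 1≤d)) r r-injective (λ j → fixed⇒root d (r-fixed j))

  -- The degree of X^(q^d) - X bounds the number of fixed points from above. Since d divides m, this
  -- polynomial divides X^(q^m) - X, and `enough-roots` supplies the lower bound.
  ∣Fixed∣ : ∀ d → d ∣ m → 1 ≤ d → ∣ Fixed d ∣ ≡ q ℕ.^ d
  ∣Fixed∣ d d∣m 1≤d = ℕ.≤-antisym
    (fixed-≤ d 1≤d (element ∘ member (Fixed d)) (λ eq → member-injective (Fixed d) (element-injective eq))
      (λ j → ∈-comprehension⁻ (λ j → φ^ d (element j) ≈? element j) (member-∈ (Fixed d) j)))
    (enough-roots (K.IsMonic-Φ (2≤q^ d 1≤d)) (X^q^k⇒X^q^m d∣m X^≡X)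
      (λ j → φ^ d (element j) ≈? element j)
      (λ j Φ≈0 → trans (φ^-^ d _) (x∙y⁻¹≈ε⇒x≈y _ _ (trans (sym (⟦⟧-Φ (q ℕ.^ d) _)) Φ≈0))))
    where
    open Quotient K.commutativeRing (K.Φ (q ℕ.^ d))
    X^ = K.X K.^ₚ (q ℕ.^ d)
    X^≡X : X^ ≡ᴰ K.X
    X^≡X = RingProperties.x∙y⁻¹≈ε⇒x≈y 𝒬.ring X^ K.X D≡0

  fixed⇒∈𝔽 : ∀ d → d ∣ m → 1 ≤ d → ∀ {x} → φ^ d x ≈ x → x ∈𝔽 (q ℕ.^ d)
  fixed⇒∈𝔽 d d∣m 1≤d fixed = Fixed d , Fixed-isSubfield d , ∣Fixed∣ d d∣m 1≤d , ∈-Fixed⁺ d fixed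

  -- Whichever subfield S of order q^d witnesses the membership, Fermat's theorem inside S turns its
  -- order into the fixed-point equation. With `fixed⇒∈𝔽` this makes the subfield condition a
  -- statement about powers of φ.
  ∈𝔽⇒fixed : ∀ d {x} → x ∈𝔽 (q ℕ.^ d) → φ^ d x ≈ x
  ∈𝔽⇒fixed d {x} (S , S-subfield , ∣S∣≡ , x∈) =
    trans (φ^-^ d x) (trans (^-congʳ x (≡.sym ∣S∣≡)) (SubfieldFermat.fermat-∈ L S-subfield x∈))

module Orbits (q m : ℕ) (1≤m : 1 ≤ m) (K : FiniteField c ℓ q) (L : FiniteField c′ ℓ′ (q ℕ.^ m))
  (ι : FiniteField.Carrier K → FiniteField.Carrier L)
  (ι-isRingHomomorphism :
    IsRingHomomorphism (FiniteField.rawRing K) (FiniteField.rawRing L) ι) where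

  open Extension q m 1≤m K L ι ι-isRingHomomorphism
  open FiniteField L
  open FieldProperties L
  open Polynomial commutativeRing hiding (rawSemiring)
  open PolynomialRing commutativeRing
  open PolynomialsOverField L hiding (module IrreducibleQuotient)
  open RingProperties ring using (x≈y⇒x∙y⁻¹≈ε)
  open SubfieldPreservingMaps q m K L ι ι-isRingHomomorphism
    using (InBase; HasBaseCoefficients; coeff-All)
  open SetoidReasoning setoid

  -- Maps commuting with the Frobenius automorphism

  HasBaseCoefficients⇒commutes : ∀ {f : Carrier → Carrier} → HasBaseCoefficients f → ∀ x → f (φ x) ≈ φ (f x)
  HasBaseCoefficients⇒commutes {f} (p , _ , f≈p , p∈) x =
    trans (f≈p (φ x)) (trans (sym (φ-eval (coeff-All p p∈))) (φ-cong (sym (f≈p x))))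
    where
    φ-eval : ∀ {p} → All InBase p → φ (eval p x) ≈ eval p (φ x)
    φ-eval []       = φ-0
    φ-eval (a ∷ as) = trans (φ-+ _ _)
      (+-cong (InBase⇒fixed a) (trans (φ-* x _) (*-congˡ (φ-eval as))))

  -- Polynomials of degree less than N = q^m are determined by their values
  -- and there are as many of them as maps L → L.
  interpolate : ∀ (f : Carrier → Carrier) → (∀ {x y} → x ≈ y → f x ≈ f y) →
                ∃[ p ] DegreeBelow (q ℕ.^ m) p × (∀ x → f x ≈ eval p x)
  interpolate f f-cong = polyOf N j , polyOf-below N j , λ x → begin
    f x                            ≈⟨ f-cong (element-index x) ⟨
    f (element (index x))          ≈⟨ index-injective (≡.sym (values≡ (index x))) ⟩
    eval (polyOf N j) (element (index x)) ≈⟨ eval-cong (polyOf N j) (element-index x) ⟩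
    eval (polyOf N j) x            ∎
    where
    N = q ℕ.^ m
    values : Fin (N ℕ.^ N) → Fin N → Fin N
    values j i = index (eval (polyOf N j) (element i))
    values-injective : ∀ {j j′} → funToFin (values j) ≡ funToFin (values j′) → j ≡ j′
    values-injective {j} {j′} eq = polyOf-injective N (agree N (polyOf N j) (polyOf N j′)
      (DegreeBelow-+ (polyOf N j) (-ₚ polyOf N j′) (polyOf-below N j)
        (DegreeBelow-neg (polyOf N j′) (polyOf-below N j′)))
      element element-injective λ i → index-injective
        (≡.trans (≡.sym (Fin.finToFun-funToFin (values j) i))
          (≡.trans (≡.cong (λ z → finToFun {N} {N} z i) eq) (Fin.finToFun-funToFin (values j′) i))))
    target : Fin N → Fin N
    target i = index (f (element i))
    preimage = injective⇒surjective {f = funToFin ∘ values} values-injective (funToFin target)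
    j = proj₁ preimage
    values≡ : ∀ i → values j i ≡ target i
    values≡ i = ≡.trans (≡.sym (Fin.finToFun-funToFin (values j) i))
      (≡.trans (≡.cong (λ z → finToFun {N} {N} z i) (proj₂ preimage)) (Fin.finToFun-funToFin target i))

  -- The polynomial p of f and its image under φ on coefficients agree on L,
  -- so they are equal and the coefficients are fixed by φ.
  commutes⇒HasBaseCoefficients : ∀ {f : Carrier → Carrier} → (∀ {x y} → x ≈ y → f x ≈ f y) →
                                 (∀ x → f (φ x) ≈ φ (f x)) → HasBaseCoefficients f
  commutes⇒HasBaseCoefficients {f} f-cong f-φ = let p , p< , f≈p = interpolate f f-cong in
    p , p< , f≈p , λ k → fixed⇒InBase (trans (sym (coeff-φ p k)) (coeff-≈ (φp≋p p p< f≈p) k))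
    where
    coeff-φ : ∀ p k → coeff (map φ p) k ≈ φ (coeff p k)
    coeff-φ []      k       = sym φ-0
    coeff-φ (a ∷ p) zero    = refl
    coeff-φ (a ∷ p) (suc k) = coeff-φ p k
    eval-φ : ∀ p x → eval (map φ p) (φ x) ≈ φ (eval p x)
    eval-φ []      x = sym φ-0
    eval-φ (a ∷ p) x = sym (trans (φ-+ a _) (+-congˡ (trans (φ-* x _) (*-congˡ (sym (eval-φ p x))))))
    φp≋p : ∀ p → DegreeBelow (q ℕ.^ m) p → (∀ x → f x ≈ eval p x) → map φ p ≋ p
    φp≋p p p< f≈p = agree (q ℕ.^ m) (map φ p) p
      (DegreeBelow-+ (map φ p) (-ₚ p)
        (λ k k≥ → trans (coeff-φ p k) (trans (φ-cong (p< k k≥)) φ-0)) (DegreeBelow-neg p p<))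
      element element-injective λ j → let x = element j
                                          -- The value of the conjugated polynomial is known only at
                                          -- points φ y, so y is taken as the preimage φ^(m - 1) x
                                          -- of x.
                                          y = φ^ (1 ℕ.* ℕ.pred m) x in begin
        eval (map φ p) x          ≈⟨ eval-cong (map φ p) (φ^-onto 1 x) ⟨
        eval (map φ p) (φ y)      ≈⟨ eval-φ p y ⟩
        φ (eval p y)              ≈⟨ φ-cong (f≈p y) ⟨
        φ (f y)                   ≈⟨ f-φ y ⟨
        f (φ y)                   ≈⟨ f-cong (φ^-onto 1 x) ⟩
        f x                       ≈⟨ f≈p x ⟩
        eval p x                  ∎

  -- Periods of elements under φ

  record HasPeriod (k : ℕ) (x : Carrier) : Set ℓ′ where
    no-eta-equality
    constructor hasPeriod
    field
      positive : 1 ≤ k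
      fixed    : φ^ k x ≈ x
      minimal  : ∀ e → φ^ e x ≈ x → k ∣ e
  open HasPeriod

  abstract
    -- Division with remainder turns leastness among positive exponents into the divisibility
    -- required by `minimal`, from which uniqueness and `k ∣ m` are immediate.
    period : ∀ x → ∃[ k ] HasPeriod k x
    -- The search index j stands for the exponent j + 1, so that exponent 0 is excluded; it succeeds
    -- at the latest for j = m - 1.
    period x with least (λ j → φ^ (suc j) x ≈? x) (ℕ.pred m)
                    (trans (reflexive (≡.cong (λ k → φ^ k x) (ℕ.suc-pred m ⦃ ℕ.>-nonZero 1≤m ⦄))) (φ^-m x))
    ... | j , fixed , below = suc j , hasPeriod (s≤s z≤n) fixed λ e e-fixed →
      m%n≡0⇒n∣m e (suc j) (remainder≡0 (e % suc j) (m%n<n e (suc j)) (begin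
        φ^ (e % suc j) x                                ≈⟨ φ^-cong (e % suc j) (φ^-* (suc j) (e / suc j) fixed) ⟨
        φ^ (e % suc j) (φ^ (e / suc j ℕ.* suc j) x)     ≡⟨ φ^-∘ (e % suc j) _ x ⟩
        φ^ (e % suc j ℕ.+ e / suc j ℕ.* suc j) x        ≡⟨ ≡.cong (λ k → φ^ k x) (m≡m%n+[m/n]*n e (suc j)) ⟨
        φ^ e x                                          ≈⟨ e-fixed ⟩
        x                                               ∎))
      where
      remainder≡0 : ∀ r → r < suc j → φ^ r x ≈ x → r ≡ 0
      remainder≡0 zero    _         _       = ≡.refl
      remainder≡0 (suc r) (s≤s r<j) r-fixed = contradiction r-fixed (below r r<j)

  period-unique : ∀ {k k′ x} → HasPeriod k x → HasPeriod k′ x → k ≡ k′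
  period-unique per per′ = ∣-antisym (minimal per _ (fixed per′)) (minimal per′ _ (fixed per))

  period-∣m : ∀ {k x} → HasPeriod k x → k ∣ m
  period-∣m {x = x} per = minimal per m (φ^-m x)

  period-difference : ∀ {k x} → HasPeriod k x → ∀ {i j} → i ≤ j → φ^ i x ≈ φ^ j x → k ∣ j ℕ.∸ i
  period-difference {x = x} per {i} {j} i≤j eq = minimal per (j ℕ.∸ i) (φ^-injective i (begin
    φ^ i (φ^ (j ℕ.∸ i) x)     ≡⟨ φ^-∘ i (j ℕ.∸ i) x ⟩
    φ^ (i ℕ.+ (j ℕ.∸ i)) x    ≡⟨ ≡.cong (λ k → φ^ k x) (ℕ.m+[n∸m]≡n i≤j) ⟩
    φ^ j x                    ≈⟨ eq ⟨
    φ^ i x                    ∎))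

  orbit-injective : ∀ {k x} → HasPeriod k x → ∀ {i j} → i < k → j < k → φ^ i x ≈ φ^ j x → i ≡ j
  orbit-injective {k} per i<k j<k eq = ℕ.≤-antisym (bound j<k i<k (sym eq)) (bound i<k j<k eq)
    where
    bound : ∀ {i j} → i < k → j < k → φ^ i _ ≈ φ^ j _ → j ≤ i
    bound {i} {j} i<k j<k eq = ℕ.≮⇒≥ λ i<j →
      >⇒∤ ⦃ ℕ.>-nonZero (ℕ.m<n⇒0<n∸m i<j) ⦄ (ℕ.≤-<-trans (ℕ.m∸n≤m j i) j<k)
        (period-difference per (ℕ.<⇒≤ i<j) eq)

  -- Roots of irreducible polynomials

  module Root {k P} (P-monic : K.IsMonic k P) (P-irreducible : K.Irreducible P) (1≤k : 1 ≤ k)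
    {x} (root : ⟦ P ⟧ x ≈ 0#) where
    open Quotient K.commutativeRing P
    open K.IrreducibleQuotient P-monic P-irreducible

    ⟦⟧-≡ᴰ : ∀ {p p′} → p ≡ᴰ p′ → ⟦ p ⟧ x ≈ ⟦ p′ ⟧ x
    ⟦⟧-≡ᴰ {p} {p′} (s Quotient., p≋) = begin
      ⟦ p ⟧ x                       ≈⟨ ⟦⟧-resp x p≋ ⟩
      ⟦ p′ K.+ₚ s K.*ₚ P ⟧ x        ≈⟨ ⟦⟧-+ p′ (s K.*ₚ P) x ⟩
      ⟦ p′ ⟧ x + ⟦ s K.*ₚ P ⟧ x     ≈⟨ +-congˡ (trans (⟦⟧-* s P x) (trans (*-congˡ root) (zeroʳ _))) ⟩
      ⟦ p′ ⟧ x + 0#                 ≈⟨ +-identityʳ _ ⟩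
      ⟦ p′ ⟧ x                      ∎

    -- A nonzero p of degree below k has an inverse u modulo P, and p(x) u(x) = 1 forbids p(x) = 0.
    -- Thus P has least degree among the annihilators of x.
    vanishing : ∀ p → K.DegreeBelow k p → ⟦ p ⟧ x ≈ 0# → p K.≋ []
    vanishing p p< p≈0 with K.zeroₚ? p
    ... | yes p≋0 = K.coefficientwise p≋0
    ... | no  p≉0 = let u , pu≡1 = invert p (λ p≡0 → p≉0 (K.coeff-≈ (≡ᴰ-below p< (λ _ _ → K.refl) p≡0))) in
      contradiction (begin
        0#                       ≈⟨ zeroˡ _ ⟨
        0# * ⟦ u ⟧ x             ≈⟨ *-congʳ p≈0 ⟨
        ⟦ p ⟧ x * ⟦ u ⟧ x        ≈⟨ ⟦⟧-* p u x ⟨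
        ⟦ p K.*ₚ u ⟧ x           ≈⟨ ⟦⟧-≡ᴰ pu≡1 ⟩
        ⟦ K.1# ∷ [] ⟧ x          ≈⟨ ⟦⟧-1 x ⟩
        1#                       ∎) 0≉1

    below-unique : ∀ p p′ → K.DegreeBelow k (p K.+ₚ K.-ₚ p′) → ⟦ p ⟧ x ≈ ⟦ p′ ⟧ x → p K.≋ p′
    below-unique p p′ p-p′< eq = RingProperties.x∙y⁻¹≈ε⇒x≈y K.𝒫.ring p p′
      (vanishing (p K.+ₚ K.-ₚ p′) p-p′<
        (trans (⟦⟧-+ p (K.-ₚ p′) x) (trans (+-congˡ (⟦⟧-neg p′ x)) (x≈y⇒x∙y⁻¹≈ε eq))))

    -- Hence a root of P determines P, and different irreducible polynomials of degree k belong to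
    -- different orbits.
    monic-unique : ∀ {P′} → K.IsMonic k P′ → ⟦ P′ ⟧ x ≈ 0# → P K.≋ P′
    monic-unique {P′} P′-monic root′ =
      below-unique P P′ (K.IsMonic-cancel P-monic P′-monic) (trans root (sym root′))

    φ^k-fixed : φ^ k x ≈ x
    φ^k-fixed = begin
      φ^ k x                            ≈⟨ φ^-^ k x ⟩
      x ^ (q ℕ.^ k)                     ≈⟨ ⟦⟧-X^ (q ℕ.^ k) x ⟨
      ⟦ K.X K.^ₚ (q ℕ.^ k) ⟧ x          ≈⟨ ⟦⟧-≡ᴰ (fermat-quotient K.X) ⟩
      ⟦ K.X ⟧ x                         ≈⟨ ⟦⟧-X x ⟩
      x                                 ∎
      where open Exp commutativeSemiring using (_^_)

    -- The q^k values of polynomials of degree less than k at x are distinct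
    -- and fixed by φ^e when φ^e fixes x.
    root-period : HasPeriod k x
    root-period = let e , per = period x in ≡.subst (λ j → HasPeriod j x) (e≡k per) per
      where
      e≡k : ∀ {e} → HasPeriod e x → e ≡ k
      e≡k {e} per = ℕ.≤-antisym
        (∣⇒≤ ⦃ ℕ.>-nonZero 1≤k ⦄ (minimal per k φ^k-fixed))
        (ℕ.≮⇒≥ λ e<k → ℕ.<⇒≱ (ℕ.^-monoʳ-< q K.2≤n e<k)
          (fixed-≤ e (positive per) (λ j → ⟦ K.polyOf k j ⟧ x)
            (λ {i} {j} eq → K.polyOf-injective k (below-unique (K.polyOf k i) (K.polyOf k j)
              (K.DegreeBelow-+ (K.polyOf k i) (K.-ₚ K.polyOf k j) (K.polyOf-below k i)
                (K.DegreeBelow-neg (K.polyOf k j) (K.polyOf-below k j))) eq))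
            (λ j → trans (φ^-⟦⟧ e (K.polyOf k j) x) (⟦⟧-cong (K.polyOf k j) (fixed per)))))

    -- The orbit of x already consists of k distinct roots, so a root outside it would be number k +
    -- 1 for a polynomial of degree k.
    conjugate : ∀ {y} → ⟦ P ⟧ y ≈ 0# → ∃[ i ] y ≈ φ^ i x
    conjugate {y} y-root with Fin.any? (λ (j : Fin k) → φ^ (toℕ j) x ≈? y)
    ... | yes (j , eq) = toℕ j , sym eq
    ... | no  y∉ = contradiction
      (map-injective P
        (root-bound (suc k) (map ι P) (map-below P (K.IsMonic.below P-monic)) r r-injective r-roots))
      (K.IsMonic⇒≉[] P-monic)
      where
      r : Fin (suc k) → Carrier
      r zero    = y
      r (suc j) = φ^ (toℕ j) x
      r-injective : ∀ {i j} → r i ≈ r j → i ≡ j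
      r-injective {zero}  {zero}  eq = ≡.refl
      r-injective {zero}  {suc j} eq = contradiction (j , sym eq) y∉
      r-injective {suc i} {zero}  eq = contradiction (i , eq) y∉
      r-injective {suc i} {suc j} eq = ≡.cong suc
        (Fin.toℕ-injective (orbit-injective root-period (Fin.toℕ<n i) (Fin.toℕ<n j) eq))
      r-roots : ∀ j → ⟦ P ⟧ (r j) ≈ 0#
      r-roots zero    = y-root
      r-roots (suc j) = trans (sym (φ^-⟦⟧ (toℕ j) P x)) (trans (φ^-cong (toℕ j) root) (φ^-0 (toℕ j)))

  -- Monic polynomials over `K` by index, and minimal polynomials

  monicOf : ∀ k → Fin (q ℕ.^ k) → K.Poly
  monicOf k j = K.monic (K.element ∘ finToFun {q} {k} j)

  monicOf-monic : ∀ k j → K.IsMonic k (monicOf k j)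
  monicOf-monic k j = K.monic-IsMonic (K.element ∘ finToFun {q} {k} j)

  monicOf-surjective : ∀ {k p} → K.IsMonic k p → ∃[ j ] monicOf k j K.≋ p
  monicOf-surjective {k} {p} p-monic = funToFin {k} f , K.monic-≋ _ p p-monic λ i →
    K.trans (K.reflexive (≡.cong K.element (Fin.finToFun-funToFin f i))) (K.element-index _)
    where
    f : Fin k → Fin q
    f i = K.index (K.coeff p (toℕ i))

  monicOf-injective : ∀ k {i j} → monicOf k i K.≋ monicOf k j → i ≡ j
  monicOf-injective k {i} {j} eq = finToFun-injective {k} {q} λ x → K.element-injective
    (K.trans (K.reflexive (≡.sym (K.coeff-monic (K.element ∘ finToFun {q} {k} i) x)))
      (K.trans (K.coeff-≈ eq (toℕ x)) (K.reflexive (K.coeff-monic (K.element ∘ finToFun {q} {k} j) x))))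

  -- A monic annihilator of x of least degree is irreducible.
  minimalPolynomial : ∀ x → ∃[ d ] ∃[ j ] 1 ≤ d × K.Irreducible (monicOf d j) × ⟦ monicOf d j ⟧ x ≈ 0#
  minimalPolynomial x = d , j , 1≤d , irreducible , root
    where
    annihilates? : ∀ d → Dec (∃[ j ] ⟦ monicOf d j ⟧ x ≈ 0#)
    annihilates? d = Fin.any? λ j → ⟦ monicOf d j ⟧ x ≈? 0#
    annihilator : ∀ {d p} → K.IsMonic d p → ⟦ p ⟧ x ≈ 0# → ∃[ j ] ⟦ monicOf d j ⟧ x ≈ 0#
    annihilator p-monic p≈0 = let j , eq = monicOf-surjective p-monic in
      j , trans (⟦⟧-resp x eq) p≈0
    N = q ℕ.^ m
    -- The degree q^m certainly occurs: X^(q^m) - X annihilates every element of `L`.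
    search = least annihilates? N (annihilator (K.IsMonic-Φ (2≤q^ m 1≤m))
      (trans (⟦⟧-Φ N x) (x≈y⇒x∙y⁻¹≈ε (fermat x))))
    d = proj₁ search
    j = proj₁ (proj₁ (proj₂ search))
    root = proj₂ (proj₁ (proj₂ search))
    below = proj₂ (proj₂ search)
    P = monicOf d j
    P-monic = monicOf-monic d j
    constant : ∀ {p} → K.IsMonic 0 p → p K.≋ (K.1# ∷ [])
    constant (K.isMonic p< p≈1) = K.coefficientwise λ { zero → p≈1 ; (suc k) → p< (suc k) (s≤s z≤n) }
    1≤d : 1 ≤ d
    1≤d = ℕ.≮⇒≥ λ { (s≤s d≤0) → 0≉1 (trans (sym root) (trans
      (⟦⟧-resp x (constant (≡.subst (λ e → K.IsMonic e P) (ℕ.n≤0⇒n≡0 d≤0) P-monic))) (⟦⟧-1 x))) }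
    -- The factor a annihilates x, so its degree is at least the least degree d; the degrees of a
    -- and b add up to at most d, hence b is constant.
    cofactor : ∀ a b → P K.≋ a K.*ₚ b → ⟦ a ⟧ x ≈ 0# → b K.∣ₚ (K.1# ∷ [])
    cofactor a b P≋ab a≈0 = record { quotient = v ∷ [] ; equality = K.coeff-≈ (constant vb-monic) }
      where
      P≉[] = K.IsMonic⇒≉[] P-monic
      a≉[] : ¬ a K.≋ []
      a≉[] a≋[] = P≉[] (K.𝒫.trans P≋ab (K.𝒫.*-congʳ {b} a≋[]))
      b≉[] : ¬ b K.≋ []
      b≉[] b≋[] = P≉[] (K.𝒫.trans P≋ab (K.𝒫.trans (K.𝒫.*-congˡ {a} b≋[]) (K.𝒫.zeroʳ a)))
      normal-a = K.normalize a a≉[]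
      normal-b = K.normalize b b≉[]
      d′ = proj₁ normal-a
      e  = proj₁ normal-b
      u  = proj₁ (proj₂ normal-a)
      v  = proj₁ (proj₂ normal-b)
      ua-monic = proj₁ (proj₂ (proj₂ normal-a))
      a-top = proj₁ (proj₂ (proj₂ (proj₂ normal-a)))
      b-top = proj₁ (proj₂ (proj₂ (proj₂ normal-b)))
      a< = proj₂ (proj₂ (proj₂ (proj₂ normal-a)))
      b< = proj₂ (proj₂ (proj₂ (proj₂ normal-b)))
      d≤d′ : d ≤ d′
      d≤d′ = ℕ.≮⇒≥ λ d′<d → below d′ d′<d (annihilator ua-monic
        (trans (⟦⟧-* (u ∷ []) a x) (trans (*-congˡ a≈0) (zeroʳ _))))
      d′+e≤d : d′ ℕ.+ e ≤ d
      d′+e≤d = ℕ.≮⇒≥ λ d<d′+e → K.*-nonzero a-top b-top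
        (K.trans (K.sym (K.coeff-*-top a b d′ e a< b<)) (K.trans (K.sym (K.coeff-≈ P≋ab _))
          (K.IsMonic.below P-monic _ d<d′+e)))
      e≡0 : e ≡ 0
      e≡0 = ℕ.n≤0⇒n≡0 (ℕ.+-cancelˡ-≤ d′ e 0
        (ℕ.≤-trans d′+e≤d (ℕ.≤-trans d≤d′ (ℕ.≤-reflexive (≡.sym (ℕ.+-identityʳ d′))))))
      vb-monic : K.IsMonic 0 ((v ∷ []) K.*ₚ b)
      vb-monic = ≡.subst (λ i → K.IsMonic i ((v ∷ []) K.*ₚ b)) e≡0 (proj₁ (proj₂ (proj₂ normal-b)))
    irreducible : K.Irreducible P
    irreducible = K.mkIrred
      (λ { record { quotient = s ; equality = sP≈1 } → 0≉1 (begin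
        0#                       ≈⟨ zeroʳ (⟦ s ⟧ x) ⟨
        ⟦ s ⟧ x * 0#             ≈⟨ *-congˡ root ⟨
        ⟦ s ⟧ x * ⟦ P ⟧ x        ≈⟨ ⟦⟧-* s P x ⟨
        ⟦ s K.*ₚ P ⟧ x           ≈⟨ ⟦⟧-resp {s K.*ₚ P} {K.1# ∷ []} x (K.coefficientwise sP≈1) ⟩
        ⟦ K.1# ∷ [] ⟧ x          ≈⟨ ⟦⟧-1 x ⟩
        1#                       ∎) })
      (λ {a} {b} P≈ab → split a b (K.coefficientwise P≈ab))
      where
      split : ∀ a b → P K.≋ a K.*ₚ b → a K.∣ₚ (K.1# ∷ []) ⊎ b K.∣ₚ (K.1# ∷ [])
      split a b P≋ab = zero-factor (⟦ a ⟧ x ≈? 0#) (⟦ b ⟧ x ≈? 0#)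
        where
        zero-factor : Dec (⟦ a ⟧ x ≈ 0#) → Dec (⟦ b ⟧ x ≈ 0#) → a K.∣ₚ (K.1# ∷ []) ⊎ b K.∣ₚ (K.1# ∷ [])
        zero-factor (yes a≈0) _         = inj₂ (cofactor a b P≋ab a≈0)
        zero-factor (no _)    (yes b≈0) = inj₁ (cofactor b a (K.𝒫.trans P≋ab (K.𝒫.*-comm a b)) b≈0)
        zero-factor (no a≉0)  (no b≉0)  = contradiction
          (trans (sym (⟦⟧-* a b x)) (trans (sym (⟦⟧-resp x P≋ab)) root)) (*-nonzero a≉0 b≉0)

  -- Representatives of the orbits

  -- The same filter as in the definition of `π`, so that its positions are `Fin (π K k)` by
  -- definition.
  irreducibles : ∀ k → List (Fin (q ℕ.^ k))
  irreducibles k = filter (λ j → K.irreducible? (K.element ∘ finToFun {q} {k} j)) (allFin (q ℕ.^ k))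

  divisor-positive : ∀ {k} → k ∣ m → 1 ≤ k
  divisor-positive {zero}  0∣m = contradiction (0∣⇒≡0 0∣m) (ℕ.n>0⇒n≢0 1≤m)
  divisor-positive {suc k} _   = s≤s z≤n

  module _ (k : ℕ) (k∣m : k ∣ m) where

    private
      1≤k : 1 ≤ k
      1≤k = divisor-positive k∣m

    irreducibleOf : Fin (π K k) → K.Poly
    irreducibleOf j = monicOf k (lookup (irreducibles k) j)

    irreducibleOf-monic : ∀ j → K.IsMonic k (irreducibleOf j)
    irreducibleOf-monic j = monicOf-monic k (lookup (irreducibles k) j)

    irreducibleOf-irreducible : ∀ j → K.Irreducible (irreducibleOf j)
    irreducibleOf-irreducible j =
      proj₂ (∈-filter⁻ (λ j → K.irreducible? (K.element ∘ finToFun {q} {k} j))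
        {xs = allFin (q ℕ.^ k)} (∈-lookup j))

    abstract
      private
        roots? : ∀ j i → Dec (⟦ irreducibleOf j ⟧ (element i) ≈ 0#)
        roots? j i = ⟦ irreducibleOf j ⟧ (element i) ≈? 0#

        -- `enough-roots` provides at least k ≥ 1 roots, so position 0 exists; the representative is
        -- the first root in the enumeration of `L`.
        root : ∀ j → Fin (∣ comprehension (roots? j) ∣)
        root j = fromℕ< (ℕ.≤-trans 1≤k (enough-roots (irreducibleOf-monic j)
          (X^q^k⇒X^q^m k∣m (fermat-quotient K.X)) (roots? j) (λ _ eq → eq)))
          where open K.IrreducibleQuotient (irreducibleOf-monic j) (irreducibleOf-irreducible j)

      rep : Fin (π K k) → Carrier
      rep j = element (member (comprehension (roots? j)) (root j))

      rep-root : ∀ j → ⟦ irreducibleOf j ⟧ (rep j) ≈ 0#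
      rep-root j = ∈-comprehension⁻ (roots? j) (member-∈ (comprehension (roots? j)) (root j))

    private
      module RepRoot j = Root (irreducibleOf-monic j) (irreducibleOf-irreducible j) 1≤k (rep-root j)

    rep-period : ∀ j → HasPeriod k (rep j)
    rep-period = RepRoot.root-period

    -- Polynomials over `K` commute with φ, so the irreducible polynomial of j′ also vanishes at
    -- `rep j`, and a common root makes the two polynomials equal.
    rep-injective : ∀ a b {j j′} → φ^ a (rep j) ≈ φ^ b (rep j′) → j ≡ j′
    rep-injective a b {j} {j′} eq =
      lookup-injective (filter⁺ _ (allFin⁺ (q ℕ.^ k)))
        (monicOf-injective k (RepRoot.monic-unique j (irreducibleOf-monic j′) (φ^-injective a (begin
          φ^ a (⟦ irreducibleOf j′ ⟧ (rep j))     ≈⟨ φ^-⟦⟧ a (irreducibleOf j′) (rep j) ⟩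
          ⟦ irreducibleOf j′ ⟧ (φ^ a (rep j))     ≈⟨ ⟦⟧-cong (irreducibleOf j′) eq ⟩
          ⟦ irreducibleOf j′ ⟧ (φ^ b (rep j′))    ≈⟨ φ^-⟦⟧ b (irreducibleOf j′) (rep j′) ⟨
          φ^ b (⟦ irreducibleOf j′ ⟧ (rep j′))    ≈⟨ trans (φ^-cong b (rep-root j′)) (φ^-0 b) ⟩
          0#                                      ≈⟨ φ^-0 a ⟨
          φ^ a 0#                                 ∎))))

    abstract
      -- The degree of the minimal polynomial of x is its period k, so this polynomial occurs among
      -- the irreducibles of degree k, and x is conjugate to the root chosen for it.
      locate : ∀ {x} → HasPeriod k x → ∃[ j ] ∃[ i ] x ≈ φ^ i (rep j)
      locate {x} per = let d , j , 1≤d , irreducible , root = minimalPolynomial x in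
        conjugate-of (≡.subst (λ e → ∃[ j ] K.Irreducible (monicOf e j) × ⟦ monicOf e j ⟧ x ≈ 0#)
          (period-unique (Root.root-period (monicOf-monic d j) irreducible 1≤d root) per)
          (j , irreducible , root))
        where
        conjugate-of : ∃[ j ] K.Irreducible (monicOf k j) × ⟦ monicOf k j ⟧ x ≈ 0# →
                       ∃[ j ] ∃[ i ] x ≈ φ^ i (rep j)
        conjugate-of (j , irreducible , root) = Any.index j∈ ,
          RepRoot.conjugate (Any.index j∈)
            (trans (reflexive (≡.cong (λ i → ⟦ monicOf k i ⟧ x) (≡.sym (lookup-index j∈)))) root)
          where
          j∈ : j Membership.∈ irreducibles k
          j∈ = ∈-filter⁺ (λ j → K.irreducible? (K.element ∘ finToFun {q} {k} j)) (∈-allFin j) irreducible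

-- For m ≥ 1 the divisor is positive and the quotient determined. The product is indexed by divisors
-- with their proofs, and this identifies indices with equal k.
∣-irrelevant : ∀ {k m} → 1 ≤ m → (p p′ : k ∣ m) → p ≡ p′
∣-irrelevant {zero}  1≤m (divides t m≡) _ =
  contradiction (≡.trans m≡ (ℕ.*-zeroʳ t)) (ℕ.n>0⇒n≢0 1≤m)
∣-irrelevant {suc k} 1≤m (divides t m≡) (divides t′ m≡′)
  with ℕ.*-cancelʳ-≡ t t′ (suc k) (≡.trans (≡.sym m≡) m≡′)
... | ≡.refl = ≡.cong (divides t) (ℕ.≡-irrelevant m≡ m≡′)

∣-difference : ∀ k {i j} → i ≤ j → k ∣ j ℕ.∸ i → + k ∣ℤ (+ i ℤ.- + j)
∣-difference k {i} {j} i≤j k∣ = ℤ.∣ᵤ⇒∣ (≡.subst (k ∣_)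
  (≡.trans (≡.sym (ℤ.∣⊖∣-≤ i≤j)) (≡.cong ℤ.∣_∣ (≡.sym (ℤ.m-n≡m⊖n i j)))) k∣)

difference-∣ : ∀ k {i j} → i ≤ j → + k ∣ℤ (+ i ℤ.- + j) → k ∣ j ℕ.∸ i
difference-∣ k {i} {j} i≤j k∣ = ≡.subst (k ∣_)
  (≡.trans (≡.cong ℤ.∣_∣ (ℤ.m-n≡m⊖n i j)) (ℤ.∣⊖∣-≤ i≤j)) (ℤ.∣⇒∣ᵤ k∣)

module Coordinates (q m : ℕ) (1≤m : 1 ≤ m) (K : FiniteField c ℓ q) (L : FiniteField c′ ℓ′ (q ℕ.^ m))
  (ι : FiniteField.Carrier K → FiniteField.Carrier L)
  (ι-isRingHomomorphism :
    IsRingHomomorphism (FiniteField.rawRing K) (FiniteField.rawRing L) ι) where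

  open Extension q m 1≤m K L ι ι-isRingHomomorphism
    using (φ; φ-cong; φ^; φ^-cong; φ^-∘; φ^-comm; φ^-m; φ^-*; φ^-injective; InBase⇒fixed; fixed⇒InBase; fixed⇒∈𝔽; ∈𝔽⇒fixed)
  open Orbits q m 1≤m K L ι ι-isRingHomomorphism
  open HasPeriod
  open FiniteField L using (Carrier; _≈_; setoid; refl; sym; trans; reflexive)
  open SubfieldPreservingMaps q m K L ι ι-isRingHomomorphism
  open Map using (_⟨$⟩_)
  open SetoidReasoning setoid

  private
    instance
      m-nonZero : ℕ.NonZero m
      m-nonZero = ℕ.>-nonZero 1≤m

    module C k = Group (C k)

  -- The action of ℤ through powers of φ

  φ^-cong-≤ : ∀ {k x} → φ^ k x ≈ x → ∀ {i j} → i ≤ j → C._≈_ k (+ i) (+ j) → φ^ i x ≈ φ^ j x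
  φ^-cong-≤ {k} {x} fixed {i} {j} i≤j i≡j with difference-∣ k i≤j i≡j
  ... | divides t j∸i≡ = begin
    φ^ i x                   ≈⟨ φ^-cong i (φ^-* k t fixed) ⟨
    φ^ i (φ^ (t ℕ.* k) x)    ≡⟨ φ^-∘ i (t ℕ.* k) x ⟩
    φ^ (i ℕ.+ t ℕ.* k) x     ≡⟨ ≡.cong (λ d → φ^ d x) (≡.trans (≡.cong (i ℕ.+_) (≡.sym j∸i≡)) (ℕ.m+[n∸m]≡n i≤j)) ⟩
    φ^ j x                   ∎

  φ^-cong-mod : ∀ {k x} → φ^ k x ≈ x → ∀ i j → C._≈_ k (+ i) (+ j) → φ^ i x ≈ φ^ j x
  φ^-cong-mod {k} {x} fixed i j i≡j with ℕ.≤-total i j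
  ... | inj₁ i≤j = φ^-cong-≤ fixed i≤j i≡j
  ... | inj₂ j≤i = sym (φ^-cong-≤ fixed j≤i (C.sym k {+ i} {+ j} i≡j))

  φ^-injective-mod : ∀ {k x} → HasPeriod k x → ∀ i j → φ^ i x ≈ φ^ j x → C._≈_ k (+ i) (+ j)
  φ^-injective-mod {k} per i j eq with ℕ.≤-total i j
  ... | inj₁ i≤j = ∣-difference k i≤j (period-difference per i≤j eq)
  ... | inj₂ j≤i = C.sym k {+ j} {+ i} (∣-difference k j≤i (period-difference per j≤i (sym eq)))

  -- As φ^m is the identity and every period divides m, reducing the exponent modulo m gives a
  -- single action of ℤ that serves all the groups C_k and allows negative twists.
  act : ℤ → Carrier → Carrier
  act z = φ^ (z %ℕ m)

  private
    remainder : ∀ z → C._≈_ m z (+ (z %ℕ m))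
    remainder z = ℤ.divides (z /ℕ m) (≡.trans
      (≡.cong (ℤ._- + (z %ℕ m)) (a≡a%ℕn+[a/ℕn]*n z m))
      (AbelianGroupProperties.xyx⁻¹≈y ℤ.+-0-abelianGroup (+ (z %ℕ m)) ((z /ℕ m) ℤ.* + m)))

    weaken : ∀ {k} → k ∣ m → ∀ {z z′} → C._≈_ m z z′ → C._≈_ k z z′
    weaken k∣m m∣ = ℤ.∣-trans (ℤ.∣ᵤ⇒∣ k∣m) m∣

    remainder-cong : ∀ {k} → k ∣ m → ∀ {z z′} → C._≈_ k z z′ → C._≈_ k (+ (z %ℕ m)) (+ (z′ %ℕ m))
    remainder-cong {k} k∣m {z} {z′} eq = C.trans k {+ (z %ℕ m)} {z} {+ (z′ %ℕ m)}
      (C.sym k {z} {+ (z %ℕ m)} (weaken k∣m {z} {+ (z %ℕ m)} (remainder z)))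
      (C.trans k {z} {z′} {+ (z′ %ℕ m)} eq (weaken k∣m {z′} {+ (z′ %ℕ m)} (remainder z′)))

  act-cong : ∀ z {x y} → x ≈ y → act z x ≈ act z y
  act-cong z = φ^-cong (z %ℕ m)

  act-mod : ∀ {k x} → k ∣ m → φ^ k x ≈ x → ∀ z z′ → C._≈_ k z z′ → act z x ≈ act z′ x
  act-mod k∣m fixed z z′ eq = φ^-cong-mod fixed (z %ℕ m) (z′ %ℕ m) (remainder-cong k∣m {z} {z′} eq)

  act-injective : ∀ {k x} → HasPeriod k x → ∀ z z′ → act z x ≈ act z′ x → C._≈_ k z z′
  act-injective {k} {x} per z z′ eq = C.trans k {z} {+ (z %ℕ m)} {z′}
    (weaken k∣m {z} {+ (z %ℕ m)} (remainder z))
    (C.trans k {+ (z %ℕ m)} {+ (z′ %ℕ m)} {z′} (φ^-injective-mod per (z %ℕ m) (z′ %ℕ m) eq)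
      (C.sym k {z′} {+ (z′ %ℕ m)} (weaken k∣m {z′} {+ (z′ %ℕ m)} (remainder z′))))
    where k∣m = period-∣m per

  act-+ : ∀ z z′ x → act (z ℤ.+ z′) x ≈ act z (act z′ x)
  act-+ z z′ x = trans
    (φ^-cong-mod (φ^-m x) r″ (r ℕ.+ r′)
      (C.trans m {+ r″} {z ℤ.+ z′} {+ r ℤ.+ + r′}
        (C.sym m {z ℤ.+ z′} {+ r″} (remainder (z ℤ.+ z′)))
        (C.∙-cong m {z} {+ r} {z′} {+ r′} (remainder z) (remainder z′))))
    (reflexive (≡.sym (φ^-∘ r r′ x)))
    where
    r = z %ℕ m
    r′ = z′ %ℕ m
    r″ = (z ℤ.+ z′) %ℕ m

  act-ℕ : ∀ i x → act (+ i) x ≈ φ^ i x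
  act-ℕ i x = φ^-cong-mod (φ^-m x) ((+ i) %ℕ m) i (C.sym m {+ i} {+ ((+ i) %ℕ m)} (remainder (+ i)))

  Commutes : (Carrier → Carrier) → Set _
  Commutes f = ∀ x → f (φ x) ≈ φ (f x)

  commutes-φ^ : ∀ f → Commutes f → ∀ i x → f (φ^ i x) ≈ φ^ i (f x)
  commutes-φ^ f f-φ zero    x = refl
  commutes-φ^ f f-φ (suc i) x = trans (f-φ (φ^ i x)) (φ-cong (commutes-φ^ f f-φ i x))

  -- Maps as elements of the product of semidirect products

  𝒢 : Group _ _
  𝒢 = ∏ (Divisor m) (λ d → 𝒮⋉C^ (π K (proj₁ d)) (proj₁ d))
  private module 𝒢 = Group 𝒢

  base : (d : Divisor m) → Fin (π K (proj₁ d)) → Carrier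
  base (k , k∣m) = rep k k∣m

  base-period : ∀ d j → HasPeriod (proj₁ d) (base d j)
  base-period (k , k∣m) = rep-period k k∣m

  base-injective : ∀ d i i′ {j j′} → φ^ i (base d j) ≈ φ^ i′ (base d j′) → j ≡ j′
  base-injective (k , k∣m) i i′ = rep-injective k k∣m i i′

  abstract
    divisor : Carrier → Divisor m
    divisor x = proj₁ (period x) , period-∣m (proj₂ (period x))

    divisor-period : ∀ x → HasPeriod (proj₁ (divisor x)) x
    divisor-period x = proj₂ (period x)

  divisor-≡ : (d d′ : Divisor m) → proj₁ d ≡ proj₁ d′ → d ≡ d′
  divisor-≡ (k , k∣m) (_ , k∣m′) ≡.refl = ≡.cong (k ,_) (∣-irrelevant 1≤m k∣m k∣m′)

  coordinates : ∀ x → ∃[ j ] ∃[ i ] x ≈ φ^ i (base (divisor x) j)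
  coordinates x = locate (proj₁ (divisor x)) (proj₂ (divisor x)) (divisor-period x)

  permuted : 𝒢.Carrier → (d : Divisor m) → Fin (π K (proj₁ d)) → Fin (π K (proj₁ d))
  permuted g d j = proj₁ (g d) ⟨$⟩ʳ j

  twist : 𝒢.Carrier → (d : Divisor m) → Fin (π K (proj₁ d)) → ℤ
  twist g d = proj₂ (g d)

  image : 𝒢.Carrier → (d : Divisor m) → Fin (π K (proj₁ d)) → Carrier
  image g d j = act (twist g d j) (base d (permuted g d j))

  infix 4 _⊩_
  record _⊩_ (f : Carrier → Carrier) (g : 𝒢.Carrier) : Set ℓ′ where
    constructor represents
    field on-base : ∀ d j → f (base d j) ≈ image g d j
  open _⊩_

  image-fixed : ∀ g d j → φ^ (proj₁ d) (image g d j) ≈ image g d j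
  image-fixed g d j = trans (reflexive (φ^-comm (proj₁ d) (twist g d j %ℕ m) _))
    (act-cong (twist g d j) (fixed (base-period d _)))

  -- The permutation is recovered first, because distinct representatives lie in distinct orbits;
  -- then both twists act on the same element of period k and agree modulo k.
  image-injective : ∀ g g′ → (∀ d j → image g d j ≈ image g′ d j) → g 𝒢.≈ g′
  image-injective g g′ eq d =
    permuted≡ , λ j → act-injective (base-period d (permuted g d j)) (twist g d j) (twist g′ d j)
      (≡.subst (λ i → image g d j ≈ act (twist g′ d j) (base d i)) (≡.sym (permuted≡ j)) (eq d j))
    where
    permuted≡ : ∀ j → permuted g d j ≡ permuted g′ d j
    permuted≡ j = base-injective d (twist g d j %ℕ m) (twist g′ d j %ℕ m) (eq d j)

  ⊩-functional : ∀ {f f′ g g′} → (∀ x → f x ≈ f′ x) → f ⊩ g → f′ ⊩ g′ → g 𝒢.≈ g′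
  ⊩-functional {g = g} {g′} f≈f′ f⊩g f′⊩g′ = image-injective g g′ λ d j →
    trans (sym (on-base f⊩g d j)) (trans (f≈f′ (base d j)) (on-base f′⊩g′ d j))

  ⊩-resp : ∀ {f g g′} → f ⊩ g → g 𝒢.≈ g′ → f ⊩ g′
  ⊩-resp {f} {g} {g′} f⊩g g≈g′ = represents λ d j → begin
    f (base d j)                                     ≈⟨ on-base f⊩g d j ⟩
    act (twist g d j) (base d (permuted g d j))      ≡⟨ ≡.cong (act (twist g d j) ∘ base d) (proj₁ (g≈g′ d) j) ⟩
    act (twist g d j) (base d (permuted g′ d j))     ≈⟨ act-mod (proj₂ d) (fixed (base-period d _)) (twist g d j) (twist g′ d j) (proj₂ (g≈g′ d) j) ⟩
    image g′ d j                                     ∎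

  ⊩-∘ : ∀ {f f′} g g′ → (∀ {x y} → x ≈ y → f x ≈ f y) → Commutes f → f ⊩ g → f′ ⊩ g′ → f ∘ f′ ⊩ g 𝒢.∙ g′
  ⊩-∘ {f} {f′} g g′ f-cong f-φ f⊩g f′⊩g′ = represents λ d j → let i = permuted g′ d j
                                                                  z = twist g d i
                                                                  z′ = twist g′ d j
                                                                  y = base d (permuted g d i) in begin
    f (f′ (base d j))             ≈⟨ f-cong (on-base f′⊩g′ d j) ⟩
    f (act z′ (base d i))         ≈⟨ commutes-φ^ f f-φ (z′ %ℕ m) (base d i) ⟩
    act z′ (f (base d i))         ≈⟨ act-cong z′ (on-base f⊩g d i) ⟩
    -- Commuting with φ has moved the inner twist outside, while the product adds it on the right;
    -- powers of φ may be exchanged.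
    act z′ (act z y)              ≡⟨ φ^-comm (z′ %ℕ m) (z %ℕ m) y ⟩
    act z (act z′ y)              ≈⟨ act-+ z z′ y ⟨
    act (z ℤ.+ z′) y              ∎

  ⊩-id : id ⊩ 𝒢.ε
  ⊩-id = represents λ d j → sym (act-ℕ 0 (base d j))

  -- Every x is some φ^i of a representative, so a map commuting with φ is determined by its values
  -- on representatives.
  ⊩-determines : ∀ {f f′ g} → (∀ {x y} → x ≈ y → f x ≈ f y) → (∀ {x y} → x ≈ y → f′ x ≈ f′ y) →
                 Commutes f → Commutes f′ → f ⊩ g → f′ ⊩ g → ∀ x → f x ≈ f′ x
  ⊩-determines {f} {f′} {g} f-cong f′-cong f-φ f′-φ f⊩g f′⊩g x =
    let j , i , x≈ = coordinates x
        d = divisor x in begin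
    f x                      ≈⟨ f-cong x≈ ⟩
    f (φ^ i (base d j))      ≈⟨ commutes-φ^ f f-φ i (base d j) ⟩
    φ^ i (f (base d j))      ≈⟨ φ^-cong i (trans (on-base f⊩g d j) (sym (on-base f′⊩g d j))) ⟩
    φ^ i (f′ (base d j))     ≈⟨ commutes-φ^ f′ f′-φ i (base d j) ⟨
    f′ (φ^ i (base d j))     ≈⟨ f′-cong x≈ ⟨
    f′ x                     ∎

  -- From invertible maps to the product

  Tˣ : Group _ _
  Tˣ = T ˣ
  private module Tˣ = Group Tˣ

  apply : Tˣ.Carrier → Carrier → Carrier
  apply (f , _) = f ⟨$⟩_

  apply-cong : ∀ u {x y} → x ≈ y → apply u x ≈ apply u y
  apply-cong (f , _) = Func.cong (Map.func f)

  apply-commutes : ∀ u → Commutes (apply u)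
  apply-commutes (f , _) = HasBaseCoefficients⇒commutes (Map.hasBaseCoefficients f)

  apply-inverse : ∀ u x → apply (u Tˣ.⁻¹) (apply u x) ≈ x
  apply-inverse (_ , _ , f⁻¹f , _) = f⁻¹f

  apply-injective : ∀ u {x y} → apply u x ≈ apply u y → x ≈ y
  apply-injective u {x} {y} eq =
    trans (sym (apply-inverse u x)) (trans (apply-cong (u Tˣ.⁻¹) eq) (apply-inverse u y))

  -- An injective map commuting with φ leaves unchanged which powers of φ fix an element; orbits
  -- therefore go to orbits of the same length, and the map splits over the divisors k.
  apply-period : ∀ u {k x} → HasPeriod k x → HasPeriod k (apply u x)
  apply-period u {k} {x} per = hasPeriod (positive per)
    (trans (sym (commutes-φ^ (apply u) (apply-commutes u) k x)) (apply-cong u (fixed per)))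
    (λ e e-fixed → minimal per e
      (apply-injective u (trans (commutes-φ^ (apply u) (apply-commutes u) e x) e-fixed)))

  private
    abstract
      located : ∀ u d j → ∃[ j′ ] ∃[ i ] apply u (base d j) ≈ φ^ i (base d j′)
      located u (k , k∣m) j = locate k k∣m (apply-period u (rep-period k k∣m j))

    target : Tˣ.Carrier → (d : Divisor m) → Fin (π K (proj₁ d)) → Fin (π K (proj₁ d))
    target u d j = proj₁ (located u d j)

    -- Applying v after u returns to the representative of j, so j″ and j have a common orbit,
    -- whatever exponents were chosen on the way.
    target-inverse : ∀ u v → (∀ x → apply v (apply u x) ≈ x) → ∀ d j → target v d (target u d j) ≡ j
    target-inverse u v vu≈id d j =
      let j′ , i , u≈ = located u d j
          j″ , i′ , v≈ = located v d j′ in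
      base-injective d (i ℕ.+ i′) 0 (begin
        φ^ (i ℕ.+ i′) (base d j″)        ≡⟨ φ^-∘ i i′ (base d j″) ⟨
        φ^ i (φ^ i′ (base d j″))         ≈⟨ φ^-cong i v≈ ⟨
        φ^ i (apply v (base d j′))       ≈⟨ commutes-φ^ (apply v) (apply-commutes v) i (base d j′) ⟨
        apply v (φ^ i (base d j′))       ≈⟨ apply-cong v u≈ ⟨
        apply v (apply u (base d j))     ≈⟨ vu≈id (base d j) ⟩
        base d j                         ∎)

  toProduct : Tˣ.Carrier → 𝒢.Carrier
  toProduct u d =
    Perm.permutation (target u d) (target (u Tˣ.⁻¹) d)
      (target-inverse (u Tˣ.⁻¹) u (apply-inverse (u Tˣ.⁻¹)) d)
      (target-inverse u (u Tˣ.⁻¹) (apply-inverse u) d) ,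
    λ j → + (proj₁ (proj₂ (located u d j)))

  toProduct-⊩ : ∀ u → apply u ⊩ toProduct u
  toProduct-⊩ u = represents λ d j → let j′ , i , u≈ = located u d j in
    trans u≈ (sym (act-ℕ i (base d j′)))

  -- From the product to invertible maps

  extend : 𝒢.Carrier → Carrier → Carrier
  extend g x = let j , i , _ = coordinates x in φ^ i (image g (divisor x) j)

  orbit-period : ∀ {k x y} i → x ≈ φ^ i y → HasPeriod k y → HasPeriod k x
  orbit-period {k} i x≈ per = hasPeriod (positive per)
    (trans (φ^-cong k x≈) (trans (reflexive (φ^-comm k i _)) (trans (φ^-cong i (fixed per)) (sym x≈))))
    (λ e e-fixed → minimal per e (φ^-injective i (trans (reflexive (φ^-comm i e _))
      (trans (φ^-cong e (sym x≈)) (trans e-fixed x≈)))))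

  -- Independence of the chosen coordinates, which may differ even for equal elements: the period
  -- fixes the divisor, the orbit fixes j, and the exponent is unique modulo k, which suffices
  -- because the image is fixed by φ^k.
  extend-φ^ : ∀ g d j i {x} → x ≈ φ^ i (base d j) → extend g x ≈ φ^ i (image g d j)
  extend-φ^ g d j i {x} x≈ = same-orbit d
    (divisor-≡ (divisor x) d (period-unique (divisor-period x) (orbit-period i x≈ (base-period d j))))
    j x≈ (coordinates x)
    where
    same-orbit : ∀ d → divisor x ≡ d → ∀ j → x ≈ φ^ i (base d j) →
                 (c : ∃[ j′ ] ∃[ i′ ] x ≈ φ^ i′ (base (divisor x) j′)) →
                 φ^ (proj₁ (proj₂ c)) (image g (divisor x) (proj₁ c)) ≈ φ^ i (image g d j)
    same-orbit d ≡.refl j x≈ (j′ , i′ , x≈′) = same-rep (base-injective d i′ i (trans (sym x≈′) x≈)) x≈′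
      where
      same-rep : ∀ {j′} → j′ ≡ j → x ≈ φ^ i′ (base d j′) → φ^ i′ (image g d j′) ≈ φ^ i (image g d j)
      same-rep ≡.refl x≈′ = φ^-cong-mod (image-fixed g d j) i′ i
        (φ^-injective-mod (base-period d j) i′ i (trans (sym x≈′) x≈))

  extend-cong : ∀ g {x y} → x ≈ y → extend g x ≈ extend g y
  extend-cong g {x} {y} x≈y = let j , i , y≈ = coordinates y in
    extend-φ^ g (divisor y) j i (trans x≈y y≈)

  extend-commutes : ∀ g → Commutes (extend g)
  extend-commutes g x = let j , i , x≈ = coordinates x in
    extend-φ^ g (divisor x) j (suc i) (φ-cong x≈)

  extend-⊩ : ∀ g → extend g ⊩ g
  extend-⊩ g = represents λ d j → extend-φ^ g d j 0 refl

  -- The composite and the identity both represent the neutral element, so they agree as maps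
  -- commuting with φ.
  extend-inverse : ∀ g h → g 𝒢.∙ h 𝒢.≈ 𝒢.ε → ∀ x → extend g (extend h x) ≈ x
  extend-inverse g h gh≈ε = ⊩-determines
    (λ x≈y → extend-cong g (extend-cong h x≈y)) id
    (λ x → trans (extend-cong g (extend-commutes h x)) (extend-commutes g (extend h x))) (λ _ → refl)
    (⊩-resp (⊩-∘ g h (extend-cong g) (extend-commutes g) (extend-⊩ g) (extend-⊩ h)) gh≈ε) ⊩-id

  extend-fixed : ∀ g k {x} → φ^ k x ≈ x → φ^ k (extend g x) ≈ extend g x
  extend-fixed g k {x} fixed =
    trans (sym (commutes-φ^ (extend g) (extend-commutes g) k x)) (extend-cong g fixed)

  extend-fixed⁻ : ∀ g k {x} → φ^ k (extend g x) ≈ extend g x → φ^ k x ≈ x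
  extend-fixed⁻ g k {x} fixed = begin
    φ^ k x                                    ≈⟨ φ^-cong k (inv x) ⟨
    φ^ k (extend (g 𝒢.⁻¹) (extend g x))       ≈⟨ extend-fixed (g 𝒢.⁻¹) k fixed ⟩
    extend (g 𝒢.⁻¹) (extend g x)              ≈⟨ inv x ⟩
    x                                         ∎
    where inv = extend-inverse (g 𝒢.⁻¹) g (𝒢.inverseˡ g)

  extendMap : 𝒢.Carrier → Map
  extendMap g = record
    { func = record { to = extend g ; cong = extend-cong g }
    ; subfieldPreserving = record
      { base  = λ x∈ → fixed⇒InBase (extend-fixed g 1 (InBase⇒fixed x∈))
      -- Lying outside a subfield is preserved because the inverse extension commutes with φ too: a
      -- power of φ fixing the image fixes x.
      ; tower = λ d s d∣m s∣m → λ { (x∈d , x∉s) →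
          fixed⇒∈𝔽 d d∣m (divisor-positive d∣m) (extend-fixed g d (∈𝔽⇒fixed d x∈d)) ,
          λ fx∈s → x∉s (fixed⇒∈𝔽 s s∣m (divisor-positive s∣m)
            (extend-fixed⁻ g s (∈𝔽⇒fixed s fx∈s))) }
      }
    ; hasBaseCoefficients = commutes⇒HasBaseCoefficients (extend-cong g) (extend-commutes g)
    }

  fromProduct : 𝒢.Carrier → Tˣ.Carrier
  fromProduct g = extendMap g , extendMap (g 𝒢.⁻¹) ,
    extend-inverse (g 𝒢.⁻¹) g (𝒢.inverseˡ g) , extend-inverse g (g 𝒢.⁻¹) (𝒢.inverseʳ g)

  -- The isomorphism of groups

  toProduct-homo : ∀ u v → toProduct (u Tˣ.∙ v) 𝒢.≈ toProduct u 𝒢.∙ toProduct v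
  toProduct-homo u v = ⊩-functional (λ _ → refl) (toProduct-⊩ (u Tˣ.∙ v))
    (⊩-∘ (toProduct u) (toProduct v) (apply-cong u) (apply-commutes u) (toProduct-⊩ u) (toProduct-⊩ v))

  toProduct-cong : ∀ {u v} → u Tˣ.≈ v → toProduct u 𝒢.≈ toProduct v
  toProduct-cong {u} {v} u≈v = ⊩-functional u≈v (toProduct-⊩ u) (toProduct-⊩ v)

  toProduct-ε : toProduct Tˣ.ε 𝒢.≈ 𝒢.ε
  toProduct-ε = ⊩-functional (λ _ → refl) (toProduct-⊩ Tˣ.ε) ⊩-id

  isomorphism : Tˣ ≅ 𝒢
  isomorphism = toProduct , record
    { isGroupMonomorphism = record
      { isGroupHomomorphism = record
        { isMonoidHomomorphism = record
          { isMagmaHomomorphism = record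
            { isRelHomomorphism = record { cong = λ {u} {v} → toProduct-cong {u} {v} }
            ; homo              = toProduct-homo
            }
          ; ε-homo = toProduct-ε
          }
        ; ⁻¹-homo = λ u → GroupProperties.inverseˡ-unique 𝒢 (toProduct (u Tˣ.⁻¹)) (toProduct u)
            (𝒢.trans {toProduct (u Tˣ.⁻¹) 𝒢.∙ toProduct u} {toProduct (u Tˣ.⁻¹ Tˣ.∙ u)} {𝒢.ε}
              (𝒢.sym {toProduct (u Tˣ.⁻¹ Tˣ.∙ u)} {toProduct (u Tˣ.⁻¹) 𝒢.∙ toProduct u}
                (toProduct-homo (u Tˣ.⁻¹) u))
              (𝒢.trans {toProduct (u Tˣ.⁻¹ Tˣ.∙ u)} {toProduct Tˣ.ε} {𝒢.ε}
                (toProduct-cong {u Tˣ.⁻¹ Tˣ.∙ u} {Tˣ.ε} (Tˣ.inverseˡ u)) toProduct-ε))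
        }
      ; injective = λ {u} {v} eq → ⊩-determines (apply-cong u) (apply-cong v)
          (apply-commutes u) (apply-commutes v) (⊩-resp (toProduct-⊩ u) eq) (toProduct-⊩ v)
      }
    ; surjective = λ g → fromProduct g , λ {u} u≈ →
        ⊩-functional u≈ (toProduct-⊩ u) (extend-⊩ g)
    }

open import Data.Nat.Base using (_^_)

corollary14 :
  {c ℓ c′ ℓ′ : Level} (q m : ℕ) → IsPrimePower q → 1 ≤ m →
  (K : FiniteField c ℓ q) (L : FiniteField c′ ℓ′ (q ^ m)) →
  (ι : FiniteField.Carrier K → FiniteField.Carrier L) →
  (ι-hom : IsRingHomomorphism (FiniteField.rawRing K) (FiniteField.rawRing L) ι) →
  (SubfieldPreservingMaps.T q m K L ι ι-hom) ˣ ≅ ∏ (Divisor m) (λ k → 𝒮⋉C^ (π K (proj₁ k)) (proj₁ k))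
corollary14 q m _ 1≤m K L ι ι-hom = Coordinates.isomorphism q m 1≤m K L ι ι-hom
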